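{- Let $(T_{start},T_{end},k)$ be an input instance, where $T_{start}$ and $T_{end}$ are two triangulations of a set $\mathcal P$ of points in the Euclidean plane and $k$ is an integer. The algorithm FLIPDT (described in the context) is correct, i.e. it meets its specification: it returns YES if there exists a sequence of flips of length $k$ that transforms $T_{start}$ into $T_{end}$, and otherwise it returns NO. Moreover, FLIPDT runs in time $O^{*}(k\cdot 32^{k})$.
   Context: Let $\mathcal P$ be a set of $n$ points in the Euclidean plane. A triangulation of $\mathcal P$ is a maximal planar subdivision with vertex set $\mathcal P$. If an edge $e$ of a triangulation is a diagonal of a convex quadrilateral in it, flipping $e$ means deleting $e$ and inserting the other diagonal of that quadrilateral; otherwise flipping $e$ is not allowed. An edge of the current triangulation that does not belong to $T_{end}$ is called necessary. The notation $O^{*}(\cdot)$ suppresses factors polynomial in the input size. Actions. The edge being operated on is the current edge. An action of type (i) moves from the current edge to one of the (at most four) edges sharing a triangle with it in the current triangulation. An action of type (ii) flips the current edge and moves back to the previous edge of the flipped edge in the current walk (a walk is a sequence of edges, beginning with the starting edge, in which any two consecutive edges share a triangle). Algorithm FLIPDT$(T_{start},T_{end},k)$. Number the points of $\mathcal P$ from $1$ to $n$ arbitrarily and label each edge by the pair of numbers of its endpoints, so that edges can be ordered lexicographically. For each ordered partition (composition) $(k_1,\dots,k_t)$ of $k$ with $k_1+\dots+k_t=k$ and all $k_i\ge 1$, let $O_{lex}$ be the lexicographically ordered list of the necessary edges of $T_{start}$, and perform the following branching search with iterations $i=1,\dots,t$, starting from $T=T_{start}$ and $i=1$. In iteration $i$,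 with current triangulation $T$: repeatedly pick the next edge of $O_{lex}$ until finding an edge $e$ that is a necessary edge of $T$; if the end of $O_{lex}$ is reached without finding one, replace $O_{lex}$ by the lexicographically ordered list of all necessary edges of $T$ and let $e$ be its first edge. Then branch over every possible sequence of actions of length $2k_i-1$ consisting of $k_i$ actions of type (ii) and $k_i-1$ actions of type (i), whose last action is of type (ii), and such that in every prefix of the sequence with its last action removed the number of actions of type (i) is not less than the number of actions of type (ii). For each such sequence, perform it on $T$ starting from $e$, obtaining a triangulation $T'$. If $i<t$, continue with iteration $i+1$ on $T'$; if $i=t$ and $T'=T_{end}$, return YES. If no branch under any partition returns YES, return NO.
   Formalization: The answer YES is proved when k is the flip distance (a sequence of length k exists and none is shorter); for larger k the claim fails, e.g. T_start = T_end a triangulated convex quadrilateral and k = 2, where no necessary edge exists and FLIPDT returns NO. -}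

module Defs where

open import Level using (Level; _⊔_) renaming (suc to lsuc)
open import Algebra.Bundles using (CommutativeRing)
open import Data.Bool.Base using (Bool; true; false; if_then_else_; not; _∨_; _∧_)
open import Data.Fin.Base as Fin using (Fin)
import Data.Fin.Properties as Fin
open import Data.List.Base using (List; []; _∷_; filter; allFin; uncons)
open import Data.List.Membership.Propositional using (_∈_)
open import Data.List.Relation.Binary.Subset.Propositional using (_⊆_)
open import Data.List.Relation.Unary.Unique.Propositional using (Unique)
open import Data.Maybe.Base using (Maybe; just; nothing; maybe′)
import Data.Nat.Base as ℕ
open import Data.Nat.Base using (ℕ; zero; suc; pred)
import Data.Nat.Properties as ℕ
open import Data.Product.Base using (∃-syntax; ∃₂; _×_; _,_)
open import Data.Product.Properties using (≡-dec)
open import Data.Sum.Base using (_⊎_)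
open import Relation.Binary.Core using (Rel)
open import Relation.Binary.Definitions using (DecidableEquality)
open import Relation.Binary.Structures using (IsStrictTotalOrder)
open import Relation.Binary.PropositionalEquality.Core using (_≡_; _≢_)
open import Relation.Nullary using (¬_; does; ¬?)

-- The library has no real numbers, so the coordinates are taken in an
-- arbitrary ordered field; the Euclidean plane is the case of ℝ.  The
-- trichotomy contained in IsStrictTotalOrder is the unit-cost comparison
-- of coordinates of the real RAM.

record OrderedField (a ℓ : Level) : Set (lsuc (a ⊔ ℓ)) where
  infix 4 _<_ _≤_
  field
    commutativeRing : CommutativeRing a ℓ
  open CommutativeRing commutativeRing public
  field
    _<_                : Rel Carrier ℓ
    isStrictTotalOrder : IsStrictTotalOrder _≈_ _<_
    0<1                : 0# < 1#
    +-monoˡ-<          : ∀ {x y} z → x < y → (x + z) < (y + z)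
    *-pos              : ∀ {x y} → 0# < x → 0# < y → 0# < (x * y)
    inverse            : ∀ x → ¬ (x ≈ 0#) → ∃[ y ] (x * y) ≈ 1#

  open IsStrictTotalOrder isStrictTotalOrder public using (compare; _<?_)

  _≤_ : Rel Carrier ℓ
  x ≤ y = ¬ (y < x)

module _ {a ℓ} (F : OrderedField a ℓ) where
  open OrderedField F

  Point : Set a
  Point = Carrier × Carrier

  infix 4 _≈ₚ_
  _≈ₚ_ : Rel Point ℓ
  (x , y) ≈ₚ (x′ , y′) = (x ≈ x′) × (y ≈ y′)

  -- Twice the signed area of the triangle q r s; it is positive exactly when
  -- q r s is a left turn.
  det : Point → Point → Point → Carrier
  det (x₁ , y₁) (x₂ , y₂) (x₃ , y₃) =
    ((x₂ - x₁) * (y₃ - y₁)) - ((y₂ - y₁) * (x₃ - x₁))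

  OnSegment : Point → Point → Point → Set (a ⊔ ℓ)
  OnSegment (x , y) (x₁ , y₁) (x₂ , y₂) =
    ∃₂ λ s t → (0# ≤ s) × (0# ≤ t) × ((s + t) ≈ 1#)
             × (x ≈ ((s * x₁) + (t * x₂)))
             × (y ≈ ((s * y₁) + (t * y₂)))

-- The numbering of the points is that of Fin n, and an edge is labelled by
-- the numbers of its endpoints, the smaller one first.

Edge : ℕ → Set
Edge n = Fin n × Fin n

edge : ∀ {n} → Fin n → Fin n → Edge n
edge i j = if does (i Fin.<? j) then (i , j) else (j , i)

_≟ᴱ_ : ∀ {n} → DecidableEquality (Edge n)
_≟ᴱ_ = ≡-dec Fin._≟_ Fin._≟_

_≤ˡᵉˣ_ : ∀ {n} → Edge n → Edge n → Bool
(i , j) ≤ˡᵉˣ (i′ , j′) =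
  does (i Fin.<? i′) ∨ (does (i Fin.≟ i′) ∧ does (j Fin.≤? j′))

infix 4 _≐_
_≐_ : ∀ {n} → Rel (List (Edge n)) _
T ≐ T′ = (T ⊆ T′) × (T′ ⊆ T)

module Triangulations {a ℓ} (F : OrderedField a ℓ) {n : ℕ} (p : Fin n → Point F) where
  open OrderedField F using (0#; _<_)

  OnEdge : Point F → Edge n → Set (a ⊔ ℓ)
  OnEdge x (i , j) = OnSegment F x (p i) (p j)

  record PlanarSubdivision (T : List (Edge n)) : Set (a ⊔ ℓ) where
    field
      ordered  : ∀ {i j} → (i , j) ∈ T → i Fin.< j
      vertices : ∀ {i j} → (i , j) ∈ T → ∀ v → OnEdge (p v) (i , j) → v ≡ i ⊎ v ≡ j
      meet     : ∀ {e f} → e ∈ T → f ∈ T → e ≢ f →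
                 ∀ x → OnEdge x e → OnEdge x f → ∃[ v ] _≈ₚ_ F x (p v)

  record IsTriangulation (T : List (Edge n)) : Set (a ⊔ ℓ) where
    field
      unique  : Unique T
      planar  : PlanarSubdivision T
      maximal : ∀ e → PlanarSubdivision (e ∷ T) → e ∈ T

  Left : Fin n → Fin n → Fin n → Set ℓ
  Left i j k = 0# < det F (p i) (p j) (p k)

  Inside : Fin n → Fin n → Fin n → Fin n → Set ℓ
  Inside v i j k = Left i j v × Left j k v × Left k i v

  -- The triangular faces, listed counterclockwise: in a planar subdivision a
  -- 3-cycle bounds a face iff it has no vertex in its interior.
  record Triangle (T : List (Edge n)) (i j k : Fin n) : Set ℓ where
    field
      ccw   : Left i j k
      ij    : edge i j ∈ T
      jk    : edge j k ∈ T
      ki    : edge k i ∈ T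
      empty : ∀ v → ¬ Inside v i j k

  ConvexQuadrilateral : Fin n → Fin n → Fin n → Fin n → Set ℓ
  ConvexQuadrilateral i j k l = Left i j k × Left j k l × Left k l i × Left l i j

  record Flip (T : List (Edge n)) (e : Edge n) (T′ : List (Edge n)) : Set ℓ where
    field
      {i j k l} : Fin n
      diagonal  : e ≡ edge i j
      left      : Triangle T i j k
      right     : Triangle T j i l
      convex    : ConvexQuadrilateral i l j k
      result    : T′ ≡ edge k l ∷ filter (λ f → ¬? (f ≟ᴱ e)) T

  -- Intermediate triangulations are lists built by flips, so only the last one
  -- has to be compared up to the order of its edges.
  data FlipSequence : List (Edge n) → ℕ → List (Edge n) → Set ℓ where
    done : ∀ {T T′} → T ≐ T′ → FlipSequence T 0 T′
    flip : ∀ {T T′ T″ e m} → Flip T e T′ → FlipSequence T′ m T″ →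
           FlipSequence T (suc m) T″

  -- Minimality cannot be dropped in the completeness of FLIPDT below: for
  -- T = T′ the diagonal of a convex quadrilateral can be flipped and flipped
  -- back, but FLIPDT has no necessary edge to start from and answers NO for 2.
  IsFlipDistance : List (Edge n) → List (Edge n) → ℕ → Set ℓ
  IsFlipDistance T T′ k =
    FlipSequence T k T′ × (∀ m → m ℕ.< k → ¬ FlipSequence T m T′)

-- Values paired with the number of unit-cost steps spent on them.  A comparison
-- of two point numbers or labels, an orientation test and each element visited
-- in a list traversal cost one step.
record Timed (A : Set) : Set where
  constructor timed
  field
    steps : ℕ
    value : A

open Timed public

infixl 1 _>>=_
infixr 6 _∧ᵗ_
infixr 5 _∨ᵗ_

return : ∀ {A} → A → Timed A
return = timed 0

_>>=_ : ∀ {A B} → Timed A → (A → Timed B) → Timed B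
m >>= f = timed (steps m ℕ.+ steps (f (value m))) (value (f (value m)))

tick : ∀ {A} → Timed A → Timed A
tick m = timed (suc (steps m)) (value m)

step : ∀ {A} → A → Timed A
step x = tick (return x)

notᵗ : Timed Bool → Timed Bool
notᵗ m = m >>= λ b → return (not b)

_∧ᵗ_ _∨ᵗ_ : Timed Bool → Timed Bool → Timed Bool
m ∧ᵗ m′ = m >>= λ b → if b then m′ else return false
m ∨ᵗ m′ = m >>= λ b → if b then return true else m′

anyᵗ allᵗ : ∀ {A : Set} → (A → Timed Bool) → List A → Timed Bool
anyᵗ f []       = step false
anyᵗ f (x ∷ xs) = tick (f x ∨ᵗ anyᵗ f xs)
allᵗ f []       = step true
allᵗ f (x ∷ xs) = tick (f x ∧ᵗ allᵗ f xs)

mapᵗ : ∀ {A B : Set} → (A → B) → List A → Timed (List B)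
mapᵗ f []       = step []
mapᵗ f (x ∷ xs) = tick (mapᵗ f xs >>= λ ys → return (f x ∷ ys))

filterᵗ : ∀ {A : Set} → (A → Timed Bool) → List A → Timed (List A)
filterᵗ f []       = step []
filterᵗ f (x ∷ xs) =
  tick (f x >>= λ b → filterᵗ f xs >>= λ ys → return (if b then x ∷ ys else ys))

appendᵗ : ∀ {A : Set} → List A → List A → Timed (List A)
appendᵗ []       ys = step ys
appendᵗ (x ∷ xs) ys = tick (appendᵗ xs ys >>= λ zs → return (x ∷ zs))

pattern YES = true
pattern NO  = false

incHead : List ℕ → List ℕ
incHead []       = []
incHead (k ∷ ks) = suc k ∷ ks

-- The ordered partitions of k.  The only one of 0 is the empty one.
compositions : ℕ → Timed (List (List ℕ))
compositions 0             = step ([] ∷ [])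
compositions 1             = step ((1 ∷ []) ∷ [])
compositions (suc (suc k)) =
  compositions (suc k)  >>= λ c →
  mapᵗ (1 ∷_) c         >>= λ c₁ →
  mapᵗ incHead c        >>= λ c₂ →
  appendᵗ c₁ c₂

insertᵗ : ∀ {n} → Edge n → List (Edge n) → Timed (List (Edge n))
insertᵗ e []       = step (e ∷ [])
insertᵗ e (f ∷ fs) =
  tick (if e ≤ˡᵉˣ f then return (e ∷ f ∷ fs)
        else (insertᵗ e fs >>= λ gs → return (f ∷ gs)))

sortᵗ : ∀ {n} → List (Edge n) → Timed (List (Edge n))
sortᵗ []       = step []
sortᵗ (e ∷ es) = tick (sortᵗ es >>= insertᵗ e)

memberᵗ : ∀ {n} → Edge n → List (Edge n) → Timed Bool
memberᵗ e = anyᵗ (λ f → step (does (e ≟ᴱ f)))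

subsetᵗ : ∀ {n} → List (Edge n) → List (Edge n) → Timed Bool
subsetᵗ T T′ = allᵗ (λ e → memberᵗ e T′) T

module Algorithm {a ℓ} (F : OrderedField a ℓ) {n : ℕ} (p : Fin n → Point F)
                 (Tend : List (Edge n)) where
  open OrderedField F using (0#; _<?_)

  points : Timed (List (Fin n))
  points = timed n (allFin n)

  leftᵗ : Fin n → Fin n → Fin n → Timed Bool
  leftᵗ i j k = step (does (0# <? det F (p i) (p j) (p k)))

  insideᵗ : Fin n → Fin n → Fin n → Fin n → Timed Bool
  insideᵗ v i j k = leftᵗ i j v ∧ᵗ leftᵗ j k v ∧ᵗ leftᵗ k i v

  triangleᵗ : List (Edge n) → Fin n → Fin n → Fin n → Timed Bool
  triangleᵗ T i j k =
       leftᵗ i j k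
    ∧ᵗ memberᵗ (edge i j) T
    ∧ᵗ memberᵗ (edge j k) T
    ∧ᵗ memberᵗ (edge k i) T
    ∧ᵗ (points >>= allᵗ λ v → notᵗ (insideᵗ v i j k))

  convexᵗ : Fin n → Fin n → Fin n → Fin n → Timed Bool
  convexᵗ i j k l = leftᵗ i j k ∧ᵗ leftᵗ j k l ∧ᵗ leftᵗ k l i ∧ᵗ leftᵗ l i j

  -- The apexes of the triangles of T lying to the left of the edge from i to j.
  apexes : List (Edge n) → Fin n → Fin n → Timed (List (Fin n))
  apexes T i j = points >>= filterᵗ (triangleᵗ T i j)

  -- The targets of an action of type (i).
  neighbours : List (Edge n) → Edge n → Timed (List (Edge n))
  neighbours T (i , j) =
    apexes T i j              >>= λ ks →
    apexes T j i              >>= λ ls →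
    appendᵗ ks ls             >>= λ ms →
    mapᵗ (edge i) ms          >>= λ es →
    mapᵗ (edge j) ms          >>= λ fs →
    appendᵗ es fs

  flipQuadrilateral : List (Edge n) → Edge n → List (Fin n) → List (Fin n) →
                      Timed (Maybe (List (Edge n)))
  flipQuadrilateral T (i , j) (k ∷ _) (l ∷ _) =
    convexᵗ i l j k >>= λ b →
    if b
    then (filterᵗ (λ f → step (not (does (f ≟ᴱ (i , j))))) T >>= λ T₀ →
          return (just (edge k l ∷ T₀)))
    else return nothing
  flipQuadrilateral T _ _ _ = step nothing

  flipᵗ : List (Edge n) → Edge n → Timed (Maybe (List (Edge n)))
  flipᵗ T (i , j) =
    apexes T i j >>= λ ks →
    apexes T j i >>= λ ls →
    flipQuadrilateral T (i , j) ks ls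

  whenJust : ∀ {A : Set} → Timed (Maybe A) → (A → Timed Bool) → Timed Bool
  whenJust m κ = tick (m >>= maybe′ κ (return NO))

  -- An action of type (ii) at the current edge e, where the walk before e is w
  -- (latest edge first).
  flipBack : List (Edge n) → Edge n → List (Edge n) →
             (List (Edge n) → Edge n → List (Edge n) → Timed Bool) → Timed Bool
  flipBack T e []        κ = step NO
  flipBack T e (e′ ∷ w′) κ = whenJust (flipᵗ T e) (λ T′ → κ T′ e′ w′)

  -- Branch over the ways to perform r further actions of type (i) and s further
  -- actions of type (ii); κ is run on each resulting triangulation.  The whole
  -- sequence has one action of type (ii) more than of type (i), so "performed (i)
  -- ≥ performed (ii)" is "remaining (i) < remaining (ii)".  This holds for every
  -- prefix except the whole sequence, and makes the last action one of type (ii).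
  branch : (r s : ℕ) → List (Edge n) → Edge n → List (Edge n) →
           (List (Edge n) → Timed Bool) → Timed Bool
  branch _       zero          T e w κ = step NO
  branch zero    (suc zero)    T e w κ = whenJust (flipᵗ T e) κ
  branch zero    (suc (suc s)) T e w κ =
    flipBack T e w (λ T′ e′ w′ → branch zero (suc s) T′ e′ w′ κ)
  branch (suc r) (suc s)       T e w κ =
       (neighbours T e >>= anyᵗ (λ g → branch r (suc s) T g (e ∷ w) κ))
    ∨ᵗ (if does (suc r ℕ.<? s)
        then flipBack T e w (λ T′ e′ w′ → branch (suc r) s T′ e′ w′ κ)
        else step NO)

  necessaryEdges : List (Edge n) → Timed (List (Edge n))
  necessaryEdges T = filterᵗ (λ e → notᵗ (memberᵗ e Tend)) T >>= sortᵗ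

  nextNecessary : List (Edge n) → List (Edge n) →
                  Timed (Maybe (Edge n × List (Edge n)))
  nextNecessary T []      = step nothing
  nextNecessary T (e ∷ O) =
    tick ((memberᵗ e T ∧ᵗ notᵗ (memberᵗ e Tend)) >>= λ b →
          if b then return (just (e , O)) else nextNecessary T O)

  -- The chosen edge and the rest of O_lex, or nothing if T has no necessary edge.
  pick : List (Edge n) → List (Edge n) → Timed (Maybe (Edge n × List (Edge n)))
  pick T O =
    nextNecessary T O >>=
    maybe′ (λ eO → return (just eO))
           (necessaryEdges T >>= λ O′ → step (uncons O′))

  iterations : List ℕ → List (Edge n) → List (Edge n) → Timed Bool
  iterations []       T O = subsetᵗ T Tend ∧ᵗ subsetᵗ Tend T
  iterations (k ∷ ks) T O =
    whenJust (pick T O) λ (e , O′) →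
    branch (pred k) k T e [] (λ T′ → iterations ks T′ O′)

  search : List (Edge n) → ℕ → Timed Bool
  search Tstart k =
    compositions k >>=
    anyᵗ (λ ks → necessaryEdges Tstart >>= iterations ks Tstart)

record Instance {a ℓ} (F : OrderedField a ℓ) : Set (a ⊔ ℓ) where
  field
    n        : ℕ
    p        : Fin n → Point F
    distinct : ∀ {i j} → _≈ₚ_ F (p i) (p j) → i ≡ j
  open Triangulations F p public
  field
    Tstart Tend : List (Edge n)
    triStart    : IsTriangulation Tstart
    triEnd      : IsTriangulation Tend
    k           : ℕ

FLIPDT : ∀ {a ℓ} {F : OrderedField a ℓ} → Instance F → Timed Bool
FLIPDT {F = F} I = Algorithm.search F p Tend Tstart k
  where open Instance I

-- The polynomial factor is majorised by c (1 + size)ᵈ.  The maximum with 1 only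
-- matters where the bound vanishes.
O* : ∀ {a} {A : Set a} (size time bound : A → ℕ) → Set a
O* size time bound =
  ∃₂ λ c d → ∀ x → time x ℕ.≤ c ℕ.* suc (size x) ℕ.^ d ℕ.* (1 ℕ.⊔ bound x)

{-# OPTIONS --safe #-}

-- Completeness: let a shortest flip sequence from T to Tend be given, and let e
-- be a necessary edge of T; the sequence flips e.  If no earlier flip changes the
-- quadrilateral of e, the flip of e commutes to the front.  Otherwise the first
-- flip that does so flips an edge g which in T shares a triangle with e: move to
-- g, bring its flip to the front recursively, return to e and continue.  The moves
-- and flips made this way form an action sequence whose last action flips e, and
-- what remains of the flip sequence is shorter by exactly the flips performed, so
-- the next iteration starts from a shortest sequence again.  Minimality and the
-- invariance of the number of edges ensure that a necessary edge exists until
-- Tend is reached.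
--
-- The geometry is reduced to signs of orientation determinants and the
-- three-term Plücker relation: flips preserve that no two edges cross and that no
-- vertex lies on an edge, which makes the two triangles at an edge unique.
--
-- Time: the action sequences with k flips number at most 16ᵏ / 8, which leaves
-- room for the work between two iterations, and there are at most 2ᵏ compositions
-- of k.
module Submission where

open import Defs
open import Data.Product.Base using (_×_)
open import Relation.Binary.PropositionalEquality.Core using (_≡_)
open import Relation.Nullary using (¬_)

open import Algebra.Bundles using (CommutativeRing; RawRing)
import Algebra.Properties.AbelianGroup
import Algebra.Properties.CommutativeSemigroup
import Algebra.Properties.Ring
import Algebra.Properties.Semiring.Mult
import Algebra.Solver.Ring
open import Algebra.Solver.Ring.AlmostCommutativeRing
  using (fromCommutativeRing; _-Raw-AlmostCommutative⟶_; Induced-equivalence)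
open import Data.Bool.Base using (Bool; true; false; if_then_else_; not)
open import Data.Empty using (⊥; ⊥-elim)
open import Data.Fin.Base as Fin using (Fin)
import Data.Fin.Properties as Fin
open import Data.List.Base using (List; []; _∷_; _++_; allFin; cartesianProduct; filter; length; map; uncons)
open import Data.List.Membership.Propositional using (_∈_; _∉_)
open import Data.List.Membership.Propositional.Properties
  using (∈-filter⁺; ∈-filter⁻; ∈-++⁻; ∈-++⁺ˡ; ∈-++⁺ʳ; ∈-map⁺; ∈-map⁻; ∈-allFin; ∈-cartesianProduct⁺)
import Data.List.Membership.DecPropositional as DecMembership
open import Data.List.Properties using (filter-notAll; length-++; length-map; length-tabulate)
open import Data.List.Relation.Unary.All as All using (All; []; _∷_)
open import Data.List.Relation.Unary.AllPairs using ([]; _∷_)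
open import Data.List.Relation.Unary.Any as Any using (here; there)
open import Data.List.Relation.Unary.Unique.Propositional using (Unique)
open import Data.List.Relation.Unary.Unique.Propositional.Properties using (Unique[x∷xs]⇒x∉xs; allFin⁺; filter⁺)
open import Data.Maybe.Base using (Maybe; just; nothing; maybe′)
open import Data.Maybe.Properties using (just-injective)
open import Data.Nat.Base as ℕ using (ℕ; zero; suc; pred; z≤n; s≤s)
open import Data.Nat.ListAction using (sum)
import Data.Nat.Properties as ℕ
open import Data.Nat.Solver using (module +-*-Solver)
open import Data.Product.Base using (_,_; ∃-syntax; proj₁; proj₂)
open import Data.Sum.Base as Sum using (_⊎_; inj₁; inj₂; [_,_]′)
open import Function.Base using (_∘_; case_of_)
open import Relation.Binary.Definitions using (DecidableEquality; WeaklyDecidable; tri<; tri≈; tri>)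
open import Relation.Binary.PropositionalEquality as ≡ using (_≢_; module ≡-Reasoning)
import Relation.Binary.Reasoning.Setoid
open import Relation.Binary.Structures using (IsStrictTotalOrder)
open import Relation.Nullary using (Dec; yes; no; contradiction; does; ¬?)
open import Relation.Nullary.Decidable using (dec-true; dec-false)

-- The prefix condition turns an action sequence into a bracket word: a move to g opens a bracket,
-- the flip of g closes it by returning to the edge left, and the flip of the necessary edge at the
-- very end is the one unmatched flip. The recursion of "bring the flip of g to the front, return to
-- e, continue" produces exactly such words, which is why `Visit` is defined by the same recursion
-- and has one flip more than moves. Reordering flips is feasible because emptiness of a triangle
-- depends on the points alone: a triangle persists as long as its three sides do, so two flips
-- interfere only through the edges that they remove. Carrying `IsTriangulation` through the flips
-- would require maximality and intersections of segments again and again. `Embedded` is weaker, is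
-- stated by signs only, and still determines the apexes at an edge, which is what reordering and
-- the four targets of a move rest on. The bound 16^k / 8 for k = d + 1 is 4^d choices of targets
-- times 2^(2d+1) arrangements of d moves and d + 1 flips.

-- Ring normalisation must recognise the cancellation x - x = 0, so the
-- coefficients are integers, represented by formal differences m - n.
module DifferenceSolver {c ℓ} (R : CommutativeRing c ℓ) where
  open CommutativeRing R
  open Algebra.Properties.Ring ring using (x[y-z]≈xy-xz; [y-z]x≈yx-zx)
  open Algebra.Properties.AbelianGroup +-abelianGroup
    using (⁻¹-∙-comm; ⁻¹-anti-homo‿-; ε⁻¹≈ε)
  open Algebra.Properties.CommutativeSemigroup +-commutativeSemigroup using (interchange)
  open Algebra.Properties.Semiring.Mult semiring using (×-homo-+; ×1-homo-*)
    renaming (_×_ to _×′_)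
  open Relation.Binary.Reasoning.Setoid setoid

  ⟦_⟧ᴺ : ℕ → Carrier
  ⟦ m ⟧ᴺ = m ×′ 1#

  ⟦_⟧ᴰ : ℕ × ℕ → Carrier
  ⟦ m , n ⟧ᴰ = ⟦ m ⟧ᴺ - ⟦ n ⟧ᴺ

  differences : RawRing _ _
  differences = record
    { Carrier = ℕ × ℕ
    ; _≈_ = _≡_
    ; _+_ = λ (m , n) (m′ , n′) → m ℕ.+ m′ , n ℕ.+ n′
    ; _*_ = λ (m , n) (m′ , n′) → m ℕ.* m′ ℕ.+ n ℕ.* n′ , n ℕ.* m′ ℕ.+ m ℕ.* n′
    ; -_  = λ (m , n) → n , m
    ; 0#  = 0 , 0
    ; 1#  = 1 , 0
    }

  +-- : ∀ x y z w → (x + y) - (z + w) ≈ (x - z) + (y - w)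
  +-- x y z w = begin
    (x + y) - (z + w)      ≈⟨ +-congˡ (sym (⁻¹-∙-comm z w)) ⟩
    (x + y) + (- z + - w)  ≈⟨ interchange x y (- z) (- w) ⟩
    (x - z) + (y - w)      ∎

  *-- : ∀ x y z w → (x * z + y * w) - (y * z + x * w) ≈ (x - y) * (z - w)
  *-- x y z w = begin
    (x * z + y * w) - (y * z + x * w)      ≈⟨ +-- _ _ _ _ ⟩
    (x * z - y * z) + (y * w - x * w)      ≈⟨ +-congˡ (⁻¹-anti-homo‿- _ _) ⟨
    (x * z - y * z) - (x * w - y * w)      ≈⟨ +-cong ([y-z]x≈yx-zx z x y) (-‿cong ([y-z]x≈yx-zx w x y)) ⟨
    (x - y) * z - (x - y) * w              ≈⟨ x[y-z]≈xy-xz (x - y) z w ⟨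
    (x - y) * (z - w)                      ∎

  morphism : differences -Raw-AlmostCommutative⟶ fromCommutativeRing R
  morphism = record
    { ⟦_⟧    = ⟦_⟧ᴰ
    ; +-homo = λ (m , n) (m′ , n′) → trans
        (+-cong (×-homo-+ 1# m m′) (-‿cong (×-homo-+ 1# n n′)))
        (+-- _ _ _ _)
    ; *-homo = λ (m , n) (m′ , n′) → trans
        (+-cong (homo m m′ n n′) (-‿cong (homo n m′ m n′)))
        (*-- _ _ _ _)
    ; -‿homo = λ (m , n) → sym (⁻¹-anti-homo‿- _ _)
    ; 0-homo = -‿inverseʳ 0#
    ; 1-homo = trans (+-congˡ ε⁻¹≈ε) (trans (+-identityʳ _) (+-identityʳ 1#))
    }
    where
    homo : ∀ m m′ n n′ → ⟦ m ℕ.* m′ ℕ.+ n ℕ.* n′ ⟧ᴺ ≈ ⟦ m ⟧ᴺ * ⟦ m′ ⟧ᴺ + ⟦ n ⟧ᴺ * ⟦ n′ ⟧ᴺ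
    homo m m′ n n′ = trans (×-homo-+ 1# (m ℕ.* m′) (n ℕ.* n′))
      (+-cong (×1-homo-* m m′) (×1-homo-* n n′))

  _≟ᴰ_ : WeaklyDecidable (Induced-equivalence morphism)
  (m , n) ≟ᴰ (m′ , n′) with m ℕ.+ n′ ℕ.≟ m′ ℕ.+ n
  ... | no  _  = nothing
  ... | yes eq = just (begin
    ⟦ m ⟧ᴺ - ⟦ n ⟧ᴺ                        ≈⟨ cancel _ _ ⟨
    (⟦ m ⟧ᴺ - ⟦ n ⟧ᴺ) + (⟦ n′ ⟧ᴺ - ⟦ n′ ⟧ᴺ)  ≈⟨ +-- _ _ _ _ ⟨
    (⟦ m ⟧ᴺ + ⟦ n′ ⟧ᴺ) - (⟦ n ⟧ᴺ + ⟦ n′ ⟧ᴺ)  ≈⟨ +-cong sums (-‿cong (+-comm _ _)) ⟩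
    (⟦ m′ ⟧ᴺ + ⟦ n ⟧ᴺ) - (⟦ n′ ⟧ᴺ + ⟦ n ⟧ᴺ)  ≈⟨ +-- _ _ _ _ ⟩
    (⟦ m′ ⟧ᴺ - ⟦ n′ ⟧ᴺ) + (⟦ n ⟧ᴺ - ⟦ n ⟧ᴺ)  ≈⟨ cancel _ _ ⟩
    ⟦ m′ ⟧ᴺ - ⟦ n′ ⟧ᴺ                      ∎)
    where
    cancel : ∀ x y → x + (y - y) ≈ x
    cancel x y = trans (+-congˡ (-‿inverseʳ y)) (+-identityʳ x)
    sums : ⟦ m ⟧ᴺ + ⟦ n′ ⟧ᴺ ≈ ⟦ m′ ⟧ᴺ + ⟦ n ⟧ᴺ
    sums = trans (sym (×-homo-+ 1# m n′))
      (trans (reflexive (≡.cong (_×′ 1#) eq)) (×-homo-+ 1# m′ n))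

  open Algebra.Solver.Ring differences (fromCommutativeRing R) morphism _≟ᴰ_ public
    using (solve; _:=_; _:+_; _:*_; _:-_; :-_; con)

-- Signs of sums and products in an ordered field.

module OrderedFieldProperties {a ℓ} (F : OrderedField a ℓ) where
  open OrderedField F
  open IsStrictTotalOrder isStrictTotalOrder
    using (irrefl; asym; <-respˡ-≈; <-respʳ-≈) renaming (trans to <-trans)
  open Algebra.Properties.Ring ring using (-‿distribʳ-*)
  open Algebra.Properties.AbelianGroup +-abelianGroup using (⁻¹-involutive)

  pos-cong : ∀ {x y} → x ≈ y → 0# < x → 0# < y
  pos-cong = <-respʳ-≈

  pos⇒≉0 : ∀ {x} → 0# < x → ¬ (x ≈ 0#)
  pos⇒≉0 0<x x≈0 = irrefl (sym x≈0) 0<x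

  +-pos : ∀ {x y} → 0# < x → 0# < y → 0# < x + y
  +-pos {x} {y} 0<x 0<y = <-trans 0<y (<-respˡ-≈ (+-identityˡ y) (+-monoˡ-< y 0<x))

  neg⇒-pos : ∀ {x} → x < 0# → 0# < - x
  neg⇒-pos {x} x<0 = <-respˡ-≈ (-‿inverseʳ x) (<-respʳ-≈ (+-identityˡ (- x)) (+-monoˡ-< (- x) x<0))

  pos⇒-neg : ∀ {x} → 0# < x → - x < 0#
  pos⇒-neg {x} 0<x = <-respʳ-≈ (-‿inverseʳ x) (<-respˡ-≈ (+-identityˡ (- x)) (+-monoˡ-< (- x) 0<x))

  pos⇒-≯0 : ∀ {x} → 0# < x → ¬ (0# < - x)
  pos⇒-≯0 0<x 0<-x = asym 0<-x (pos⇒-neg 0<x)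

  pos-or-zero : ∀ {x y} → 0# < x → 0# < y ⊎ y ≈ 0# → 0# < x + y
  pos-or-zero 0<x (inj₁ 0<y) = +-pos 0<x 0<y
  pos-or-zero 0<x (inj₂ y≈0) = pos-cong (sym (trans (+-congˡ y≈0) (+-identityʳ _))) 0<x

  abstract
    +-pos⁻¹ : ∀ {x y} → 0# < x + y → 0# < x ⊎ 0# < y
    +-pos⁻¹ {x} {y} 0<x+y with compare 0# x | compare 0# y
    ... | tri< 0<x _ _ | _            = inj₁ 0<x
    ... | tri≈ _ _ _   | tri< 0<y _ _ = inj₂ 0<y
    ... | tri> _ _ _   | tri< 0<y _ _ = inj₂ 0<y
    ... | tri≈ _ 0≈x _ | tri≈ _ 0≈y _ =
      contradiction (trans (+-cong (sym 0≈x) (sym 0≈y)) (+-identityʳ 0#)) (pos⇒≉0 0<x+y)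
    ... | tri≈ _ 0≈x _ | tri> _ _ y<0 =
      contradiction (<-trans 0<x+y (<-respˡ-≈ (trans (sym (+-identityˡ y)) (+-congʳ 0≈x)) y<0)) (irrefl refl)
    ... | tri> _ _ x<0 | tri≈ _ 0≈y _ =
      contradiction (<-trans 0<x+y (<-respˡ-≈ (trans (sym (+-identityʳ x)) (+-congˡ 0≈y)) x<0)) (irrefl refl)
    ... | tri> _ _ x<0 | tri> _ _ y<0 =
      contradiction (<-trans 0<x+y (<-trans (+-monoˡ-< y x<0) (<-respˡ-≈ (sym (+-identityˡ y)) y<0)))
          (irrefl refl)

    *-pos⁻¹ : ∀ {x y} → 0# < x * y → 0# < x → 0# < y
    *-pos⁻¹ {x} {y} 0<xy 0<x with compare 0# y
    ... | tri< 0<y _ _ = 0<y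
    ... | tri≈ _ 0≈y _ = contradiction (trans (*-congˡ (sym 0≈y)) (zeroʳ x)) (pos⇒≉0 0<xy)
    ... | tri> _ _ y<0 = contradiction
      (pos-cong (sym (-‿distribʳ-* x y)) (*-pos 0<x (neg⇒-pos y<0))) (pos⇒-≯0 0<xy)

    *-zero⁻¹ : ∀ {x y} → 0# < x → x * y ≈ 0# → y ≈ 0#
    *-zero⁻¹ {x} {y} 0<x xy≈0 with compare 0# y
    ... | tri< 0<y _ _ = contradiction xy≈0 (pos⇒≉0 (*-pos 0<x 0<y))
    ... | tri≈ _ 0≈y _ = sym 0≈y
    ... | tri> _ _ y<0 = contradiction
      (trans (sym (-‿distribʳ-* x y)) (trans (-‿cong xy≈0) ε⁻¹≈ε)) (pos⇒≉0 (*-pos 0<x (neg⇒-pos y<0)))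
      where open Algebra.Properties.AbelianGroup +-abelianGroup using (ε⁻¹≈ε)

    pos-inverse : ∀ {x} → 0# < x → ∃[ y ] 0# < y × x * y ≈ 1#
    pos-inverse {x} 0<x with inverse x (pos⇒≉0 0<x)
    ... | y , xy≈1 = y , *-pos⁻¹ (pos-cong (sym xy≈1) 0<1) 0<x , xy≈1

-- Labels of edges.

module _ {n : ℕ} where

  edge-cases : (i j : Fin n) → edge i j ≡ (i , j) ⊎ edge i j ≡ (j , i)
  edge-cases i j with does (i Fin.<? j)
  ... | true  = inj₁ ≡.refl
  ... | false = inj₂ ≡.refl

  edge-ordered : {i j : Fin n} → i Fin.< j → edge i j ≡ (i , j)
  edge-ordered {i} {j} i<j = ≡.cong (if_then (i , j) else (j , i)) (dec-true (i Fin.<? j) i<j)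

  edge-unordered : {i j : Fin n} → ¬ i Fin.< j → edge i j ≡ (j , i)
  edge-unordered {i} {j} i≮j = ≡.cong (if_then (i , j) else (j , i)) (dec-false (i Fin.<? j) i≮j)

  edge-sym : (i j : Fin n) → edge i j ≡ edge j i
  edge-sym i j with Fin.<-cmp i j
  ... | tri< i<j _ j≮i    = ≡.trans (edge-ordered i<j) (≡.sym (edge-unordered j≮i))
  ... | tri≈ _   ≡.refl _ = ≡.refl
  ... | tri> i≮j _ j<i    = ≡.trans (edge-unordered i≮j) (≡.sym (edge-ordered j<i))

  edge-injective : ∀ {i j k l : Fin n} → edge i j ≡ edge k l →
                   (i ≡ k × j ≡ l) ⊎ (i ≡ l × j ≡ k)
  edge-injective {i} {j} {k} {l} eq with edge-cases i j | edge-cases k l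
  ... | inj₁ p | inj₁ q with ≡.trans (≡.sym p) (≡.trans eq q)
  ...   | ≡.refl = inj₁ (≡.refl , ≡.refl)
  edge-injective eq | inj₁ p | inj₂ q with ≡.trans (≡.sym p) (≡.trans eq q)
  ...   | ≡.refl = inj₂ (≡.refl , ≡.refl)
  edge-injective eq | inj₂ p | inj₁ q with ≡.trans (≡.sym p) (≡.trans eq q)
  ...   | ≡.refl = inj₂ (≡.refl , ≡.refl)
  edge-injective eq | inj₂ p | inj₂ q with ≡.trans (≡.sym p) (≡.trans eq q)
  ...   | ≡.refl = inj₁ (≡.refl , ≡.refl)

  -- `Flip` speaks of labels of the form `edge i j`, the algorithm of arbitrary pairs. The soundness
  -- proofs carry this predicate along the walk to pass from the latter to the former.
  Canonical : Edge n → Set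
  Canonical (i , j) = edge i j ≡ (i , j)

  edge-canonical : (i j : Fin n) → Canonical (edge i j)
  edge-canonical i j with edge-cases i j
  ... | inj₁ p rewrite p = p
  ... | inj₂ p rewrite p = ≡.trans (edge-sym j i) p

-- Orientation determinants and embedded edge sets.

module Orientations {a ℓ} (F : OrderedField a ℓ) {n : ℕ} (p : Fin n → Point F) where
  open OrderedField F
  open OrderedFieldProperties F
  open DifferenceSolver commutativeRing
  open Triangulations F p
  open IsStrictTotalOrder isStrictTotalOrder using (asym)

  X Y : Fin n → Carrier
  X i = proj₁ (p i)
  Y i = proj₂ (p i)

  [_,_,_] : Fin n → Fin n → Fin n → Carrier
  [ i , j , k ] = det F (p i) (p j) (p k)

  Collinear : Fin n → Fin n → Fin n → Set ℓ
  Collinear i j k = [ i , j , k ] ≈ 0#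

  abstract
    rotate-det : ∀ i j k → [ i , j , k ] ≈ [ j , k , i ]
    rotate-det i j k = solve 6 (λ x₁ y₁ x₂ y₂ x₃ y₃ →
        (x₂ :- x₁) :* (y₃ :- y₁) :- (y₂ :- y₁) :* (x₃ :- x₁)
        := (x₃ :- x₂) :* (y₁ :- y₂) :- (y₃ :- y₂) :* (x₁ :- x₂)) refl
      (X i) (Y i) (X j) (Y j) (X k) (Y k)

    swap-det : ∀ i j k → - [ i , j , k ] ≈ [ j , i , k ]
    swap-det i j k = solve 6 (λ x₁ y₁ x₂ y₂ x₃ y₃ →
        :- ((x₂ :- x₁) :* (y₃ :- y₁) :- (y₂ :- y₁) :* (x₃ :- x₁))
        := (x₁ :- x₂) :* (y₃ :- y₂) :- (y₁ :- y₂) :* (x₃ :- x₂)) refl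
      (X i) (Y i) (X j) (Y j) (X k) (Y k)

    split-det : ∀ i j k v → [ i , j , k ] ≈ [ i , j , v ] + ([ j , k , v ] + [ k , i , v ])
    split-det i j k v = solve 8 (λ x₁ y₁ x₂ y₂ x₃ y₃ x₄ y₄ →
        (x₂ :- x₁) :* (y₃ :- y₁) :- (y₂ :- y₁) :* (x₃ :- x₁)
        := ((x₂ :- x₁) :* (y₄ :- y₁) :- (y₂ :- y₁) :* (x₄ :- x₁))
        :+ (((x₃ :- x₂) :* (y₄ :- y₂) :- (y₃ :- y₂) :* (x₄ :- x₂))
        :+ ((x₁ :- x₃) :* (y₄ :- y₃) :- (y₁ :- y₃) :* (x₄ :- x₃)))) refl
      (X i) (Y i) (X j) (Y j) (X k) (Y k)
      (X v) (Y v)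

    -- The relation between the 2 × 2 minors of the four vectors from x to a, b, c, d. Most
    -- geometric steps below use it to deduce the sign of one orientation about x from those of the
    -- other five.
    plücker : ∀ x a b c d →
      [ x , a , b ] * [ x , c , d ] + [ x , a , d ] * [ x , b , c ] ≈ [ x , a , c ] * [ x , b , d ]
    plücker x a b c d = solve 8 (λ x₁ y₁ x₂ y₂ x₃ y₃ x₄ y₄ →
        (x₁ :* y₂ :- y₁ :* x₂) :* (x₃ :* y₄ :- y₃ :* x₄)
        :+ (x₁ :* y₄ :- y₁ :* x₄) :* (x₂ :* y₃ :- y₂ :* x₃)
        := (x₁ :* y₃ :- y₁ :* x₃) :* (x₂ :* y₄ :- y₂ :* x₄)) refl
      (X a - X x) (Y a - Y x)
      (X b - X x) (Y b - Y x)
      (X c - X x) (Y c - Y x)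
      (X d - X x) (Y d - Y x)

  rot : ∀ {i j k} → Left i j k → Left j k i
  rot {i} {j} {k} = pos-cong (rotate-det i j k)

  rot² : ∀ {i j k} → Left i j k → Left k i j
  rot² ijk = rot (rot ijk)

  rotᶜ : ∀ {i j k} → Collinear i j k → Collinear j k i
  rotᶜ {i} {j} {k} = trans (sym (rotate-det i j k))

  swapᶜ : ∀ {i j k} → Collinear i j k → Collinear j i k
  swapᶜ {i} {j} {k} c = trans (sym (swap-det i j k)) (trans (-‿cong c) ε⁻¹≈ε)
    where open Algebra.Properties.AbelianGroup +-abelianGroup using (ε⁻¹≈ε)

  Left-asym : ∀ {i j k} → Left i j k → ¬ Left j i k
  Left-asym {i} {j} {k} ijk jik = pos⇒-≯0 ijk (pos-cong (sym (swap-det i j k)) jik)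

  Left⇒¬Collinear : ∀ {i j k} → Left i j k → ¬ Collinear i j k
  Left⇒¬Collinear = pos⇒≉0

  ¬Left-iik : ∀ {i k} → ¬ Left i i k
  ¬Left-iik iik = Left-asym iik iik
  data Orientation (i j k : Fin n) : Set ℓ where
    leftTurn  : Left i j k → Orientation i j k
    straight  : Collinear i j k → Orientation i j k
    rightTurn : Left j i k → Orientation i j k

  orientation : ∀ i j k → Orientation i j k
  orientation i j k with compare 0# [ i , j , k ]
  ... | tri< ijk _ _ = leftTurn ijk
  ... | tri≈ _ ijk _ = straight (sym ijk)
  ... | tri> _ _ ijk = rightTurn (pos-cong (swap-det i j k) (neg⇒-pos ijk))

  NonNegative : Carrier → Set ℓ
  NonNegative x = 0# < x ⊎ x ≈ 0#

  sum-Left : ∀ {x a b c d} →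
    0# < [ x , a , b ] * [ x , c , d ] → NonNegative ([ x , a , d ] * [ x , b , c ]) →
    0# < [ x , a , c ] * [ x , b , d ]
  sum-Left {x} {a} {b} {c} {d} q r = pos-cong (plücker x a b c d) (pos-or-zero q r)

  sum-Right : ∀ {x a b c d} →
    NonNegative ([ x , a , b ] * [ x , c , d ]) → 0# < [ x , a , d ] * [ x , b , c ] →
    0# < [ x , a , c ] * [ x , b , d ]
  sum-Right {x} {a} {b} {c} {d} q r =
    pos-cong (trans (+-comm _ _) (plücker x a b c d)) (pos-or-zero r q)

  swapʳ-det : ∀ x a b → - [ x , a , b ] ≈ [ x , b , a ]
  swapʳ-det x a b = trans (swap-det x a b) (rotate-det a x b)

  mul⁻ : ∀ {x a b c d} → Left x b a → Left x d c → 0# < [ x , a , b ] * [ x , c , d ]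
  mul⁻ {x} {a} {b} {c} {d} xba xdc = pos-cong
    (trans (*-cong (sym (swapʳ-det x a b)) (sym (swapʳ-det x c d)))
      (solve 2 (λ u v → (:- u) :* (:- v) := u :* v) refl [ x , a , b ] [ x , c , d ]))
    (*-pos xba xdc)

  cancelˡ : ∀ {x a b c d} → 0# < [ x , a , b ] * [ x , c , d ] → Left x a b → Left x c d
  cancelˡ = *-pos⁻¹

  cancelˡ⁻ : ∀ {x a b c d} → 0# < [ x , a , b ] * [ x , c , d ] → Left x b a → Left x d c
  cancelˡ⁻ {x} {a} {b} {c} {d} q xba = *-pos⁻¹ (pos-cong
    (trans (solve 2 (λ u v → u :* v := (:- u) :* (:- v)) refl [ x , a , b ] [ x , c , d ])
      (*-cong (swapʳ-det x a b) (swapʳ-det x c d))) q) xba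

  cancelʳ : ∀ {x a b c d} → 0# < [ x , a , b ] * [ x , c , d ] → Left x c d → Left x a b
  cancelʳ q = cancelˡ (pos-cong (*-comm _ _) q)

  cancelʳ⁻ : ∀ {x a b c d} → 0# < [ x , a , b ] * [ x , c , d ] → Left x d c → Left x b a
  cancelʳ⁻ q = cancelˡ⁻ (pos-cong (*-comm _ _) q)
  zeroʳ-det : ∀ {x a b c d} → Collinear x c d → [ x , a , b ] * [ x , c , d ] ≈ 0#
  zeroʳ-det xcd = trans (*-congˡ xcd) (zeroʳ _)

  abstract
    -- Cramer's rule: the vector from a to i, scaled by `[ a , b , k ]`, equals `[ a , b , i ]`
    -- times the vector from a to k plus `[ k , i , a ]` times the vector from b to a. Both
    -- coefficients vanish and the scale is positive.
    lines-meet : ∀ {a b i k} → Left a b k → Collinear a b i → Collinear k i a → _≈ₚ_ F (p i) (p a)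
    lines-meet {a} {b} {i} {k} abk abi kia =
      coordinate (*-zero⁻¹ abk (trans
        (solve 8 (λ x₁ y₁ x₂ y₂ x₃ y₃ x₄ y₄ →
          ((x₂ :- x₁) :* (y₄ :- y₁) :- (y₂ :- y₁) :* (x₄ :- x₁)) :* (x₃ :- x₁)
          := ((x₂ :- x₁) :* (y₃ :- y₁) :- (y₂ :- y₁) :* (x₃ :- x₁)) :* (x₄ :- x₁)
          :+ ((x₃ :- x₄) :* (y₁ :- y₄) :- (y₃ :- y₄) :* (x₁ :- x₄)) :* (x₁ :- x₂)) refl
          (X a) (Y a) (X b) (Y b) (X i) (Y i) (X k) (Y k)) vanish))
      , coordinate (*-zero⁻¹ abk (trans
        (solve 8 (λ x₁ y₁ x₂ y₂ x₃ y₃ x₄ y₄ →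
          ((x₂ :- x₁) :* (y₄ :- y₁) :- (y₂ :- y₁) :* (x₄ :- x₁)) :* (y₃ :- y₁)
          := ((x₂ :- x₁) :* (y₃ :- y₁) :- (y₂ :- y₁) :* (x₃ :- x₁)) :* (y₄ :- y₁)
          :+ ((x₃ :- x₄) :* (y₁ :- y₄) :- (y₃ :- y₄) :* (x₁ :- x₄)) :* (y₁ :- y₂)) refl
          (X a) (Y a) (X b) (Y b) (X i) (Y i) (X k) (Y k)) vanish))
      where
      vanish : ∀ {u v} → [ a , b , i ] * u + [ k , i , a ] * v ≈ 0#
      vanish = trans (+-cong (trans (*-congʳ abi) (zeroˡ _)) (trans (*-congʳ kia) (zeroˡ _)))
        (+-identityˡ 0#)
      coordinate : ∀ {u v} → u - v ≈ 0# → u ≈ v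
      coordinate = Algebra.Properties.AbelianGroup.x∙y⁻¹≈ε⇒x≈y +-abelianGroup _ _

  -- A proper crossing, with k on the left of the line from i to j. Crossings of the other
  -- handedness are `Cross j i k l`, so `noCross` covers them because `edge` is symmetric.
  Cross : (i j k l : Fin n) → Set ℓ
  Cross i j k l = Left i j k × Left j i l × Left k l j × Left l k i

  -- The part of planarity that flips can be seen to preserve by signs of
  -- orientations alone.  In noVertex, v lies strictly between i and j, since the
  -- line from v to w separates them.
  record Embedded (T : List (Edge n)) : Set ℓ where
    field
      canonical : ∀ {e} → e ∈ T → Canonical e
      noCross   : ∀ {i j k l} → edge i j ∈ T → edge k l ∈ T → ¬ Cross i j k l
      noVertex  : ∀ {i j v w} → edge i j ∈ T → Collinear i j v → Left v w i → ¬ Left w v j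

  open Embedded public

  abstract
    -- The distances of i and j from the line through v and w, normalised to sum 1, are the
    -- barycentric coordinates: `α + β` times v is `β` times i plus `α` times j, up to a multiple of
    -- `[ i , j , v ]`, which vanishes.
    between⇒OnSegment : ∀ {i j v w} → Collinear i j v → Left v w i → Left w v j →
                        OnSegment F (p v) (p i) (p j)
    between⇒OnSegment {i} {j} {v} {w} ijv vwi wvj with pos-inverse (+-pos vwi wvj)
    ... | δ , 0<δ , γδ≈1 =
      [ w , v , j ] * δ , [ v , w , i ] * δ
      , asym (*-pos wvj 0<δ) , asym (*-pos vwi 0<δ)
      , trans (solve 3 (λ α β δ → β :* δ :+ α :* δ := (α :+ β) :* δ) refl _ _ δ) γδ≈1
      , coordinate (solve 8 (λ x₁ y₁ x₂ y₂ x₃ y₃ x₄ y₄ →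
          (((x₄ :- x₃) :* (y₁ :- y₃) :- (y₄ :- y₃) :* (x₁ :- x₃))
          :+ ((x₃ :- x₄) :* (y₂ :- y₄) :- (y₃ :- y₄) :* (x₂ :- x₄))) :* x₃
          := (((x₃ :- x₄) :* (y₂ :- y₄) :- (y₃ :- y₄) :* (x₂ :- x₄)) :* x₁
          :+ ((x₄ :- x₃) :* (y₁ :- y₃) :- (y₄ :- y₃) :* (x₁ :- x₃)) :* x₂)
          :+ ((x₂ :- x₁) :* (y₃ :- y₁) :- (y₂ :- y₁) :* (x₃ :- x₁)) :* (x₄ :- x₃)) refl
          (X i) (Y i) (X j) (Y j) (X v) (Y v) (X w) (Y w))
      , coordinate (solve 8 (λ x₁ y₁ x₂ y₂ x₃ y₃ x₄ y₄ →
          (((x₄ :- x₃) :* (y₁ :- y₃) :- (y₄ :- y₃) :* (x₁ :- x₃))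
          :+ ((x₃ :- x₄) :* (y₂ :- y₄) :- (y₃ :- y₄) :* (x₂ :- x₄))) :* y₃
          := (((x₃ :- x₄) :* (y₂ :- y₄) :- (y₃ :- y₄) :* (x₂ :- x₄)) :* y₁
          :+ ((x₄ :- x₃) :* (y₁ :- y₃) :- (y₄ :- y₃) :* (x₁ :- x₃)) :* y₂)
          :+ ((x₂ :- x₁) :* (y₃ :- y₁) :- (y₂ :- y₁) :* (x₃ :- x₁)) :* (y₄ :- y₃)) refl
          (X i) (Y i) (X j) (Y j) (X v) (Y v) (X w) (Y w))
      where
      open Relation.Binary.Reasoning.Setoid setoid
      α β : Carrier
      α = [ v , w , i ] ; β = [ w , v , j ]
      coordinate : ∀ {z z₁ z₂ r} → (α + β) * z ≈ (β * z₁ + α * z₂) + [ i , j , v ] * r →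
                   z ≈ (β * δ) * z₁ + (α * δ) * z₂
      coordinate {z} {z₁} {z₂} {r} eq = begin
        z                                            ≈⟨ *-identityˡ z ⟨
        1# * z                                       ≈⟨ *-congʳ γδ≈1 ⟨
        ((α + β) * δ) * z                            ≈⟨ solve 3
            (λ γ δ z → (γ :* δ) :* z := δ :* (γ :* z)) refl (α + β) δ z ⟩
        δ * ((α + β) * z)                            ≈⟨ *-congˡ eq ⟩
        δ * ((β * z₁ + α * z₂) + [ i , j , v ] * r)  ≈⟨ *-congˡ
            (trans (+-congˡ (trans (*-congʳ ijv) (zeroˡ r))) (+-identityʳ _)) ⟩
        δ * (β * z₁ + α * z₂)                        ≈⟨ solve 5
            (λ δ β z₁ α z₂ → δ :* (β :* z₁ :+ α :* z₂) := (β :* δ) :* z₁ :+ (α :* δ) :* z₂) refl δ β z₁ α z₂ ⟩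
        (β * δ) * z₁ + (α * δ) * z₂                  ∎

    -- The weights of i and j are their distances from the line kl, exchanged, and those of k and l
    -- their distances from ij. Either diagonal cuts the quadrilateral into two triangles of the
    -- same total area, so `α + β` and `γ + δ` agree and one inverse `ε` normalises both pairs.
    cross⇒intersection : ∀ {i j k l} → Cross i j k l →
      ∃[ x ] OnSegment F x (p i) (p j) × OnSegment F x (p k) (p l)
    cross⇒intersection {i} {j} {k} {l} (ijk , jil , klj , lki) with pos-inverse (+-pos lki klj)
    ... | ε , 0<ε , γε≈1 =
      (β * ε * X i + α * ε * X j , β * ε * Y i + α * ε * Y j)
      , ( β * ε , α * ε , asym (*-pos klj 0<ε) , asym (*-pos lki 0<ε)
        , trans (solve 3 (λ α β ε → β :* ε :+ α :* ε := (α :+ β) :* ε) refl α β ε) γε≈1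
        , refl , refl)
      , ( δ * ε , γ * ε , asym (*-pos jil 0<ε) , asym (*-pos ijk 0<ε)
        , trans (trans (solve 3 (λ α β ε → β :* ε :+ α :* ε := (α :+ β) :* ε) refl γ δ ε)
            (*-congʳ γ+δ≈α+β)) γε≈1
        , coordinate (solve 6 (λ u₁ u₂ v₁ v₂ w₁ w₂ →
            (w₁ :* v₂ :- w₂ :* v₁) :* u₁ :+ (u₁ :* w₂ :- u₂ :* w₁) :* v₁
            := (u₁ :* v₂ :- u₂ :* v₁) :* w₁) refl
            (X i - X k) (Y i - Y k) (X j - X k) (Y j - Y k) (X l - X k) (Y l - Y k))
        , coordinate (solve 6 (λ u₁ u₂ v₁ v₂ w₁ w₂ →
            (w₁ :* v₂ :- w₂ :* v₁) :* u₂ :+ (u₁ :* w₂ :- u₂ :* w₁) :* v₂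
            := (u₁ :* v₂ :- u₂ :* v₁) :* w₂) refl
            (X i - X k) (Y i - Y k) (X j - X k) (Y j - Y k) (X l - X k) (Y l - Y k)))
      where
      open Relation.Binary.Reasoning.Setoid setoid
      α β γ δ : Carrier
      α = [ l , k , i ] ; β = [ k , l , j ] ; γ = [ i , j , k ] ; δ = [ j , i , l ]
      γ+δ≈α+β : γ + δ ≈ α + β
      γ+δ≈α+β = begin
        γ + δ                                              ≈⟨ +-cong (split-det i j k l)
            (sym (swap-det i j l)) ⟩
        [ i , j , l ] + ([ j , k , l ] + [ k , i , l ]) - [ i , j , l ]
          ≈⟨ solve 3 (λ x y z → x :+ (y :+ z) :- x := z :+ y) refl _ _ _ ⟩
        [ k , i , l ] + [ j , k , l ]                      ≈⟨ +-cong (sym (rotate-det l k i))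
            (rotate-det j k l) ⟩
        α + β                                              ∎
      -- Coordinates relative to k, in which the four areas are cross products of
      -- the vectors to i, j and l.
      coordinate : ∀ {z₁ z₂ z₃ z₄} →
        β * (z₁ - z₃) + [ k , i , l ] * (z₂ - z₃) ≈ [ k , i , j ] * (z₄ - z₃) →
        β * ε * z₁ + α * ε * z₂ ≈ δ * ε * z₃ + γ * ε * z₄
      coordinate {z₁} {z₂} {z₃} {z₄} eq = begin
        β * ε * z₁ + α * ε * z₂
          ≈⟨ solve 6 (λ α β ε z₁ z₂ z₃ → β :* ε :* z₁ :+ α :* ε :* z₂
               := ε :* ((β :* (z₁ :- z₃) :+ α :* (z₂ :- z₃)) :+ (α :+ β) :* z₃)) refl α β ε z₁ z₂ z₃ ⟩
        ε * ((β * (z₁ - z₃) + α * (z₂ - z₃)) + (α + β) * z₃)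
          ≈⟨ *-congˡ (+-cong (trans (+-congˡ (*-congʳ (rotate-det l k i)))
              (trans eq (*-congʳ (rotate-det k i j)))) (*-congʳ (sym γ+δ≈α+β))) ⟩
        ε * (γ * (z₄ - z₃) + (γ + δ) * z₃)
          ≈⟨ solve 5 (λ γ δ ε z₃ z₄ → ε :* (γ :* (z₄ :- z₃) :+ (γ :+ δ) :* z₃)
               := δ :* ε :* z₃ :+ γ :* ε :* z₄) refl γ δ ε z₃ z₄ ⟩
        δ * ε * z₃ + γ * ε * z₄ ∎

  OnSegment-sym : ∀ {x y z} → OnSegment F x y z → OnSegment F x z y
  OnSegment-sym (s , t , 0≤s , 0≤t , s+t≈1 , eq₁ , eq₂) =
    t , s , 0≤t , 0≤s , trans (+-comm t s) s+t≈1 , trans eq₁ (+-comm _ _) , trans eq₂ (+-comm _ _)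

  OnSegment-resp : ∀ {x x′ y z} → _≈ₚ_ F x x′ → OnSegment F x y z → OnSegment F x′ y z
  OnSegment-resp (e₁ , e₂) (s , t , 0≤s , 0≤t , s+t≈1 , eq₁ , eq₂) =
    s , t , 0≤s , 0≤t , s+t≈1 , trans (sym e₁) eq₁ , trans (sym e₂) eq₂

  OnEdge-edge : ∀ {x} i j → OnSegment F x (p i) (p j) → OnEdge x (edge i j)
  OnEdge-edge i j on with edge-cases i j
  ... | inj₁ eq = ≡.subst (OnEdge _) (≡.sym eq) on
  ... | inj₂ eq = ≡.subst (OnEdge _) (≡.sym eq) (OnSegment-sym on)

  ¬Left-iji : ∀ {i j} → ¬ Left i j i
  ¬Left-iji iji = ¬Left-iik (rot² iji)

  ¬Left-ijj : ∀ {i j} → ¬ Left i j j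
  ¬Left-ijj ijj = ¬Left-iik (rot ijj)

  -- A crossing gives a common point of two edges, which planarity forces to be a vertex and hence
  -- an endpoint of both; a shared endpoint makes one of the determinants of the crossing
  -- degenerate. From here on segments are replaced by signs.
  planar⇒embedded : ∀ {T} → PlanarSubdivision T → Embedded T
  planar⇒embedded {T} planar = record
    { canonical = λ e∈T → edge-ordered (P.ordered e∈T)
    ; noCross   = nocross
    ; noVertex  = λ {i} {j} e∈T ijv vwi wvj →
        [ (λ { ≡.refl → ¬Left-iji vwi }) , (λ { ≡.refl → ¬Left-ijj wvj }) ]′
          (endpoint e∈T (between⇒OnSegment ijv vwi wvj))
    }
    where
    module P = PlanarSubdivision planar
    endpoint : ∀ {i j v} → edge i j ∈ T → OnSegment F (p v) (p i) (p j) → v ≡ i ⊎ v ≡ j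
    endpoint {i} {j} {v} e∈T on with edge-cases i j
    ... | inj₁ eq = P.vertices (≡.subst (_∈ T) eq e∈T) v on
    ... | inj₂ eq = Sum.swap (P.vertices (≡.subst (_∈ T) eq e∈T) v (OnSegment-sym on))
    nocross : ∀ {i j k l} → edge i j ∈ T → edge k l ∈ T → ¬ Cross i j k l
    nocross {i} {j} {k} {l} e∈T f∈T c@(ijk , jil , klj , lki) =
      let x , x∈ij , x∈kl = cross⇒intersection c
          v , x≈v = P.meet e∈T f∈T e≢f x (OnEdge-edge i j x∈ij) (OnEdge-edge k l x∈kl)
      in clash (endpoint e∈T (OnSegment-resp x≈v x∈ij)) (endpoint f∈T (OnSegment-resp x≈v x∈kl))
      where
      clash : ∀ {v} → v ≡ i ⊎ v ≡ j → v ≡ k ⊎ v ≡ l → ⊥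
      clash (inj₁ ≡.refl) (inj₁ ≡.refl) = ¬Left-iji ijk
      clash (inj₁ ≡.refl) (inj₂ ≡.refl) = ¬Left-ijj jil
      clash (inj₂ ≡.refl) (inj₁ ≡.refl) = ¬Left-ijj ijk
      clash (inj₂ ≡.refl) (inj₂ ≡.refl) = ¬Left-iji jil
      e≢f : edge i j ≢ edge k l
      e≢f eq with edge-injective eq
      ... | inj₁ (≡.refl , ≡.refl) = ¬Left-iji ijk
      ... | inj₂ (≡.refl , ≡.refl) = ¬Left-ijj ijk

module _ {n : ℕ} where

  ≐-refl : {T : List (Edge n)} → T ≐ T
  ≐-refl = (λ x → x) , (λ x → x)
  ≐-trans : {T T′ T″ : List (Edge n)} → T ≐ T′ → T′ ≐ T″ → T ≐ T″
  ≐-trans (p , q) (p′ , q′) = p′ ∘ p , q ∘ q′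

  exchange : (e f : Edge n) → List (Edge n) → List (Edge n)
  exchange e f T = f ∷ filter (λ g → ¬? (g ≟ᴱ e)) T

-- Triangles at an edge and the geometry of one flip.

module Flips {a ℓ} (F : OrderedField a ℓ) {n : ℕ} (p : Fin n → Point F)
                    (distinct : ∀ {i j} → _≈ₚ_ F (p i) (p j) → i ≡ j) where
  open OrderedField F using (0#; *-pos; _+_; _*_)
  open OrderedFieldProperties F using (pos-cong; +-pos⁻¹; pos-or-zero)
  open Triangulations F p
  open Orientations F p public

  Triangle-rot : ∀ {T i j k} → Triangle T i j k → Triangle T j k i
  Triangle-rot t = record
    { ccw = rot ccw ; ij = jk ; jk = ki ; ki = ij
    ; empty = λ v (a , b , c) → empty v (c , a , b) }
    where open Triangle t

  ∈-edge-sym : ∀ {T : List (Edge n)} i j → edge i j ∈ T → edge j i ∈ T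
  ∈-edge-sym i j = ≡.subst (_∈ _) (edge-sym i j)

  swapʳᶜ : ∀ {i j k} → Collinear i j k → Collinear i k j
  swapʳᶜ ijk = rotᶜ (swapᶜ ijk)

  lines-meet-≡ : ∀ {i j k l} → Left i j l → Collinear i j k → Collinear l k i → k ≡ i
  lines-meet-≡ ijl ijk lki = distinct (lines-meet ijl ijk lki)

  -- If k′ were turned further away from j than k, then jk′ would cross ik or
  -- pass through k, or k would lie inside ijk′.
  apexes-disagree : ∀ {T i j k k′} → Embedded T → Triangle T i j k → Triangle T i j k′ →
                    ¬ Left i k k′
  apexes-disagree {i = i} {j} {k} {k′} emb t t′ ikk′ with orientation j k k′
  ... | leftTurn jkk′  = noCross emb {i} {k} {k′} {j}
          (∈-edge-sym k i (Triangle.ki t)) (∈-edge-sym j k′ (Triangle.jk t′))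
          (ikk′ , rot² (Triangle.ccw t) , rot² jkk′ , rot (Triangle.ccw t′))
  ... | straight jkk′  = noVertex emb {i = j} {k′} (Triangle.jk t′) (swapʳᶜ jkk′) (rot² (Triangle.ccw t)) ikk′
  ... | rightTurn kjk′ = Triangle.empty t′ k (Triangle.ccw t , rot kjk′ , rot² ikk′)

  -- `apexes-disagree` excludes that k and k′ lie in different directions from i. On a common ray
  -- from i they are compared from j: a turn in either direction puts one apex strictly inside the
  -- side that joins i to the other, and without a turn both lie on two lines that meet only once.
  apex-unique : ∀ {T i j k k′} → Embedded T → Triangle T i j k → Triangle T i j k′ → k ≡ k′
  apex-unique {i = i} {j} {k} {k′} emb t t′ with orientation i k k′
  ... | leftTurn ikk′ = contradiction ikk′ (apexes-disagree emb t t′)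
  ... | rightTurn kik′ = contradiction (rot kik′) (apexes-disagree emb t′ t)
  ... | straight ikk′ with orientation j k k′
  ...   | leftTurn jkk′  = contradiction (rot (Triangle.ccw t′))
          (noVertex emb (Triangle.ki t) (swapᶜ ikk′) (rot² jkk′))
  ...   | rightTurn kjk′ = contradiction (rot (Triangle.ccw t))
          (noVertex emb (Triangle.ki t′) (rotᶜ (rotᶜ ikk′)) kjk′)
  ...   | straight jkk′  =
          ≡.sym (lines-meet-≡ (rot² (Triangle.ccw t)) (swapᶜ ikk′) (swapʳᶜ jkk′))

  module Quadrilateral {T i j k l} (emb : Embedded T)
                       (upper : Triangle T i j k) (lower : Triangle T j i l)
                       (convex : ConvexQuadrilateral i l j k) where
    private
      module U = Triangle upper
      module L = Triangle lower
      ilj = proj₁ convex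
      ljk = proj₁ (proj₂ convex)
      jki = proj₁ (proj₂ (proj₂ convex))
      kil = proj₂ (proj₂ (proj₂ convex))

    diagonals-cross : Cross i j k l
    diagonals-cross = U.ccw , L.ccw , rot² ljk , rot² kil

    -- Seen from k, the directions to i, l, v, j follow each other counterclockwise within less than
    -- a half turn, because j is left of ki.
    cone-k : ∀ {v} → Left k l v → Left k v j → Left k i v
    cone-k klv kvj = cancelʳ (sum-Left {k} {i} {l} (*-pos kil kvj) (inj₁ (*-pos (rot² U.ccw) klv))) (rot² ljk)

    cone-l : ∀ {v} → Left l j v → Left l v k → Left l v i
    cone-l ljv lvk = cancelˡ (sum-Left {l} {_} {_} {k} {i} (*-pos ljv (rot² kil))
        (inj₁ (*-pos (rot² L.ccw) lvk))) ljk

    -- The new triangle is covered by the two old ones and their common edge: v is inside the upper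
    -- triangle, inside the lower one, or strictly between i and j, according to its side of ij.
    right-empty : ∀ v → ¬ Inside v k l j
    right-empty v (klv , ljv , jkv) with orientation i j v
    ... | leftTurn ijv = U.empty v (ijv , jkv , cone-k klv (rot jkv))
    ... | rightTurn jiv = L.empty v (jiv , rot² (cone-l ljv (rot klv)) , ljv)
    ... | straight ijv = noVertex emb U.ij ijv (rot (rot (cone-k klv (rot jkv)))) (rot jkv)

    -- The three areas that v cuts off from the triangle klj sum to a positive number, and the one
    -- at kl is zero, so one of the other two is positive. The Plücker relation about v transfers
    -- positivity to the remaining one, since w shows k and l to lie on opposite sides of v.
    left-of-segment : ∀ {v w} → Collinear k l v → Left v w k → Left w v l → Left l j v × Left j k v
    left-of-segment {v} {w} klv vwk wvl with +-pos⁻¹ (pos-cong (split-det k l j v) (rot² ljk))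
    ... | inj₁ 0<klv = contradiction klv (Left⇒¬Collinear 0<klv)
    ... | inj₂ 0<sum with +-pos⁻¹ 0<sum
    ...   | inj₁ ljv = ljv , rot (cancelʳ
              (sum-Left {v} {j} {l} {k} {w} (mul⁻ (rot² ljv) vwk)
                  (inj₂ (zeroʳ-det (swapʳᶜ (rotᶜ (rotᶜ klv)))))) (rot wvl))
    ...   | inj₂ jkv = rot (cancelʳ⁻
              (sum-Left {v} {j} {k} {l} {w} (*-pos (rot² jkv) (rot wvl))
                  (inj₂ (zeroʳ-det (rotᶜ (rotᶜ klv))))) vwk) , jkv

    right-of-segment : ∀ {v w} → Collinear k l v → Left v w k → Left w v l → Left k i v × Left i l v
    right-of-segment {v} {w} klv vwk wvl with +-pos⁻¹ (pos-cong (split-det l k i v) (rot² kil))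
    ... | inj₁ 0<lkv = contradiction (swapᶜ klv) (Left⇒¬Collinear 0<lkv)
    ... | inj₂ 0<sum with +-pos⁻¹ 0<sum
    ...   | inj₁ kiv = kiv , rot (cancelʳ
              (sum-Right {v} {i} {w} {l} {k} (inj₂ (zeroʳ-det (swapʳᶜ (rotᶜ (rotᶜ klv)))))
                  (mul⁻ (rot² kiv) (rot wvl))) vwk)
    ...   | inj₂ ilv = rot (cancelʳ⁻
              (sum-Right {v} {i} {w} {k} {l} (inj₂ (zeroʳ-det (rotᶜ (rotᶜ klv))))
                  (*-pos (rot² ilv) vwk)) (rot wvl)) , ilv

    -- A point strictly between k and l lies inside the convex quadrilateral, hence inside one of
    -- the two old triangles or strictly inside the old diagonal.
    noVertex-kl : ∀ {v w} → Collinear k l v → Left v w k → ¬ Left w v l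
    noVertex-kl {v} klv vwk wvl with left-of-segment klv vwk wvl | right-of-segment klv vwk wvl | orientation i j v
    ... | ljv , jkv | kiv , ilv | leftTurn ijv  = U.empty v (ijv , jkv , kiv)
    ... | ljv , jkv | kiv , ilv | rightTurn jiv = L.empty v (jiv , ilv , ljv)
    ... | ljv , jkv | kiv , ilv | straight ijv  = noVertex emb U.ij ijv (rot² kiv) (rot jkv)

  ConvexQuadrilateral-opposite : ∀ {i j k l} → ConvexQuadrilateral i j k l → ConvexQuadrilateral k l i j
  ConvexQuadrilateral-opposite (ijk , jkl , kli , lij) = kli , lij , ijk , jkl

  -- An edge ab crossing kl has to leave the empty triangle lki through its
  -- corner i.
  crossing-ends-at-corner : ∀ {T a b i k l} → Embedded T →
    edge a b ∈ T → edge k i ∈ T → edge i l ∈ T →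
    Left l k i → (∀ v → ¬ Inside v l k i) → Cross a b k l → a ≡ i
  crossing-ends-at-corner {T} {a} {b} {i} {k} {l} emb ab∈T ki∈T il∈T lki empty (abk , bal , klb , lka)
    = by-side (orientation a b i)
    where
    contains-a : Left k i a → Left i l a → ⊥
    contains-a kia ila = empty a (lka , kia , ila)

    below : Left k i a → NonNegative ([ a , l , k ] * [ a , i , b ]) → ⊥
    below kia q = contains-a kia (rot (cancelʳ⁻
      (sum-Right {a} {l} {k} {i} {b} q (*-pos (rot bal) (rot² kia))) abk))

    kib : Left i k a → Left k i b
    kib ika = cancelˡ (sum-Left {k} {a} {i} {l} {b} (*-pos (rot ika) klb)
        (inj₁ (*-pos (rot² abk) (rot lki)))) (rot lka)

    by-side : Orientation a b i → a ≡ i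
    by-side (leftTurn abi) with orientation i l a
    ... | leftTurn ila  = ⊥-elim (contains-a (rot (cancelʳ
            (sum-Left {a} {k} {l} {i} {b} (mul⁻ (rot² lka) abi) (inj₁ (mul⁻ abk (rot² ila)))) (rot bal))) ila)
    ... | straight ila  = contradiction bal (noVertex emb il∈T ila abi)
    ... | rightTurn lia = contradiction (abi , bal , ilb , lia) (noCross emb ab∈T il∈T)
      where
      ilb : Left i l b
      ilb = rot² (cancelˡ⁻
        (sum-Left {l} {a} {i} {k} {b} (mul⁻ lia (rot klb)) (inj₁ (mul⁻ (rot² bal) lki))) lka)
    by-side (rightTurn bai) with orientation k i a
    ... | leftTurn kia  = ⊥-elim (below kia (inj₁ (*-pos (rot² lka) (rot bai))))
    ... | straight kia  = contradiction bai (noVertex emb ki∈T kia abk)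
    ... | rightTurn ika = contradiction (abk , bai , kib ika , ika) (noCross emb ab∈T ki∈T)
    by-side (straight abi) with orientation k i a
    ... | leftTurn kia  = ⊥-elim (below kia (inj₂ (zeroʳ-det (swapʳᶜ abi))))
    ... | straight kia  = ≡.sym (lines-meet-≡ abk abi kia)
    ... | rightTurn ika = contradiction (kib ika) (noVertex emb ab∈T abi ika)

  Cross-opposite : ∀ {i j k l} → Cross i j k l → Cross j i l k
  Cross-opposite (ijk , jil , klj , lki) = jil , ijk , lki , klj

  Cross-sym : ∀ {i j k l} → Cross i j k l → Cross k l j i
  Cross-sym (ijk , jil , klj , lki) = klj , lki , jil , ijk

  Cross⇒≢ : ∀ {i j k l} → Cross i j k l → edge i j ≢ edge k l
  Cross⇒≢ (ijk , _) eq with edge-injective eq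
  ... | inj₁ (≡.refl , ≡.refl) = ¬Left-iji ijk
  ... | inj₂ (≡.refl , ≡.refl) = ¬Left-ijj ijk

  -- Determines T′ by membership only. Thus one list serves for both orientations of the diagonal,
  -- and lists built in different orders of flips can be compared up to `≐`.
  record Replaces (T : List (Edge n)) (e f : Edge n) (T′ : List (Edge n)) : Set where
    field
      inserted : f ∈ T′
      kept     : ∀ {g} → g ∈ T → g ≢ e → g ∈ T′
      origin   : ∀ {g} → g ∈ T′ → g ≡ f ⊎ (g ∈ T × g ≢ e)

  module FlipResult {T i j k l} (emb : Embedded T)
                    (upper : Triangle T i j k) (lower : Triangle T j i l)
                    (convex : ConvexQuadrilateral i l j k)
                    {T′} (rep : Replaces T (edge i j) (edge k l) T′) where
    open Replaces rep
    private
      module U = Triangle upper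
      module L = Triangle lower
      module Q = Quadrilateral emb upper lower convex
      module Q′ = Quadrilateral emb lower upper (ConvexQuadrilateral-opposite convex)

    new∉T : edge k l ∉ T
    new∉T kl∈T = noCross emb U.ij kl∈T Q.diagonals-cross

    -- Both triangles at kl are empty, so the crossing edge has to leave one through its corner i
    -- and the other through its corner j.
    crossing-is-diagonal : ∀ {a b} → edge a b ∈ T → Cross a b k l → edge a b ≡ edge i j
    crossing-is-diagonal {a} {b} ab∈T c = ≡.cong₂ edge
      (crossing-ends-at-corner emb ab∈T U.ki L.jk (rot² (proj₂ (proj₂ (proj₂ convex)))) Q′.right-empty c)
      (crossing-ends-at-corner emb (∈-edge-sym a b ab∈T) L.ki U.jk
          (rot² (proj₁ (proj₂ convex))) Q.right-empty (Cross-opposite c))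

    old-new : ∀ {a b c d} → edge a b ∈ T → edge a b ≢ edge i j → edge c d ≡ edge k l → ¬ Cross a b c d
    old-new {a} {b} ab∈T ab≢ij cd≡kl cr with edge-injective cd≡kl
    ... | inj₁ (≡.refl , ≡.refl) = ab≢ij (crossing-is-diagonal ab∈T cr)
    ... | inj₂ (≡.refl , ≡.refl) = ab≢ij (≡.trans (edge-sym a b)
            (crossing-is-diagonal (∈-edge-sym a b ab∈T) (Cross-opposite cr)))

    embedded : Embedded T′
    embedded = record { canonical = canonical′ ; noCross = noCross′ ; noVertex = noVertex′ }
      where
      canonical′ : ∀ {e} → e ∈ T′ → Canonical e
      canonical′ e∈T′ with origin e∈T′
      ... | inj₁ ≡.refl    = edge-canonical k l
      ... | inj₂ (e∈T , _) = canonical emb e∈T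

      noCross′ : ∀ {a b c d} → edge a b ∈ T′ → edge c d ∈ T′ → ¬ Cross a b c d
      noCross′ {a} {b} ab∈T′ cd∈T′ cr with origin ab∈T′ | origin cd∈T′
      ... | inj₁ ab≡kl         | inj₁ cd≡kl         = Cross⇒≢ cr (≡.trans ab≡kl (≡.sym cd≡kl))
      ... | inj₁ ab≡kl         | inj₂ (cd∈T , cd≢ij) =
              old-new cd∈T cd≢ij (≡.trans (edge-sym b a) ab≡kl) (Cross-sym cr)
      ... | inj₂ (ab∈T , ab≢ij) | inj₁ cd≡kl         = old-new ab∈T ab≢ij cd≡kl cr
      ... | inj₂ (ab∈T , _)     | inj₂ (cd∈T , _)     = noCross emb ab∈T cd∈T cr

      noVertex′ : ∀ {a b v w} → edge a b ∈ T′ → Collinear a b v → Left v w a → ¬ Left w v b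
      noVertex′ ab∈T′ abv vwa wvb with origin ab∈T′
      ... | inj₂ (ab∈T , _) = noVertex emb ab∈T abv vwa wvb
      ... | inj₁ ab≡kl with edge-injective ab≡kl
      ...   | inj₁ (≡.refl , ≡.refl) = Q.noVertex-kl abv vwa wvb
      ...   | inj₂ (≡.refl , ≡.refl) = Q′.noVertex-kl abv vwa wvb

    right-triangle : Triangle T′ k l j
    right-triangle = record
      { ccw = rot² (proj₁ (proj₂ convex)) ; ij = inserted
      ; jk = kept L.ki lj≢ij ; ki = kept U.jk jk≢ij ; empty = Q.right-empty }
      where
      lj≢ij : edge l j ≢ edge i j
      lj≢ij eq with edge-injective eq
      ... | inj₁ (≡.refl , _) = ¬Left-ijj L.ccw
      ... | inj₂ (≡.refl , _) = ¬Left-iji L.ccw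
      jk≢ij : edge j k ≢ edge i j
      jk≢ij eq with edge-injective eq
      ... | inj₁ (≡.refl , _) = ¬Left-iik U.ccw
      ... | inj₂ (_ , ≡.refl) = ¬Left-iji U.ccw

  exchange-replaces : ∀ {T} e f → Replaces T e f (exchange e f T)
  exchange-replaces e f = record
    { inserted = here ≡.refl
    ; kept     = λ g∈T g≢e → there (∈-filter⁺ (λ g → ¬? (g ≟ᴱ e)) g∈T g≢e)
    ; origin   = λ { (here eq) → inj₁ eq ; (there g∈) → inj₂ (∈-filter⁻ (λ g → ¬? (g ≟ᴱ e)) g∈) }
    }

  replaces-cong : ∀ {S T S′ T′ e f} → S ≐ T → Replaces S e f S′ → Replaces T e f T′ → S′ ≐ T′
  replaces-cong {e = e} {f} (S⊆T , T⊆S) r r′ = half S⊆T r r′ , half T⊆S r′ r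
    where
    half : ∀ {S T S′ T′} → (∀ {g} → g ∈ S → g ∈ T) → Replaces S e f S′ → Replaces T e f T′ →
           ∀ {g} → g ∈ S′ → g ∈ T′
    half S⊆T r r′ g∈S′ with Replaces.origin r g∈S′
    ... | inj₁ ≡.refl       = Replaces.inserted r′
    ... | inj₂ (g∈S , g≢e) = Replaces.kept r′ (S⊆T g∈S) g≢e

  replaces-comm : ∀ {T e f e′ f′ T₁ T₂ S₁ S₂} → f ≢ e′ → f′ ≢ e →
    Replaces T e f T₁ → Replaces T₁ e′ f′ T₂ → Replaces T e′ f′ S₁ → Replaces S₁ e f S₂ → T₂ ≐ S₂
  replaces-comm f≢e′ f′≢e r₁ r₂ s₁ s₂ = half f′≢e r₁ r₂ s₁ s₂ , half f≢e′ s₁ s₂ r₁ r₂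
    where
    half : ∀ {T e f e′ f′ T₁ T₂ S₁ S₂} → f′ ≢ e → Replaces T e f T₁ → Replaces T₁ e′ f′ T₂ →
           Replaces T e′ f′ S₁ → Replaces S₁ e f S₂ → ∀ {g} → g ∈ T₂ → g ∈ S₂
    half f′≢e r₁ r₂ s₁ s₂ g∈T₂ with Replaces.origin r₂ g∈T₂
    ... | inj₁ ≡.refl = Replaces.kept s₂ (Replaces.inserted s₁) f′≢e
    ... | inj₂ (g∈T₁ , g≢e′) with Replaces.origin r₁ g∈T₁
    ...   | inj₁ ≡.refl       = Replaces.inserted s₂
    ...   | inj₂ (g∈T , g≢e) = Replaces.kept s₂ (Replaces.kept s₁ g∈T g≢e′) g≢e

  -- Orientation and emptiness refer to the points alone, so only the three sides must survive. The
  -- first argument of `sub` tells which of the sides is asked for, so that a caller may treat them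
  -- separately.
  Triangle-⊆ : ∀ {T T′ i j k} → Triangle T i j k →
               (∀ {g} → g ≡ edge i j ⊎ g ≡ edge j k ⊎ g ≡ edge k i → g ∈ T → g ∈ T′) → Triangle T′ i j k
  Triangle-⊆ t sub = record
    { ccw = ccw ; ij = sub (inj₁ ≡.refl) ij ; jk = sub (inj₂ (inj₁ ≡.refl)) jk
    ; ki = sub (inj₂ (inj₂ ≡.refl)) ki ; empty = empty }
    where open Triangle t

  Embedded-⊆ : ∀ {T T′} → (∀ {g} → g ∈ T′ → g ∈ T) → Embedded T → Embedded T′
  Embedded-⊆ sub emb = record
    { canonical = canonical emb ∘ sub
    ; noCross   = λ e f → noCross emb (sub e) (sub f)
    ; noVertex  = noVertex emb ∘ sub
    }

  -- A flip of edge i j to edge k l; unlike in Flip, the quadrilateral is part of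
  -- the type, whereas the resulting list is computed.
  record Flippable (T : List (Edge n)) (i j k l : Fin n) : Set ℓ where
    constructor flippable
    field
      upper  : Triangle T i j k
      lower  : Triangle T j i l
      convex : ConvexQuadrilateral i l j k

    after : List (Edge n)
    after = exchange (edge i j) (edge k l) T

    replaces : Replaces T (edge i j) (edge k l) after
    replaces = exchange-replaces (edge i j) (edge k l)

  opposite : ∀ {T i j k l} → Flippable T i j k l → Flippable T j i l k
  opposite (flippable u l c) = flippable l u (ConvexQuadrilateral-opposite c)

  Flippable⇒Flip : ∀ {T i j k l} → Flippable T i j k l → Flip T (edge i j) (exchange (edge i j) (edge k l) T)
  Flippable⇒Flip (flippable u l c) = record
    { diagonal = ≡.refl ; left = u ; right = l ; convex = c ; result = ≡.refl }

  Flip⇒Flippable : ∀ {T e T′} → Flip T e T′ → ∃[ i ] ∃[ j ] ∃[ k ] ∃[ l ]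
    e ≡ edge i j × Flippable T i j k l × T′ ≡ exchange e (edge k l) T
  Flip⇒Flippable f = _ , _ , _ , _ , diagonal , flippable left right convex , result
    where open Flip f

  Flippable-⊆ : ∀ {T T′ i j k l} → (∀ {g} → g ∈ T → g ∈ T′) → Flippable T i j k l → Flippable T′ i j k l
  Flippable-⊆ sub (flippable u l c) = flippable (Triangle-⊆ u (λ _ → sub)) (Triangle-⊆ l (λ _ → sub)) c

  module AfterFlip {T i j k l} (emb : Embedded T) (fl : Flippable T i j k l) where
    open Flippable fl
    open FlipResult emb upper lower convex replaces public
    private
      module Opposite = FlipResult emb lower upper (ConvexQuadrilateral-opposite convex)
        (≡.subst₂ (λ e f → Replaces T e f after) (edge-sym i j) (edge-sym k l) replaces)

    left-triangle : Triangle after l k i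
    left-triangle = Opposite.right-triangle

    old≢new : ∀ {g} → g ∈ T → g ≢ edge k l
    old≢new g∈T ≡.refl = new∉T g∈T

    old-side : ∀ {g} → g ∈ after → g ≢ edge k l → g ∈ T × g ≢ edge i j
    old-side g∈ g≢kl = [ (λ g≡kl → contradiction g≡kl g≢kl) , (λ x → x) ]′ (Replaces.origin replaces g∈)

  flip-embedded : ∀ {T e T′} → Embedded T → Flip T e T′ → Embedded T′
  flip-embedded emb f with Flip⇒Flippable f
  ... | _ , _ , _ , _ , ≡.refl , fl , ≡.refl = AfterFlip.embedded emb fl

  module _ {T i j k l} (emb : Embedded T) (fl : Flippable T i j k l) where
    open AfterFlip emb fl
    open Flippable fl

    -- A triangle of `after` with side kl is one of the two created by the flip, by `apex-unique`.
    -- Then ab is a side of the quadrilateral, and the old triangle on its side had the old diagonal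
    -- as another side.
    new-side : ∀ {a b x} → Triangle after a b x → edge b x ≡ edge k l ⊎ edge x a ≡ edge k l →
               ∃[ y ] Triangle T a b y × (edge i j ≡ edge a y ⊎ edge i j ≡ edge b y)
    new-side {a} {b} {x} t (inj₁ bx≡kl) with edge-injective bx≡kl
    ... | inj₁ (≡.refl , ≡.refl) with apex-unique embedded (Triangle-rot t) right-triangle
    ...   | ≡.refl = i , Triangle-rot upper , inj₁ (edge-sym i j)
    new-side {a} {b} {x} t (inj₁ bx≡kl) | inj₂ (≡.refl , ≡.refl) with apex-unique embedded
        (Triangle-rot t) left-triangle
    ...   | ≡.refl = j , Triangle-rot lower , inj₁ ≡.refl
    new-side {a} {b} {x} t (inj₂ xa≡kl) with edge-injective xa≡kl
    ... | inj₁ (≡.refl , ≡.refl) with apex-unique embedded (Triangle-rot (Triangle-rot t)) right-triangle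
    ...   | ≡.refl = i , Triangle-rot (Triangle-rot lower) , inj₂ (edge-sym i j)
    new-side {a} {b} {x} t (inj₂ xa≡kl) | inj₂ (≡.refl , ≡.refl) with apex-unique embedded
        (Triangle-rot (Triangle-rot t)) left-triangle
    ...   | ≡.refl = j , Triangle-rot (Triangle-rot upper) , inj₂ ≡.refl

    triangle-before : ∀ {a b x} → edge a b ∈ T → Triangle after a b x →
      (Triangle T a b x × edge b x ≢ edge i j × edge x a ≢ edge i j)
      ⊎ (∃[ y ] Triangle T a b y × (edge i j ≡ edge a y ⊎ edge i j ≡ edge b y))
    triangle-before {a} {b} {x} ab∈T t with edge b x ≟ᴱ edge k l | edge x a ≟ᴱ edge k l
    ... | yes eq | _      = inj₂ (new-side t (inj₁ eq))
    ... | no _   | yes eq = inj₂ (new-side t (inj₂ eq))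
    ... | no bx≢ | no xa≢ = inj₁
      ( record { ccw = ccw ; ij = ab∈T ; jk = proj₁ bx ; ki = proj₁ xa ; empty = empty }
      , proj₂ bx , proj₂ xa)
      where
      open Triangle t
      bx = old-side jk bx≢
      xa = old-side ki xa≢

  -- Flip paths and the rearrangement of flips.

  data Path : List (Edge n) → List (Edge n) → List (Edge n) → Set ℓ where
    stop : ∀ {T T′} → T ≐ T′ → Path T [] T′
    _∷_  : ∀ {T T₁ T′ e es} → Flip T e T₁ → Path T₁ es T′ → Path T (e ∷ es) T′

  flip-resp-≐ : ∀ {S T e T′} → S ≐ T → Flip T e T′ → ∃[ S′ ] Flip S e S′ × S′ ≐ T′
  flip-resp-≐ {S} S≐T f with Flip⇒Flippable f
  ... | i , j , k , l , ≡.refl , fl , ≡.refl =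
    exchange (edge i j) (edge k l) S , Flippable⇒Flip (Flippable-⊆ (proj₂ S≐T) fl) ,
    replaces-cong S≐T (exchange-replaces (edge i j) (edge k l)) (exchange-replaces (edge i j) (edge k l))

  path-resp-≐ : ∀ {S T es T′} → S ≐ T → Path T es T′ → Path S es T′
  path-resp-≐ S≐T (stop T≐T′) = stop (≐-trans S≐T T≐T′)
  path-resp-≐ S≐T (f ∷ path) with flip-resp-≐ S≐T f
  ... | _ , f′ , S′≐T′ = f′ ∷ path-resp-≐ S′≐T′ path

  _◅◅_ : ∀ {T es T′ fs T″} → Path T es T′ → Path T′ fs T″ → Path T (es ++ fs) T″
  stop T≐T′  ◅◅ path′ = path-resp-≐ T≐T′ path′
  (f ∷ path) ◅◅ path′ = f ∷ (path ◅◅ path′)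

  path-embedded : ∀ {T es T′} → Embedded T → Path T es T′ → Embedded T′
  path-embedded emb (stop (_ , T′⊆T)) = Embedded-⊆ T′⊆T emb
  path-embedded emb (f ∷ path)        = path-embedded (flip-embedded emb f) path

  flip-kept : ∀ {T e T′ g} → Flip T e T′ → g ∈ T → g ≢ e → g ∈ T′
  flip-kept f g∈T g≢e with Flip⇒Flippable f
  ... | _ , _ , _ , _ , ≡.refl , fl , ≡.refl = Replaces.kept (Flippable.replaces fl) g∈T g≢e

  path-kept : ∀ {T es T′ g} → Path T es T′ → g ∈ T → g ∉ es → g ∈ T′
  path-kept (stop (T⊆T′ , _)) g∈T g∉es = T⊆T′ g∈T
  path-kept (f ∷ path) g∈T g∉es = path-kept path (flip-kept f g∈T (g∉es ∘ here)) (g∉es ∘ there)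

  -- The targets of an action of type (i) from edge i j.
  Adjacent : List (Edge n) → Fin n → Fin n → Edge n → Set ℓ
  Adjacent T i j g = ∃[ y ] (Triangle T i j y ⊎ Triangle T j i y) × (g ≡ edge i y ⊎ g ≡ edge j y)

  Adjacent-sym : ∀ {T i j g} → Adjacent T i j g → Adjacent T j i g
  Adjacent-sym (y , t , s) = y , Sum.swap t , Sum.swap s

  Adjacent⇒∈ : ∀ {T i j g} → Adjacent T i j g → g ∈ T
  Adjacent⇒∈ {i = i} (y , inj₁ t , inj₁ ≡.refl) = ∈-edge-sym y i (Triangle.ki t)
  Adjacent⇒∈ (y , inj₁ t , inj₂ ≡.refl)         = Triangle.jk t
  Adjacent⇒∈ (y , inj₂ t , inj₁ ≡.refl)         = Triangle.jk t
  Adjacent⇒∈ {j = j} (y , inj₂ t , inj₂ ≡.refl) = ∈-edge-sym y j (Triangle.ki t)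

  record Split (T : List (Edge n)) (es : List (Edge n)) (T′ : List (Edge n)) (g : Edge n) : Set ℓ where
    field
      {es₁ es₂} : List (Edge n)
      {T₁ T₂}   : List (Edge n)
      split     : es ≡ es₁ ++ g ∷ es₂
      before    : Path T es₁ T₁
      flipped   : Flip T₁ g T₂
      rest      : Path T₂ es₂ T′
      g∉before  : g ∉ es₁

  Origin : (T es T′ : List (Edge n)) (i j k : Fin n) → Set ℓ
  Origin T es T′ i j k =
    (Triangle T i j k × edge j k ∉ es × edge k i ∉ es) ⊎ (∃[ g ] Adjacent T i j g × Split T es T′ g)

  -- Induction along the path, pulling a triangle at ij back through the first flip by
  -- `triangle-before`. If this fails, the edge flipped first was a side of the triangle of T there
  -- and serves as g. If it succeeds, the conclusion for the rest of the path carries over: an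
  -- untouched triangle stays untouched, and a g found later is a side of a triangle that T already
  -- has.
  triangle-origin : ∀ {T es T′ i j k} → Embedded T → Path T es T′ → edge i j ∈ T → edge i j ∉ es →
    Triangle T′ i j k →
    Origin T es T′ i j k
  triangle-origin emb (stop (_ , T′⊆T)) ij∈T ij∉es t = inj₁ (Triangle-⊆ t (λ _ → T′⊆T) , (λ ()) , (λ ()))
  triangle-origin {i = i} {j} {k} emb (f ∷ path) ij∈T ij∉es t with Flip⇒Flippable f
  ... | i₀ , j₀ , k₀ , l₀ , ≡.refl , fl , ≡.refl
    with triangle-origin (AfterFlip.embedded emb fl) path (flip-kept f ij∈T (ij∉es ∘ here)) (ij∉es ∘ there) t
  ... | inj₁ (t₁ , jk∉ , ki∉) with triangle-before emb fl ij∈T t₁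
  ...   | inj₁ (t₀ , jk≢ , ki≢) = inj₁ (t₀ , (λ { (here eq) → jk≢ eq ; (there x) → jk∉ x })
                                          , (λ { (here eq) → ki≢ eq ; (there x) → ki∉ x }))
  ...   | inj₂ (y , t₀ , side)  = inj₂ (_ , (y , inj₁ t₀ , side) ,
          record { split = ≡.refl ; before = stop ≐-refl ; flipped = f ; rest = path ; g∉before = λ () })
  triangle-origin {i = i} {j} {k} emb (f ∷ path) ij∈T ij∉es t
      | i₀ , j₀ , k₀ , l₀ , ≡.refl , fl , ≡.refl | inj₂ (g , (y , t₁ , side) , s) = by-side t₁
    where
    first : Adjacent _ i j (edge i₀ j₀) → _
    first adj = inj₂ (_ , adj ,
      record { split = ≡.refl ; before = stop ≐-refl ; flipped = f ; rest = path ; g∉before = λ () })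
    later : Adjacent _ i j g → g ≢ edge i₀ j₀ → _
    later adj g≢ = inj₂ (g , adj , record
      { split = ≡.cong (_ ∷_) (Split.split s) ; before = f ∷ Split.before s ; flipped = Split.flipped s
      ; rest = Split.rest s ; g∉before = λ { (here eq) → g≢ eq ; (there x) → Split.g∉before s x } })
    by-side : Triangle _ i j y ⊎ Triangle _ j i y → _
    by-side (inj₁ t₁) with triangle-before emb fl ij∈T t₁
    ... | inj₂ (z , t₀ , side₀) = first (z , inj₁ t₀ , side₀)
    ... | inj₁ (t₀ , jy≢ , yi≢) = later (y , inj₁ t₀ , side) (off side)
      where
      off : g ≡ edge i y ⊎ g ≡ edge j y → g ≢ edge i₀ j₀
      off (inj₁ g≡iy) g≡ = yi≢ (≡.trans (edge-sym y i) (≡.trans (≡.sym g≡iy) g≡))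
      off (inj₂ g≡jy) g≡ = jy≢ (≡.trans (≡.sym g≡jy) g≡)
    by-side (inj₂ t₁) with triangle-before emb fl (∈-edge-sym i j ij∈T) t₁
    ... | inj₂ (z , t₀ , side₀) = first (z , inj₂ t₀ , Sum.swap side₀)
    ... | inj₁ (t₀ , iy≢ , yj≢) = later (y , inj₂ t₀ , side) (off side)
      where
      off : g ≡ edge i y ⊎ g ≡ edge j y → g ≢ edge i₀ j₀
      off (inj₁ g≡iy) g≡ = iy≢ (≡.trans (≡.sym g≡iy) g≡)
      off (inj₂ g≡jy) g≡ = yj≢ (≡.trans (edge-sym y j) (≡.trans (≡.sym g≡jy) g≡))

  module _ {i j k l : Fin n} where
    Sides : List (Edge n)
    Sides = edge i j ∷ edge j k ∷ edge k i ∷ edge i l ∷ edge l j ∷ []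

    -- A triangle with ij among its other two sides would be the upper or the lower one, by
    -- `apex-unique`, and then ab would be a side of the quadrilateral.
    triangle-avoids : ∀ {T a b c} → Embedded T → Flippable T i j k l → Triangle T a b c → edge a b ∉ Sides →
                      edge b c ≢ edge i j × edge c a ≢ edge i j
    triangle-avoids {T} {a} {b} {c} emb (flippable upper lower _) t ab∉ = bc≢ , ca≢
      where
      bc≢ : edge b c ≢ edge i j
      bc≢ eq with edge-injective eq
      ... | inj₁ (≡.refl , ≡.refl) with apex-unique emb (Triangle-rot t) upper
      ...   | ≡.refl = ab∉ (there (there (here ≡.refl)))
      bc≢ eq | inj₂ (≡.refl , ≡.refl) with apex-unique emb (Triangle-rot t) lower
      ...   | ≡.refl = ab∉ (there (there (there (there (here ≡.refl)))))
      ca≢ : edge c a ≢ edge i j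
      ca≢ eq with edge-injective eq
      ... | inj₁ (≡.refl , ≡.refl) with apex-unique emb (Triangle-rot (Triangle-rot t)) upper
      ...   | ≡.refl = ab∉ (there (here ≡.refl))
      ca≢ eq | inj₂ (≡.refl , ≡.refl) with apex-unique emb (Triangle-rot (Triangle-rot t)) lower
      ...   | ≡.refl = ab∉ (there (there (there (here ≡.refl))))

    triangle-survives : ∀ {T a b c T′} → Embedded T → (fl : Flippable T i j k l) → Triangle T a b c →
        edge a b ∉ Sides →
                        Replaces T (edge i j) (edge k l) T′ → Triangle T′ a b c
    triangle-survives emb fl t ab∉ r = Triangle-⊆ t λ where
      (inj₁ ≡.refl)        g∈T → Replaces.kept r g∈T (λ eq → ab∉ (here eq))
      (inj₂ (inj₁ ≡.refl)) g∈T → Replaces.kept r g∈T (proj₁ (triangle-avoids emb fl t ab∉))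
      (inj₂ (inj₂ ≡.refl)) g∈T → Replaces.kept r g∈T (proj₂ (triangle-avoids emb fl t ab∉))

    -- No flip of the path removes an edge of the quadrilateral, so its two triangles persist
    -- throughout; conversely the triangles used by the path never contain ij, by `triangle-avoids`.
    -- The list of flipped labels is unchanged, so later conditions on which edges a path flips
    -- remain valid.
    commute : ∀ {T es T′} → Embedded T → Flippable T i j k l → Path T es T′ → (∀ {g} → g ∈ es → g ∉ Sides) →
              Path (exchange (edge i j) (edge k l) T) es (exchange (edge i j) (edge k l) T′)
    commute emb fl (stop T≐T′) off = stop (replaces-cong T≐T′ (exchange-replaces _ _) (exchange-replaces _ _))
    commute {T} emb fl (f ∷ path) off with Flip⇒Flippable f
    ... | a , b , c , d , ≡.refl , gl , ≡.refl =
      Flippable⇒Flip gl′ ∷ path-resp-≐ agree (commute (AfterFlip.embedded emb gl) fl′ path (off ∘ there))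
      where
      module G = Flippable gl
      module E = Flippable fl
      ab∉ : edge a b ∉ Sides
      ab∉ = off (here ≡.refl)
      gl′ : Flippable (exchange (edge i j) (edge k l) T) a b c d
      gl′ = flippable (triangle-survives emb fl G.upper ab∉ E.replaces)
                      (triangle-survives emb fl G.lower
                          (≡.subst (_∉ Sides) (edge-sym a b) ab∉) E.replaces) G.convex
      kept : ∀ {g} → g ∈ Sides → g ∈ T → g ∈ G.after
      kept g∈S g∈T = Replaces.kept G.replaces g∈T (λ { ≡.refl → ab∉ g∈S })
      fl′ : Flippable G.after i j k l
      fl′ = flippable
        (Triangle-⊆ E.upper λ where
          (inj₁ ≡.refl)        → kept (here ≡.refl)
          (inj₂ (inj₁ ≡.refl)) → kept (there (here ≡.refl))
          (inj₂ (inj₂ ≡.refl)) → kept (there (there (here ≡.refl))))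
        (Triangle-⊆ E.lower λ where
          (inj₁ ≡.refl)        → kept (here (edge-sym j i))
          (inj₂ (inj₁ ≡.refl)) → kept (there (there (there (here ≡.refl))))
          (inj₂ (inj₂ ≡.refl)) → kept (there (there (there (there (here ≡.refl))))))
        E.convex
      agree : exchange (edge a b) (edge c d) (exchange (edge i j) (edge k l) T) ≐ exchange (edge i j)
          (edge k l) G.after
      -- An edge inserted by either flip is absent from T, so neither exchange removes what the
      -- other inserts.
      agree = replaces-comm
        (λ kl≡ab → AfterFlip.old≢new emb fl (Triangle.ij G.upper) (≡.sym kl≡ab))
        (λ cd≡ij → AfterFlip.old≢new emb gl (Triangle.ij E.upper) (≡.sym cd≡ij))
        E.replaces (exchange-replaces _ _) G.replaces (exchange-replaces _ _)

-- Values computed by the timed list operations.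

does-true : ∀ {a} {P : Set a} (P? : Dec P) → does P? ≡ true → P
does-true (yes p) _ = p

not-true : ∀ {b} → not b ≡ true → b ≢ true
not-true {false} _ ()

≢true⇒not : ∀ {b} → b ≢ true → not b ≡ true
≢true⇒not {false} _ = ≡.refl
≢true⇒not {true} ≢ = contradiction ≡.refl ≢

∧ᵗ-true⁺ : ∀ m {m′} → value m ≡ true → value m′ ≡ true → value (m ∧ᵗ m′) ≡ true
∧ᵗ-true⁺ m p q rewrite p = q

∧ᵗ-true⁻ : ∀ m {m′} → value (m ∧ᵗ m′) ≡ true → value m ≡ true × value m′ ≡ true
∧ᵗ-true⁻ m p with value m
... | true = ≡.refl , p

∨ᵗ-true⁺ : ∀ m {m′} → value m ≡ true ⊎ value m′ ≡ true → value (m ∨ᵗ m′) ≡ true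
∨ᵗ-true⁺ m (inj₁ p) rewrite p = ≡.refl
∨ᵗ-true⁺ m (inj₂ q) with value m
... | true  = ≡.refl
... | false = q

∨ᵗ-true⁻ : ∀ m {m′} → value (m ∨ᵗ m′) ≡ true → value m ≡ true ⊎ value m′ ≡ true
∨ᵗ-true⁻ m p with value m
... | true  = inj₁ ≡.refl
... | false = inj₂ p

module _ {A : Set} where

  anyᵗ-true⁺ : ∀ (f : A → Timed Bool) {x xs} → x ∈ xs → value (f x) ≡ true → value (anyᵗ f xs) ≡ true
  anyᵗ-true⁺ f (here ≡.refl)      p = ∨ᵗ-true⁺ (f _) (inj₁ p)
  anyᵗ-true⁺ f {xs = y ∷ _} (there x∈xs) p = ∨ᵗ-true⁺ (f y) (inj₂ (anyᵗ-true⁺ f x∈xs p))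

  anyᵗ-true⁻ : ∀ (f : A → Timed Bool) {xs} → value (anyᵗ f xs) ≡ true → ∃[ x ] x ∈ xs × value (f x) ≡ true
  anyᵗ-true⁻ f {x ∷ xs} p with ∨ᵗ-true⁻ (f x) p
  ... | inj₁ q = x , here ≡.refl , q
  ... | inj₂ q with anyᵗ-true⁻ f q
  ...   | y , y∈xs , r = y , there y∈xs , r

  allᵗ-true⁺ : ∀ (f : A → Timed Bool) xs → (∀ {x} → x ∈ xs → value (f x) ≡ true) → value (allᵗ f xs) ≡ true
  allᵗ-true⁺ f []       p = ≡.refl
  allᵗ-true⁺ f (x ∷ xs) p = ∧ᵗ-true⁺ (f x) (p (here ≡.refl)) (allᵗ-true⁺ f xs (p ∘ there))

  allᵗ-true⁻ : ∀ (f : A → Timed Bool) {x xs} → value (allᵗ f xs) ≡ true → x ∈ xs → value (f x) ≡ true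
  allᵗ-true⁻ f p (here ≡.refl)                = proj₁ (∧ᵗ-true⁻ (f _) p)
  allᵗ-true⁻ f {xs = y ∷ _} p (there x∈xs) = allᵗ-true⁻ f (proj₂ (∧ᵗ-true⁻ (f y) p)) x∈xs

  ∈-filterᵗ⁺ : ∀ (f : A → Timed Bool) {x xs} → x ∈ xs → value (f x) ≡ true → x ∈ value (filterᵗ f xs)
  ∈-filterᵗ⁺ f (here ≡.refl) p rewrite p = here ≡.refl
  ∈-filterᵗ⁺ f {xs = y ∷ _} (there x∈xs) p with value (f y)
  ... | true  = there (∈-filterᵗ⁺ f x∈xs p)
  ... | false = ∈-filterᵗ⁺ f x∈xs p

  ∈-filterᵗ⁻ : ∀ (f : A → Timed Bool) {x} xs → x ∈ value (filterᵗ f xs) → x ∈ xs × value (f x) ≡ true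
  ∈-filterᵗ⁻ f (y ∷ xs) x∈ with value (f y) in eq
  ∈-filterᵗ⁻ f (y ∷ xs) (here ≡.refl) | true = here ≡.refl , eq
  ∈-filterᵗ⁻ f (y ∷ xs) (there x∈)    | true with ∈-filterᵗ⁻ f xs x∈
  ... | x∈xs , p = there x∈xs , p
  ∈-filterᵗ⁻ f (y ∷ xs) x∈ | false with ∈-filterᵗ⁻ f xs x∈
  ... | x∈xs , p = there x∈xs , p

  value-appendᵗ : ∀ (xs ys : List A) → value (appendᵗ xs ys) ≡ xs ++ ys
  value-appendᵗ []       ys = ≡.refl
  value-appendᵗ (x ∷ xs) ys = ≡.cong (x ∷_) (value-appendᵗ xs ys)

  value-mapᵗ : ∀ {B : Set} (f : A → B) xs → value (mapᵗ f xs) ≡ map f xs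
  value-mapᵗ f []       = ≡.refl
  value-mapᵗ f (x ∷ xs) = ≡.cong (f x ∷_) (value-mapᵗ f xs)

module _ {n : ℕ} where

  memberᵗ-true⁺ : ∀ {e : Edge n} {T} → e ∈ T → value (memberᵗ e T) ≡ true
  memberᵗ-true⁺ {e} e∈T = anyᵗ-true⁺ _ e∈T (dec-true (e ≟ᴱ e) ≡.refl)

  memberᵗ-true⁻ : ∀ {e : Edge n} {T} → value (memberᵗ e T) ≡ true → e ∈ T
  memberᵗ-true⁻ {e} {T} p =
    let f , f∈T , q = anyᵗ-true⁻ (λ f → step (does (e ≟ᴱ f))) p
    in ≡.subst (_∈ T) (≡.sym (does-true (e ≟ᴱ f) q)) f∈T

  subsetᵗ-true⁺ : ∀ {T T′ : List (Edge n)} → (∀ {g} → g ∈ T → g ∈ T′) → value (subsetᵗ T T′) ≡ true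
  subsetᵗ-true⁺ {T} sub = allᵗ-true⁺ _ T (memberᵗ-true⁺ ∘ sub)

  subsetᵗ-true⁻ : ∀ {T T′ : List (Edge n)} → value (subsetᵗ T T′) ≡ true → ∀ {g} → g ∈ T → g ∈ T′
  subsetᵗ-true⁻ p g∈T = memberᵗ-true⁻ (allᵗ-true⁻ _ p g∈T)

  value-filterᵗ-≢ : ∀ (e : Edge n) T →
    value (filterᵗ (λ f → step (not (does (f ≟ᴱ e)))) T) ≡ filter (λ f → ¬? (f ≟ᴱ e)) T
  value-filterᵗ-≢ e []      = ≡.refl
  value-filterᵗ-≢ e (f ∷ T) with does (f ≟ᴱ e)
  ... | true  = value-filterᵗ-≢ e T
  ... | false = ≡.cong (f ∷_) (value-filterᵗ-≢ e T)

  ∈-insertᵗ : ∀ (e : Edge n) fs {g} → g ∈ e ∷ fs → g ∈ value (insertᵗ e fs)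
  ∈-insertᵗ e []       g∈ = g∈
  ∈-insertᵗ e (f ∷ fs) g∈ with e ≤ˡᵉˣ f
  ... | true = g∈
  ∈-insertᵗ e (f ∷ fs) (here eq)          | false = there (∈-insertᵗ e fs (here eq))
  ∈-insertᵗ e (f ∷ fs) (there (here eq))  | false = here eq
  ∈-insertᵗ e (f ∷ fs) (there (there g∈)) | false = there (∈-insertᵗ e fs (there g∈))

  ∈-insertᵗ⁻ : ∀ (e : Edge n) fs {g} → g ∈ value (insertᵗ e fs) → g ∈ e ∷ fs
  ∈-insertᵗ⁻ e []       g∈ = g∈
  ∈-insertᵗ⁻ e (f ∷ fs) g∈ with e ≤ˡᵉˣ f
  ... | true = g∈
  ∈-insertᵗ⁻ e (f ∷ fs) (here eq)  | false = there (here eq)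
  ∈-insertᵗ⁻ e (f ∷ fs) (there g∈) | false with ∈-insertᵗ⁻ e fs g∈
  ... | here eq   = here eq
  ... | there g∈′ = there (there g∈′)

  ∈-sortᵗ : ∀ (es : List (Edge n)) {g} → g ∈ es → g ∈ value (sortᵗ es)
  ∈-sortᵗ (e ∷ es) (here eq)  = ∈-insertᵗ e (value (sortᵗ es)) (here eq)
  ∈-sortᵗ (e ∷ es) (there g∈) = ∈-insertᵗ e (value (sortᵗ es)) (there (∈-sortᵗ es g∈))

  ∈-sortᵗ⁻ : ∀ (es : List (Edge n)) {g} → g ∈ value (sortᵗ es) → g ∈ es
  ∈-sortᵗ⁻ (e ∷ es) g∈ with ∈-insertᵗ⁻ e (value (sortᵗ es)) g∈
  ... | here eq   = here eq
  ... | there g∈′ = there (∈-sortᵗ⁻ es g∈′)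

-- Counting in lists without repetition.

module _ {A : Set} (_≟_ : DecidableEquality A) where
  open DecMembership _≟_ using (_∈?_)

  private
    without : A → List A → List A
    without x = filter (λ y → ¬? (y ≟ x))

    length-without : ∀ {x ys} → x ∈ ys → length (without x ys) ℕ.< length ys
    length-without {x} {ys} x∈ys = filter-notAll (λ y → ¬? (y ≟ x)) ys (Any.map (λ eq ≢ → ≢ (≡.sym eq)) x∈ys)

  Unique-⊆⇒length≤ : ∀ {xs ys} → Unique xs → (∀ {x} → x ∈ xs → x ∈ ys) → length xs ℕ.≤ length ys
  Unique-⊆⇒length≤ {[]}     _  _   = z≤n
  Unique-⊆⇒length≤ {x ∷ xs} u@(_ ∷ u′) sub = ℕ.≤-<-trans
    (Unique-⊆⇒length≤ u′ λ y∈xs → ∈-filter⁺ (λ y → ¬? (y ≟ x)) (sub (there y∈xs)) λ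
        { ≡.refl → Unique[x∷xs]⇒x∉xs u y∈xs })
    (length-without (sub (here ≡.refl)))

  Unique-⊆⇒⊇ : ∀ {xs ys} → Unique xs → (∀ {x} → x ∈ xs → x ∈ ys) → length ys ℕ.≤ length xs →
               ∀ {y} → y ∈ ys → y ∈ xs
  Unique-⊆⇒⊇ {xs} {ys} u sub le {y} y∈ys with y ∈? xs
  ... | yes y∈xs = y∈xs
  ... | no y∉xs = contradiction
    (ℕ.≤-<-trans (Unique-⊆⇒length≤ u λ x∈xs → ∈-filter⁺ (λ x → ¬? (x ≟ y)) (sub x∈xs) λ
        { ≡.refl → y∉xs x∈xs })
                 (length-without y∈ys))
    (ℕ.≤⇒≯ le)

  length-replace : ∀ {x : A} {xs} (y : A) → Unique xs → x ∈ xs →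
                   length (y ∷ filter (λ z → ¬? (z ≟ x)) xs) ≡ length xs
  length-replace {x} {xs} y u x∈xs = ℕ.≤-antisym (length-without x∈xs)
    (Unique-⊆⇒length≤ {ys = x ∷ without x xs} u λ {z} z∈xs → case z ≟ x of λ where
      (yes z≡x) → here z≡x
      (no z≢x)  → there (∈-filter⁺ (λ y → ¬? (y ≟ x)) z∈xs z≢x))

-- Compositions of a number.

data Composition : ℕ → List ℕ → Set where
  []  : Composition 0 []
  _∷_ : ∀ {m ks} d → Composition m ks → Composition (suc d ℕ.+ m) (suc d ∷ ks)

value-compositions : ∀ m → let c = value (compositions (suc m)) in
  value (compositions (suc (suc m))) ≡ map (1 ∷_) c ++ map incHead c
value-compositions m = ≡.trans
  (value-appendᵗ (value (mapᵗ (1 ∷_) c)) (value (mapᵗ incHead c)))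
  (≡.cong₂ _++_ (value-mapᵗ (1 ∷_) c) (value-mapᵗ incHead c))
  where c = value (compositions (suc m))

∈-compositions : ∀ {m ks} → Composition m ks → ks ∈ value (compositions m)
∈-compositions [] = here ≡.refl
∈-compositions (_∷_ {zero} zero [])      = here ≡.refl
∈-compositions (_∷_ {suc m} {ks} zero c) =
  ≡.subst (1 ∷ ks ∈_) (≡.sym (value-compositions m)) (∈-++⁺ˡ (∈-map⁺ (1 ∷_) (∈-compositions c)))
∈-compositions (_∷_ {m} {ks} (suc d) c)  =
  ≡.subst (suc (suc d) ∷ ks ∈_) (≡.sym (value-compositions (d ℕ.+ m)))
    (∈-++⁺ʳ (map (1 ∷_) (value (compositions (suc (d ℕ.+ m))))) (∈-map⁺ incHead (∈-compositions (d ∷ c))))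

∈-compositions⁻ : ∀ m {ks} → ks ∈ value (compositions m) → Composition m ks
∈-compositions⁻ zero (here ≡.refl) = []
∈-compositions⁻ (suc zero) (here ≡.refl) = 0 ∷ []
∈-compositions⁻ (suc (suc m)) {ks} ks∈ =
  extend (∈-compositions⁻ (suc m)) (∈-++⁻ (map (1 ∷_) c) (≡.subst (ks ∈_) (value-compositions m) ks∈))
  where
  c = value (compositions (suc m))
  increment : ∀ {m ks} → Composition (suc m) ks → Composition (suc (suc m)) (incHead ks)
  increment (d ∷ c) = suc d ∷ c
  extend : (∀ {ks} → ks ∈ c → Composition (suc m) ks) → ks ∈ map (1 ∷_) c ⊎ ks ∈ map incHead c →
           Composition (suc (suc m)) ks
  extend ih (inj₁ ks∈) with ∈-map⁻ (1 ∷_) ks∈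
  ... | ks′ , ks′∈ , ≡.refl = 0 ∷ ih ks′∈
  extend ih (inj₂ ks∈) with ∈-map⁻ incHead ks∈
  ... | ks′ , ks′∈ , ≡.refl = increment (ih ks′∈)

composition-sum : ∀ {m ks} → Composition m ks → sum ks ≡ m
composition-sum []      = ≡.refl
composition-sum (d ∷ c) = ≡.cong (suc d ℕ.+_) (composition-sum c)

-- Step counts of the list operations and of `compositions`.

open import Data.Nat.Base using (_+_; _*_; _^_; _≤_)

steps-∧ᵗ : ∀ m {m′ a b} → steps m ≤ a → steps m′ ≤ b → steps (m ∧ᵗ m′) ≤ a + b
steps-∧ᵗ m p q with value m
... | true  = ℕ.+-mono-≤ p q
... | false = ℕ.+-mono-≤ p z≤n

steps-∨ᵗ : ∀ m {m′ a b} → steps m ≤ a → steps m′ ≤ b → steps (m ∨ᵗ m′) ≤ a + b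
steps-∨ᵗ m p q with value m
... | true  = ℕ.+-mono-≤ p z≤n
... | false = ℕ.+-mono-≤ p q

steps-notᵗ : ∀ m {a} → steps m ≤ a → steps (notᵗ m) ≤ a
steps-notᵗ m p = ℕ.≤-trans (ℕ.≤-reflexive (ℕ.+-identityʳ (steps m))) p

module _ {A : Set} where

  steps-anyᵗ : ∀ (f : A → Timed Bool) {b} xs → (∀ {x} → x ∈ xs → steps (f x) ≤ b) →
               steps (anyᵗ f xs) ≤ suc (length xs * suc b)
  steps-anyᵗ f     []       _ = ℕ.≤-refl
  steps-anyᵗ f {b} (x ∷ xs) p = s≤s (ℕ.≤-trans
    (steps-∨ᵗ (f x) (p (here ≡.refl)) (steps-anyᵗ f xs (p ∘ there)))
    (ℕ.≤-reflexive (ℕ.+-suc b (length xs * suc b))))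

  steps-allᵗ : ∀ (f : A → Timed Bool) {b} xs → (∀ x → steps (f x) ≤ b) →
               steps (allᵗ f xs) ≤ suc (length xs * suc b)
  steps-allᵗ f     []       _ = ℕ.≤-refl
  steps-allᵗ f {b} (x ∷ xs) p = s≤s (ℕ.≤-trans
    (steps-∧ᵗ (f x) (p x) (steps-allᵗ f xs p))
    (ℕ.≤-reflexive (ℕ.+-suc b (length xs * suc b))))

  steps-filterᵗ : ∀ (f : A → Timed Bool) {b} xs → (∀ x → steps (f x) ≤ b) →
                  steps (filterᵗ f xs) ≤ suc (length xs * suc b)
  steps-filterᵗ f     []       _ = ℕ.≤-refl
  steps-filterᵗ f {b} (x ∷ xs) p = s≤s (ℕ.≤-trans
    (ℕ.+-mono-≤ (p x) (ℕ.≤-trans (ℕ.≤-reflexive (ℕ.+-identityʳ _)) (steps-filterᵗ f xs p)))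
    (ℕ.≤-reflexive (ℕ.+-suc b (length xs * suc b))))

  length-filterᵗ : ∀ (f : A → Timed Bool) xs → length (value (filterᵗ f xs)) ≤ length xs
  length-filterᵗ f []       = z≤n
  length-filterᵗ f (x ∷ xs) with value (f x)
  ... | true  = s≤s (length-filterᵗ f xs)
  ... | false = ℕ.m≤n⇒m≤1+n (length-filterᵗ f xs)

  unique-filterᵗ : ∀ (f : A → Timed Bool) {xs} → Unique xs → Unique (value (filterᵗ f xs))
  unique-filterᵗ f [] = []
  unique-filterᵗ f {x ∷ xs} (x∉ ∷ u) with value (f x)
  ... | true  = All.tabulate (λ y∈ → All.lookup x∉ (proj₁ (∈-filterᵗ⁻ f xs y∈))) ∷ unique-filterᵗ f u
  ... | false = unique-filterᵗ f u

  steps-mapᵗ : ∀ {B : Set} (f : A → B) xs → steps (mapᵗ f xs) ≡ suc (length xs)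
  steps-mapᵗ f []       = ≡.refl
  steps-mapᵗ f (x ∷ xs) = ≡.cong suc (≡.trans (ℕ.+-identityʳ _) (steps-mapᵗ f xs))

  steps-appendᵗ : ∀ (xs ys : List A) → steps (appendᵗ xs ys) ≡ suc (length xs)
  steps-appendᵗ []       ys = ≡.refl
  steps-appendᵗ (x ∷ xs) ys = ≡.cong suc (≡.trans (ℕ.+-identityʳ _) (steps-appendᵗ xs ys))

^-distribʳ-* : ∀ k m n → (m * n) ^ k ≡ m ^ k * n ^ k
^-distribʳ-* zero    m n = ≡.refl
^-distribʳ-* (suc k) m n = ≡.trans (≡.cong (m * n *_) (^-distribʳ-* k m n))
  (solve 4 (λ m n x y → m :* n :* (x :* y) := (m :* x) :* (n :* y)) ≡.refl m n (m ^ k) (n ^ k))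
  where open +-*-Solver

length-cartesianProduct : ∀ {A B : Set} (xs : List A) (ys : List B) →
                          length (cartesianProduct xs ys) ≡ length xs * length ys
length-cartesianProduct []       ys = ≡.refl
length-cartesianProduct (x ∷ xs) ys = ≡.trans (length-++ (map (x ,_) ys))
  (≡.cong₂ _+_ (length-map (x ,_) ys) (length-cartesianProduct xs ys))

length-allFin : ∀ n → length (allFin n) ≡ n
length-allFin n = length-tabulate {n = n} (λ i → i)

length-compositions : ∀ m → length (value (compositions m)) ≤ 2 ^ m
length-compositions zero          = ℕ.≤-refl
length-compositions (suc zero)    = s≤s z≤n
length-compositions (suc (suc m)) = begin
  length (value (compositions (suc (suc m))))  ≡⟨ ≡.cong length (value-compositions m) ⟩
  length (map (1 ∷_) c ++ map incHead c)       ≡⟨ length-++ (map (1 ∷_) c) ⟩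
  length (map (1 ∷_) c) + length (map incHead c)  ≡⟨ ≡.cong₂ _+_ (length-map (1 ∷_) c)
      (length-map incHead c) ⟩
  length c + length c                          ≤⟨ ℕ.+-mono-≤ (length-compositions (suc m))
      (length-compositions (suc m)) ⟩
  2 ^ suc m + 2 ^ suc m                        ≡⟨ ≡.cong (2 ^ suc m +_) (ℕ.+-identityʳ _) ⟨
  2 ^ suc (suc m)                              ∎
  where
  open ℕ.≤-Reasoning
  c = value (compositions (suc m))

-- With x = 2^(m+1), the two maps and the append traverse lists of total cost at most 3 · 2x, so the
-- recurrence adds 6x; the factor 6 is the one for which 6x + 6x is again 6 · 2x.
steps-compositions : ∀ m → steps (compositions m) ≤ 6 * 2 ^ m
steps-compositions zero          = s≤s z≤n
steps-compositions (suc zero)    = s≤s z≤n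
steps-compositions (suc (suc m)) = begin
  steps (compositions (suc m)) +
      (steps (mapᵗ (1 ∷_) c) + (steps (mapᵗ incHead c) + steps
          (appendᵗ (value (mapᵗ (1 ∷_) c)) (value (mapᵗ incHead c)))))
    ≡⟨ ≡.cong (steps (compositions (suc m)) +_)
        (≡.cong₂ _+_ (steps-mapᵗ (1 ∷_) c) (≡.cong₂ _+_ (steps-mapᵗ incHead c)
         (≡.trans (steps-appendᵗ (value (mapᵗ (1 ∷_) c)) _)
             (≡.cong suc (≡.trans (≡.cong length (value-mapᵗ (1 ∷_) c)) (length-map (1 ∷_) c)))))) ⟩
  steps (compositions (suc m)) + (suc (length c) + (suc (length c) + suc (length c)))
    ≤⟨ ℕ.+-mono-≤ (steps-compositions (suc m)) (ℕ.+-mono-≤ bound (ℕ.+-mono-≤ bound bound)) ⟩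
  6 * x + ((x + x) + ((x + x) + (x + x)))
    ≡⟨ solve 1 (λ x → con 6 :* x :+ ((x :+ x) :+ ((x :+ x) :+ (x :+ x))) := con 6 :* (con 2 :* x)) ≡.refl x ⟩
  6 * 2 ^ suc (suc m) ∎
  where
  open ℕ.≤-Reasoning
  open +-*-Solver
  c = value (compositions (suc m))
  x = 2 ^ suc m
  bound : suc (length c) ≤ x + x
  bound = ℕ.+-mono-≤ (ℕ.m^n>0 2 (suc m)) (length-compositions (suc m))

module _ {n : ℕ} where

  steps-memberᵗ : ∀ (e : Edge n) {b} T → length T ≤ b → steps (memberᵗ e T) ≤ suc (b * 2)
  steps-memberᵗ e T len = ℕ.≤-trans (steps-anyᵗ _ T (λ _ → ℕ.≤-refl)) (s≤s (ℕ.*-monoˡ-≤ 2 len))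

  steps-subsetᵗ : ∀ {b} (T T′ : List (Edge n)) → length T ≤ b → length T′ ≤ b →
                  steps (subsetᵗ T T′) ≤ suc (b * suc (suc (b * 2)))
  steps-subsetᵗ {b} T T′ len len′ = ℕ.≤-trans
    (steps-allᵗ (λ e → memberᵗ e T′) T (λ e → steps-memberᵗ e T′ len′))
    (s≤s (ℕ.*-monoˡ-≤ (suc (suc (b * 2))) len))

  steps-insertᵗ : ∀ (e : Edge n) fs → steps (insertᵗ e fs) ≤ suc (length fs)
  steps-insertᵗ e []       = ℕ.≤-refl
  steps-insertᵗ e (f ∷ fs) with e ≤ˡᵉˣ f
  ... | true  = s≤s z≤n
  ... | false = s≤s (ℕ.≤-trans (ℕ.≤-reflexive (ℕ.+-identityʳ _)) (steps-insertᵗ e fs))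

  length-insertᵗ : ∀ (e : Edge n) fs → length (value (insertᵗ e fs)) ≡ suc (length fs)
  length-insertᵗ e []       = ≡.refl
  length-insertᵗ e (f ∷ fs) with e ≤ˡᵉˣ f
  ... | true  = ≡.refl
  ... | false = ≡.cong suc (length-insertᵗ e fs)

  length-sortᵗ : ∀ (es : List (Edge n)) → length (value (sortᵗ es)) ≡ length es
  length-sortᵗ []       = ≡.refl
  length-sortᵗ (e ∷ es) = ≡.trans (length-insertᵗ e (value (sortᵗ es))) (≡.cong suc (length-sortᵗ es))

  steps-sortᵗ : ∀ {b} (es : List (Edge n)) → length es ≤ b → steps (sortᵗ es) ≤ suc (length es * suc (suc b))
  steps-sortᵗ     []       _   = ℕ.≤-refl
  steps-sortᵗ {b} (e ∷ es) len = s≤s (begin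
    steps (sortᵗ es) + steps (insertᵗ e (value (sortᵗ es)))
      ≤⟨ ℕ.+-mono-≤ (steps-sortᵗ es (ℕ.<⇒≤ len))
          (ℕ.≤-trans (steps-insertᵗ e (value (sortᵗ es)))
              (s≤s (ℕ.≤-trans (ℕ.≤-reflexive (length-sortᵗ es)) (ℕ.<⇒≤ len)))) ⟩
    suc (length es * suc (suc b)) + suc b
      ≡⟨ solve 2 (λ x b → con 1 :+ x :+ (con 1 :+ b) := con 2 :+ b :+ x) ≡.refl (length es * suc (suc b)) b ⟩
    suc (suc b) + length es * suc (suc b) ∎)
    where
    open ℕ.≤-Reasoning
    open +-*-Solver

  unique-edges : ∀ {T : List (Edge n)} → Unique T → length T ≤ n * n
  unique-edges {T} u = begin
    length T                                           ≤⟨ Unique-⊆⇒length≤ _≟ᴱ_ u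
        (λ {(i , j)} _ → ∈-cartesianProduct⁺ (∈-allFin i) (∈-allFin j)) ⟩
    length (cartesianProduct (allFin n) (allFin n))    ≡⟨ length-cartesianProduct (allFin n) (allFin n) ⟩
    length (allFin n) * length (allFin n)              ≡⟨ ≡.cong₂ _*_ (length-allFin n) (length-allFin n) ⟩
    n * n                                              ∎
    where open ℕ.≤-Reasoning

-- `edges` counts all pairs of points, which bounds every list of edges without repetition. In
-- `neighbour`, the summands 2, 3, 3, 3 are the traversals for at most one apex on either side.
-- `node` adds up branching, picking and the final comparison, so that a single amount pays for any
-- kind of node of the search tree.
module Bounds (n : ℕ) where
  edges member triangle apex neighbour flipping next necessary picking subset node : ℕ
  edges     = n * n
  member    = suc (edges * 2)
  triangle  = 1 + (member + (member + (member + (n + suc (n * 4)))))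
  apex      = n + suc (n * suc triangle)
  neighbour = apex + (apex + (2 + (3 + (3 + 3))))
  flipping  = apex + (apex + (4 + member))
  next      = suc (edges * suc (member + member))
  necessary = suc (edges * suc member) + suc (edges * suc (suc edges))
  picking   = next + (necessary + 1)
  subset    = suc (edges * suc member)
  node      = (neighbour + suc flipping + 6) + (suc picking + (subset + subset))

-- The tests and flips of the algorithm agree with the geometry.

module Correctness {a ℓ} (F : OrderedField a ℓ) {n : ℕ} (p : Fin n → Point F)
                   (distinct : ∀ {i j} → _≈ₚ_ F (p i) (p j) → i ≡ j) (Tend : List (Edge n)) where
  open OrderedField F using (0#; _<?_)
  open Triangulations F p
  open Algorithm F p Tend
  open Flips F p distinct public

  leftᵗ-true⁺ : ∀ {i j k} → Left i j k → value (leftᵗ i j k) ≡ true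
  leftᵗ-true⁺ {i} {j} {k} = dec-true (0# <? [ i , j , k ])

  leftᵗ-true⁻ : ∀ {i j k} → value (leftᵗ i j k) ≡ true → Left i j k
  leftᵗ-true⁻ {i} {j} {k} = does-true (0# <? [ i , j , k ])

  insideᵗ-true⁺ : ∀ {v i j k} → Inside v i j k → value (insideᵗ v i j k) ≡ true
  insideᵗ-true⁺ {v} {i} {j} {k} (ijv , jkv , kiv) =
    ∧ᵗ-true⁺ (leftᵗ i j v) (leftᵗ-true⁺ ijv) (∧ᵗ-true⁺ (leftᵗ j k v) (leftᵗ-true⁺ jkv) (leftᵗ-true⁺ kiv))

  insideᵗ-true⁻ : ∀ {v i j k} → value (insideᵗ v i j k) ≡ true → Inside v i j k
  insideᵗ-true⁻ {v} {i} {j} {k} p =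
    let q , r = ∧ᵗ-true⁻ (leftᵗ i j v) p
        s , t = ∧ᵗ-true⁻ (leftᵗ j k v) r
    in leftᵗ-true⁻ q , leftᵗ-true⁻ s , leftᵗ-true⁻ t

  convexᵗ-true⁺ : ∀ {i j k l} → ConvexQuadrilateral i j k l → value (convexᵗ i j k l) ≡ true
  convexᵗ-true⁺ {i} {j} {k} {l} (ijk , jkl , kli , lij) =
    ∧ᵗ-true⁺ (leftᵗ i j k) (leftᵗ-true⁺ ijk) (∧ᵗ-true⁺ (leftᵗ j k l) (leftᵗ-true⁺ jkl)
      (∧ᵗ-true⁺ (leftᵗ k l i) (leftᵗ-true⁺ kli) (leftᵗ-true⁺ lij)))

  convexᵗ-true⁻ : ∀ {i j k l} → value (convexᵗ i j k l) ≡ true → ConvexQuadrilateral i j k l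
  convexᵗ-true⁻ {i} {j} {k} {l} p =
    let q , r = ∧ᵗ-true⁻ (leftᵗ i j k) p
        s , t = ∧ᵗ-true⁻ (leftᵗ j k l) r
        u , v = ∧ᵗ-true⁻ (leftᵗ k l i) t
    in leftᵗ-true⁻ q , leftᵗ-true⁻ s , leftᵗ-true⁻ u , leftᵗ-true⁻ v

  triangleᵗ-true⁺ : ∀ {T i j k} → Triangle T i j k → value (triangleᵗ T i j k) ≡ true
  triangleᵗ-true⁺ {T} {i} {j} {k} t =
    ∧ᵗ-true⁺ (leftᵗ i j k) (leftᵗ-true⁺ ccw) (∧ᵗ-true⁺ (memberᵗ (edge i j) T) (memberᵗ-true⁺ ij)
      (∧ᵗ-true⁺ (memberᵗ (edge j k) T) (memberᵗ-true⁺ jk) (∧ᵗ-true⁺ (memberᵗ (edge k i) T) (memberᵗ-true⁺ ki)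
        (allᵗ-true⁺ _ (allFin n) λ {v} _ → ≢true⇒not (empty v ∘ insideᵗ-true⁻)))))
    where open Triangle t

  triangleᵗ-true⁻ : ∀ {T i j k} → value (triangleᵗ T i j k) ≡ true → Triangle T i j k
  triangleᵗ-true⁻ {T} {i} {j} {k} p =
    let q₁ , r₁ = ∧ᵗ-true⁻ (leftᵗ i j k) p
        q₂ , r₂ = ∧ᵗ-true⁻ (memberᵗ (edge i j) T) r₁
        q₃ , r₃ = ∧ᵗ-true⁻ (memberᵗ (edge j k) T) r₂
        q₄ , r₄ = ∧ᵗ-true⁻ (memberᵗ (edge k i) T) r₃
    in record
      { ccw = leftᵗ-true⁻ q₁ ; ij = memberᵗ-true⁻ q₂ ; jk = memberᵗ-true⁻ q₃ ; ki = memberᵗ-true⁻ q₄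
      ; empty = λ v inside → not-true
          (allᵗ-true⁻ (λ v → notᵗ (insideᵗ v i j k)) r₄ (∈-allFin v)) (insideᵗ-true⁺ inside) }

  ∈-apexes⁺ : ∀ {T i j k} → Triangle T i j k → k ∈ value (apexes T i j)
  ∈-apexes⁺ {T} {i} {j} {k} t = ∈-filterᵗ⁺ (triangleᵗ T i j) (∈-allFin k) (triangleᵗ-true⁺ t)

  ∈-apexes⁻ : ∀ {T i j k} → k ∈ value (apexes T i j) → Triangle T i j k
  ∈-apexes⁻ {T} {i} {j} k∈ = triangleᵗ-true⁻ (proj₂ (∈-filterᵗ⁻ (triangleᵗ T i j) (allFin n) k∈))

  value-neighbours : ∀ T i j → let ms = value (apexes T i j) ++ value (apexes T j i) in
    value (neighbours T (i , j)) ≡ map (edge i) ms ++ map (edge j) ms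
  value-neighbours T i j = combine (value (apexes T i j)) (value (apexes T j i))
    where
    combine : ∀ ks ls →
      value (appendᵗ ks ls >>= λ ms → mapᵗ (edge i) ms >>= λ es → mapᵗ (edge j) ms >>= λ fs → appendᵗ es fs)
      ≡ map (edge i) (ks ++ ls) ++ map (edge j) (ks ++ ls)
    combine ks ls = ≡.trans
      (value-appendᵗ (value (mapᵗ (edge i) ms)) (value (mapᵗ (edge j) ms)))
      (≡.cong₂ _++_ (≡.trans (value-mapᵗ (edge i) ms) (≡.cong (map (edge i)) (value-appendᵗ ks ls)))
                    (≡.trans (value-mapᵗ (edge j) ms) (≡.cong (map (edge j)) (value-appendᵗ ks ls))))
      where ms = value (appendᵗ ks ls)

  ∈-neighbours⁺ : ∀ {T i j g} → Adjacent T i j g → g ∈ value (neighbours T (i , j))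
  ∈-neighbours⁺ {T} {i} {j} (y , t , side) = ≡.subst (_ ∈_) (≡.sym (value-neighbours T i j)) (by-side side)
    where
    ms = value (apexes T i j) ++ value (apexes T j i)
    y∈ : y ∈ ms
    y∈ = [ (λ t → ∈-++⁺ˡ (∈-apexes⁺ t)) , (λ t → ∈-++⁺ʳ (value (apexes T i j)) (∈-apexes⁺ t)) ]′ t
    by-side : ∀ {g} → g ≡ edge i y ⊎ g ≡ edge j y → g ∈ map (edge i) ms ++ map (edge j) ms
    by-side (inj₁ ≡.refl) = ∈-++⁺ˡ (∈-map⁺ (edge i) y∈)
    by-side (inj₂ ≡.refl) = ∈-++⁺ʳ (map (edge i) ms) (∈-map⁺ (edge j) y∈)

  neighbours-canonical : ∀ {T e g} → g ∈ value (neighbours T e) → Canonical g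
  neighbours-canonical {T} {i , j} {g} g∈ =
    [ from i , from j ]′ (∈-++⁻ (map (edge i) ms) (≡.subst (g ∈_) (value-neighbours T i j) g∈))
    where
    ms = value (apexes T i j) ++ value (apexes T j i)
    from : ∀ i → g ∈ map (edge i) ms → Canonical g
    from i g∈ᵢ = let y , _ , eq = ∈-map⁻ (edge i) g∈ᵢ in ≡.subst Canonical (≡.sym eq) (edge-canonical i y)

  -- `flipQuadrilateral` looks only at the head of each list of apexes; uniqueness of the apex makes
  -- that head the right one.
  apexes-single : ∀ {T i j k} → Embedded T → Triangle T i j k → ∃[ ks ] value (apexes T i j) ≡ k ∷ ks
  apexes-single {T} {i} {j} {k} emb t =
    head-of (value (apexes T i j)) (∈-apexes⁺ t) λ x∈ → apex-unique emb (∈-apexes⁻ x∈) t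
    where
    head-of : ∀ ks → k ∈ ks → (∀ {x} → x ∈ ks → x ≡ k) → ∃[ ks′ ] ks ≡ k ∷ ks′
    head-of (x ∷ ks) _ all-k = ks , ≡.cong (_∷ ks) (all-k (here ≡.refl))

  exchangeIf : List (Edge n) → Edge n → Edge n → Bool → Timed (Maybe (List (Edge n)))
  exchangeIf T e f b =
    if b then (filterᵗ (λ g → step (not (does (g ≟ᴱ e)))) T >>= λ T₀ → return (just (f ∷ T₀)))
    else return nothing

  exchangeIf-true : ∀ T e f {b} → b ≡ true → value (exchangeIf T e f b) ≡ just (exchange e f T)
  exchangeIf-true T e f ≡.refl = ≡.cong (λ T₀ → just (f ∷ T₀)) (value-filterᵗ-≢ e T)

  exchangeIf-just : ∀ T e f b {T′} → value (exchangeIf T e f b) ≡ just T′ → b ≡ true × T′ ≡ exchange e f T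
  exchangeIf-just T e f true q =
    ≡.refl , just-injective (≡.trans (≡.sym q) (exchangeIf-true T e f ≡.refl))

  flipQuadrilateral-just : ∀ T i j {T′} ks ls → value (flipQuadrilateral T (i , j) ks ls) ≡ just T′ →
    ∃[ k ] ∃[ l ] k ∈ ks × l ∈ ls × value (convexᵗ i l j k) ≡ true × T′ ≡ exchange (i , j) (edge k l) T
  flipQuadrilateral-just T i j {T′} (k ∷ ks) (l ∷ ls) q =
    k , l , here ≡.refl , here ≡.refl , exchangeIf-just T (i , j) (edge k l) (value (convexᵗ i l j k)) q
  flipQuadrilateral-just T i j (_ ∷ _) [] ()

  flipᵗ-flippable : ∀ {T i j k l} → Embedded T → Flippable T i j k l →
    value (flipᵗ T (i , j)) ≡ just (exchange (i , j) (edge k l) T)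
  flipᵗ-flippable {T} {i} {j} emb (flippable upper lower convex) =
    let ks , eq  = apexes-single emb upper
        ls , eq′ = apexes-single emb lower
    in ≡.trans (≡.cong₂ (λ ks ls → value (flipQuadrilateral T (i , j) ks ls)) eq eq′)
               (exchangeIf-true T (i , j) _ (convexᵗ-true⁺ convex))

  flipᵗ-complete : ∀ {T e T′} → Embedded T → Flip T e T′ → value (flipᵗ T e) ≡ just T′
  flipᵗ-complete {T} emb f =
    let i , j , k , l , e≡ij , fl , T′≡ = Flip⇒Flippable f
    in ≡.trans (oriented fl e≡ij (edge-cases i j)) (≡.cong just (≡.sym T′≡))
    where
    oriented : ∀ {e i j k l} → Flippable T i j k l → e ≡ edge i j → edge i j ≡ (i , j) ⊎ edge i j ≡ (j , i) →
               value (flipᵗ T e) ≡ just (exchange e (edge k l) T)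
    oriented {i = i} {j} {k} {l} fl e≡ij (inj₁ ij) =
      ≡.subst (λ e → value (flipᵗ T e) ≡ just (exchange e (edge k l) T))
        (≡.sym (≡.trans e≡ij ij)) (flipᵗ-flippable emb fl)
    -- The label lists the endpoints in the other order, so the algorithm sees the quadrilateral
    -- turned by a half turn and inserts `edge l k`.
    oriented {i = i} {j} {k} {l} fl e≡ij (inj₂ ji) =
      ≡.subst₂ (λ e h → value (flipᵗ T e) ≡ just (exchange e h T))
        (≡.sym (≡.trans e≡ij ji)) (edge-sym l k) (flipᵗ-flippable emb (opposite fl))

  flipᵗ-sound : ∀ {T e T′} → Canonical e → value (flipᵗ T e) ≡ just T′ → Flip T e T′
  flipᵗ-sound {T} {i , j} can q =
    let k , l , k∈ , l∈ , c , T′≡ = flipQuadrilateral-just T i j (value (apexes T i j))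
            (value (apexes T j i)) q
    in record
      { diagonal = ≡.sym can ; left = ∈-apexes⁻ k∈ ; right = ∈-apexes⁻ l∈
      ; convex = convexᵗ-true⁻ c ; result = T′≡ }

  whenJust-true⁻ : ∀ {A : Set} (m : Timed (Maybe A)) κ → value (whenJust m κ) ≡ true →
                   ∃[ x ] value m ≡ just x × value (κ x) ≡ true
  whenJust-true⁻ m κ q with value m
  ... | just x = x , ≡.refl , q

  whenJust-true⁺ : ∀ {A : Set} (m : Timed (Maybe A)) {x} κ → value m ≡ just x → value (κ x) ≡ true →
                   value (whenJust m κ) ≡ true
  whenJust-true⁺ m κ eq q rewrite eq = q

  flipBack-sound : ∀ {T e} w κ → Canonical e → All Canonical w → value (flipBack T e w κ) ≡ true →
    ∃[ e′ ] ∃[ w′ ] ∃[ T′ ] Canonical e′ × All Canonical w′ × Flip T e T′ × value (κ T′ e′ w′) ≡ true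
  flipBack-sound {T} {e} (e′ ∷ w′) κ can (can′ ∷ can-w′) q =
    let T′ , f , r = whenJust-true⁻ (flipᵗ T e) (λ T′ → κ T′ e′ w′) q
    in e′ , w′ , T′ , can′ , can-w′ , flipᵗ-sound can f , r

  -- Soundness of the search.

  Reaches : List (Edge n) → ℕ → (List (Edge n) → Timed Bool) → Set ℓ
  Reaches T s κ = ∃[ T′ ] ∃[ es ] Path T es T′ × length es ≡ s × value (κ T′) ≡ true

  reach : ∀ {T e T′ s κ} → Flip T e T′ → Reaches T′ s κ → Reaches T (suc s) κ
  reach f (T″ , es , path , len , q) = T″ , _ ∷ es , f ∷ path , ≡.cong suc len , q

  -- Moves leave the triangulation unchanged, so the length of the path is the number s of remaining
  -- flips, whatever r is. The continuation is arbitrary because the later iterations are run inside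
  -- it.
  branch-sound : ∀ r s {T e w} κ → Canonical e → All Canonical w →
                 value (branch r s T e w κ) ≡ true → Reaches T s κ
  branch-sound zero (suc zero) {T} {e} κ can _ q =
    let T′ , f , r = whenJust-true⁻ (flipᵗ T e) κ q
    in reach {κ = κ} (flipᵗ-sound can f) (T′ , [] , stop ≐-refl , ≡.refl , r)
  branch-sound zero (suc (suc s)) {T} {e} {w} κ can can-w q =
    let e′ , w′ , T′ , can′ , can-w′ , f , q′ =
          flipBack-sound {T} {e} w (λ T′ e′ w′ → branch zero (suc s) T′ e′ w′ κ) can can-w q
    in reach {κ = κ} f (branch-sound zero (suc s) κ can′ can-w′ q′)
  branch-sound (suc r) (suc s) {T} {e} {w} κ can can-w q =
    [ (λ q₁ →
        let g , g∈ , q₂ = anyᵗ-true⁻ (λ g → branch r (suc s) T g (e ∷ w) κ) q₁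
        in branch-sound r (suc s) κ (neighbours-canonical {T} {e} g∈) (can ∷ can-w) q₂)
    , (λ q₁ →
        let e′ , w′ , T′ , can′ , can-w′ , f , q₂ =
              flipBack-sound {T} {e} w (λ T′ e′ w′ → branch (suc r) s T′ e′ w′ κ) can can-w
                (guard-true (does (suc r ℕ.<? s)) q₁)
        in reach {κ = κ} f (branch-sound (suc r) s κ can′ can-w′ q₂))
    ]′ (∨ᵗ-true⁻ (neighbours T e >>= anyᵗ (λ g → branch r (suc s) T g (e ∷ w) κ)) q)
    where
    guard-true : ∀ b {m} → value (if b then m else step NO) ≡ true → value m ≡ true
    guard-true true q = q

  NecessaryEdge : List (Edge n) → Edge n → Set
  NecessaryEdge T e = e ∈ T × e ∉ Tend

  necessaryᵗ⁻ : ∀ {e} → value (notᵗ (memberᵗ e Tend)) ≡ true → e ∉ Tend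
  necessaryᵗ⁻ q e∈ = not-true q (memberᵗ-true⁺ e∈)

  necessaryᵗ⁺ : ∀ {e} → e ∉ Tend → value (notᵗ (memberᵗ e Tend)) ≡ true
  necessaryᵗ⁺ e∉ = ≢true⇒not (e∉ ∘ memberᵗ-true⁻)

  ∈-necessaryEdges⁻ : ∀ T {e} → e ∈ value (necessaryEdges T) → NecessaryEdge T e
  ∈-necessaryEdges⁻ T e∈ =
    let e∈T , q = ∈-filterᵗ⁻ (λ e → notᵗ (memberᵗ e Tend)) T (∈-sortᵗ⁻ _ e∈) in e∈T , necessaryᵗ⁻ q

  ∈-necessaryEdges⁺ : ∀ {T e} → NecessaryEdge T e → e ∈ value (necessaryEdges T)
  ∈-necessaryEdges⁺ (e∈T , e∉) = ∈-sortᵗ _ (∈-filterᵗ⁺ (λ e → notᵗ (memberᵗ e Tend)) e∈T (necessaryᵗ⁺ e∉))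

  nextNecessary-sound : ∀ T O {e O′} → value (nextNecessary T O) ≡ just (e , O′) → NecessaryEdge T e
  nextNecessary-sound T (f ∷ O) = found (memberᵗ f T ∧ᵗ notᵗ (memberᵗ f Tend))
    (λ q → let q₁ , q₂ = ∧ᵗ-true⁻ (memberᵗ f T) q in memberᵗ-true⁻ q₁ , necessaryᵗ⁻ q₂)
    where
    found : ∀ m → (value m ≡ true → NecessaryEdge T f) → ∀ {e O′} →
      value (m >>= λ b → if b then return (just (f , O)) else nextNecessary T O) ≡ just
          (e , O′) → NecessaryEdge T e
    found m nec q with value m
    found m nec ≡.refl | true  = nec ≡.refl
    found m nec q      | false = nextNecessary-sound T O q

  uncons-just : ∀ {A : Set} {xs : List A} {y ys} → uncons xs ≡ just (y , ys) → xs ≡ y ∷ ys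
  uncons-just {xs = _ ∷ _} ≡.refl = ≡.refl

  uncons-nothing : ∀ {A : Set} {xs : List A} → uncons xs ≡ nothing → xs ≡ []
  uncons-nothing {xs = []} _ = ≡.refl

  orElse : Timed (Maybe (Edge n × List (Edge n))) → Timed (List (Edge n)) →
      Timed (Maybe (Edge n × List (Edge n)))
  orElse m m′ = m >>= maybe′ (λ eO → return (just eO)) (m′ >>= λ O′ → step (uncons O′))

  orElse-just : ∀ m m′ {e O′} → value (orElse m m′) ≡ just (e , O′) →
                value m ≡ just (e , O′) ⊎ value m′ ≡ e ∷ O′
  orElse-just m m′ q with value m
  ... | just _  = inj₁ q
  ... | nothing = inj₂ (uncons-just q)

  orElse-nothing : ∀ m m′ → value (orElse m m′) ≡ nothing → value m′ ≡ []
  orElse-nothing m m′ q with value m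
  ... | nothing = uncons-nothing q

  pick-sound : ∀ T O {e O′} → value (pick T O) ≡ just (e , O′) → NecessaryEdge T e
  pick-sound T O q = [ nextNecessary-sound T O ,
      (λ eq → ∈-necessaryEdges⁻ T (≡.subst (_ ∈_) (≡.sym eq) (here ≡.refl))) ]′
    (orElse-just (nextNecessary T O) (necessaryEdges T) q)

  pick-nothing : ∀ T O → value (pick T O) ≡ nothing → ∀ {e} → e ∈ T → e ∈ Tend
  pick-nothing T O q {e} e∈T with DecMembership._∈?_ _≟ᴱ_ e Tend
  ... | yes e∈ = e∈
  ... | no  e∉ = contradiction
    (≡.subst (e ∈_) (orElse-nothing (nextNecessary T O) (necessaryEdges T) q)
        (∈-necessaryEdges⁺ (e∈T , e∉))) λ ()

  iterations-sound : ∀ ks {T O} → Embedded T → value (iterations ks T O) ≡ true →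
                     ∃[ es ] Path T es Tend × length es ≡ sum ks
  iterations-sound [] {T} emb q =
    let q₁ , q₂ = ∧ᵗ-true⁻ (subsetᵗ T Tend) q
    in [] , stop (subsetᵗ-true⁻ q₁ , subsetᵗ-true⁻ q₂) , ≡.refl
  iterations-sound (k ∷ ks) {T} {O} emb q =
    let (e , O′) , q₁ , q₂ = whenJust-true⁻ (pick T O)
          (λ (e , O′) → branch (pred k) k T e [] (λ T′ → iterations ks T′ O′)) q
        e∈T , _ = pick-sound T O q₁
        T′ , es , path , len , q₃ = branch-sound (pred k) k (λ T′ → iterations ks T′ O′)
            (canonical emb e∈T) [] q₂
        fs , path′ , len′ = iterations-sound ks (path-embedded emb path) q₃
    in es ++ fs , path ◅◅ path′ , ≡.trans (length-++ es) (≡.cong₂ ℕ._+_ len len′)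

  search-sound : ∀ {T k} → Embedded T → value (search T k) ≡ true → ∃[ es ] Path T es Tend × length es ≡ k
  search-sound {T} {k} emb q =
    let ks , ks∈ , q₁ = anyᵗ-true⁻ (λ ks → necessaryEdges T >>= iterations ks T) q
        es , path , len = iterations-sound ks emb q₁
    in es , path , ≡.trans len (composition-sum (∈-compositions⁻ k ks∈))

  -- Completeness: visits and their execution by the search.

  -- Visit T e d T′ is a walk that starts at e, performs d actions of type (i)
  -- and suc d of type (ii) with the flip of e last, and leads from T to T′.
  data Visit : List (Edge n) → Edge n → ℕ → List (Edge n) → Set ℓ where
    now  : ∀ {T e T′} → Flip T e T′ → Visit T e 0 T′
    push : ∀ {T e g d T₁ d′ T₂} → g ∈ value (neighbours T e) → Visit T g d T₁ → Visit T₁ e d′ T₂ →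
           Visit T e (suc (d ℕ.+ d′)) T₂

  visit-path : ∀ {T e d T′} → Visit T e d T′ → ∃[ es ] Path T es T′ × length es ≡ suc d
  visit-path (now f) = _ , f ∷ stop ≐-refl , ≡.refl
  visit-path (push {d = d} {d′ = d′} _ v v′) =
    let es , path , len = visit-path v ; es′ , path′ , len′ = visit-path v′
    in es ++ es′ , path ◅◅ path′ ,
       ≡.trans (length-++ es) (≡.trans (≡.cong₂ ℕ._+_ len len′) (≡.cong suc (ℕ.+-suc d d′)))

  ∈-neighbours-edge : ∀ {T i j g} → Adjacent T i j g → g ∈ value (neighbours T (edge i j))
  ∈-neighbours-edge {T} {i} {j} {g} adj =
    [ (λ eq → ≡.subst (λ e → g ∈ value (neighbours T e)) (≡.sym eq) (∈-neighbours⁺ adj))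
    , (λ eq → ≡.subst (λ e → g ∈ value (neighbours T e)) (≡.sym eq) (∈-neighbours⁺ (Adjacent-sym adj)))
    ]′ (edge-cases i j)

  -- `unflipped` and `fs⊆es` are the invariants of the recursion: while an adjacent g is visited
  -- first, they ensure that e is still present afterwards and is not flipped by what remains before
  -- its own flip. `count` measures the decrease.
  record Visited (T : List (Edge n)) (e : Edge n) (es : List (Edge n)) (T′ : List (Edge n)) : Set ℓ where
    field
      {d}       : ℕ
      {T₁}      : List (Edge n)
      {fs}      : List (Edge n)
      visit     : Visit T e d T₁
      remaining : Path T₁ fs T′
      count     : d ℕ.+ length fs ≡ length es
      fs⊆es     : ∀ {g} → g ∈ fs → g ∈ es
      unflipped : ∀ {g} → g ∈ T → g ∉ es → g ≢ e → g ∈ T₁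

  abstract
    -- Every edge e that is flipped after a path es can be visited: either its
    -- quadrilateral is untouched by es and e can be flipped at once, or es flips an
    -- edge g adjacent to e, and the flips up to the one of g are rearranged into a
    -- visit of g.
    visited : ∀ N {T es T₁ T′ e} → length es ℕ.< N → Embedded T → e ∈ T → e ∉ es →
              Path T es T₁ → Flip T₁ e T′ → Visited T e es T′
    visited (suc N) {T} {es} {T₁} (s≤s es≤N) emb e∈T e∉es path f with Flip⇒Flippable f
    ... | i , j , k , l , ≡.refl , flippable upper lower convex , ≡.refl =
      by-origin (triangle-origin emb path e∈T e∉es upper)
                (triangle-origin emb path (∈-edge-sym i j e∈T) (≡.subst (_∉ es) (edge-sym i j) e∉es) lower)
      where
      e : Edge n
      e = edge i j
      by-neighbour : ∀ {g} → Adjacent T i j g → Split T es T₁ g → Visited T e es (exchange e (edge k l) T₁)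
      by-neighbour {g} adj s = record
        { visit     = push (∈-neighbours-edge adj) V.visit W.visit
        ; remaining = W.remaining
        ; count     = counting
        ; fs⊆es     = rest⊆es ∘ W.fs⊆es
        ; unflipped = λ g∈T g∉es g≢e → W.unflipped (kept g∈T g∉es) (g∉es ∘ rest⊆es) g≢e
        }
        where
        open Split s using (es₁; es₂; split)
        module S = Split s
        open ≡-Reasoning
        lengths : length es ≡ length es₁ ℕ.+ suc (length es₂)
        lengths = ≡.trans (≡.cong length split) (length-++ es₁)
        es₁⊆es : ∀ {h} → h ∈ es₁ → h ∈ es
        es₁⊆es = ≡.subst (_ ∈_) (≡.sym split) ∘ ∈-++⁺ˡ
        es₂⊆es : ∀ {h} → h ∈ es₂ → h ∈ es
        es₂⊆es = ≡.subst (_ ∈_) (≡.sym split) ∘ ∈-++⁺ʳ es₁ ∘ there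
        g∈es : g ∈ es
        g∈es = ≡.subst (g ∈_) (≡.sym split) (∈-++⁺ʳ es₁ (here ≡.refl))
        module V = Visited (visited N
          (ℕ.<-≤-trans (≡.subst (length es₁ ℕ.<_) (≡.sym lengths) (ℕ.m<m+n (length es₁) (s≤s z≤n))) es≤N)
          emb (Adjacent⇒∈ adj) S.g∉before S.before S.flipped)
        rest⊆es : ∀ {h} → h ∈ V.fs ++ es₂ → h ∈ es
        rest⊆es h∈ = [ es₁⊆es ∘ V.fs⊆es , es₂⊆es ]′ (∈-++⁻ V.fs h∈)
        kept : ∀ {h} → h ∈ T → h ∉ es → h ∈ V.T₁
        kept h∈T h∉es = V.unflipped h∈T (h∉es ∘ es₁⊆es) (λ { ≡.refl → h∉es g∈es })
        total : suc (V.d ℕ.+ length (V.fs ++ es₂)) ≡ length es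
        total = begin
          suc (V.d ℕ.+ length (V.fs ++ es₂))        ≡⟨ ≡.cong (λ x → suc (V.d ℕ.+ x)) (length-++ V.fs) ⟩
          suc (V.d ℕ.+ (length V.fs ℕ.+ length es₂))  ≡⟨ ≡.cong suc (ℕ.+-assoc V.d _ _) ⟨
          suc (V.d ℕ.+ length V.fs ℕ.+ length es₂)    ≡⟨ ≡.cong (λ x → suc (x ℕ.+ length es₂)) V.count ⟩
          suc (length es₁ ℕ.+ length es₂)            ≡⟨ ℕ.+-suc (length es₁) (length es₂) ⟨
          length es₁ ℕ.+ suc (length es₂)            ≡⟨ lengths ⟨
          length es                                  ∎
        -- After the visit of g the walk is back at e, and the path leading to the flip of e has
        -- lost the `suc V.d` flips of that visit, so the recursion applies to e itself.
        module W = Visited (visited N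
          (ℕ.<-≤-trans (≡.subst (length (V.fs ++ es₂) ℕ.<_) total (s≤s (ℕ.m≤n+m _ V.d))) es≤N)
          (path-embedded emb (proj₁ (proj₂ (visit-path V.visit))))
          (kept e∈T e∉es) (e∉es ∘ rest⊆es) (V.remaining ◅◅ S.rest) f)
        counting : suc (V.d ℕ.+ W.d) ℕ.+ length W.fs ≡ length es
        counting = begin
          suc (V.d ℕ.+ W.d ℕ.+ length W.fs)    ≡⟨ ≡.cong suc (ℕ.+-assoc V.d W.d _) ⟩
          suc (V.d ℕ.+ (W.d ℕ.+ length W.fs))  ≡⟨ ≡.cong (λ x → suc (V.d ℕ.+ x)) W.count ⟩
          suc (V.d ℕ.+ length (V.fs ++ es₂))   ≡⟨ total ⟩
          length es                             ∎

      by-origin : Origin T es T₁ i j k → Origin T es T₁ j i l → Visited T e es (exchange e (edge k l) T₁)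
      by-origin (inj₂ (g , adj , s)) _ = by-neighbour adj s
      by-origin (inj₁ _) (inj₂ (g , adj , s)) = by-neighbour (Adjacent-sym adj) s
      by-origin (inj₁ (upper₀ , jk∉ , ki∉)) (inj₁ (lower₀ , il∉ , lj∉)) = record
        { visit     = now (Flippable⇒Flip fl)
        ; remaining = commute emb fl path off
        ; count     = ≡.refl
        ; fs⊆es     = λ g∈ → g∈
        ; unflipped = λ g∈T _ g≢e → Replaces.kept (Flippable.replaces fl) g∈T g≢e
        }
        where
        fl : Flippable T i j k l
        fl = flippable upper₀ lower₀ convex
        off : ∀ {g} → g ∈ es → g ∉ Sides {i} {j} {k} {l}
        off g∈ (here ≡.refl)                                 = e∉es g∈
        off g∈ (there (here ≡.refl))                         = jk∉ g∈
        off g∈ (there (there (here ≡.refl)))                 = ki∉ g∈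
        off g∈ (there (there (there (here ≡.refl))))         = il∉ g∈
        off g∈ (there (there (there (there (here ≡.refl))))) = lj∉ g∈

  -- The visit is followed by further actions from e′, so its end is a proper prefix and has to
  -- satisfy the prefix condition, which is r < s in terms of the remaining actions. For `push`, the
  -- inner visit of g returns to e with the budget for the rest of the visit of e added to r and s;
  -- this keeps the inequality.
  visit-inner : ∀ {T e d T′} → Embedded T → Visit T e d T′ → ∀ r s {e′ w′ κ} → r ℕ.< s →
    value (branch r s T′ e′ w′ κ) ≡ true → value (branch (d ℕ.+ r) (suc d ℕ.+ s) T e (e′ ∷ w′) κ) ≡ true
  visit-inner {T} {e} emb (now f) zero (suc s) {e′} {w′} {κ} _ q =
    whenJust-true⁺ (flipᵗ T e) (λ T′ → branch zero (suc s) T′ e′ w′ κ) (flipᵗ-complete emb f) q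
  visit-inner {T} {e} emb (now f) (suc r) s {e′} {w′} {κ} r<s q = ∨ᵗ-true⁺
    (neighbours T e >>= anyᵗ (λ g → branch r (suc s) T g (e ∷ e′ ∷ w′) κ))
    (inj₂ (guard (dec-true (suc r ℕ.<? s) r<s)
      (whenJust-true⁺ (flipᵗ T e) (λ T′ → branch (suc r) s T′ e′ w′ κ) (flipᵗ-complete emb f) q)))
    where
    guard : ∀ {b m} → b ≡ true → value m ≡ true → value (if b then m else step NO) ≡ true
    guard ≡.refl q = q
  visit-inner {T} {e} emb (push {g = g} {d} {T₁} {d′} g∈ v v′) r s {e′} {w′} {κ} r<s q = ∨ᵗ-true⁺
    (neighbours T e >>= anyᵗ (λ g → branch (d ℕ.+ d′ ℕ.+ r) (suc (suc (d ℕ.+ d′ ℕ.+ s))) T g (e ∷ e′ ∷ w′) κ))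
    (inj₁ (anyᵗ-true⁺ (λ g → branch (d ℕ.+ d′ ℕ.+ r) (suc (suc (d ℕ.+ d′ ℕ.+ s))) T g (e ∷ e′ ∷ w′) κ) g∈
      (≡.subst₂ (λ r s → value (branch r s T g (e ∷ e′ ∷ w′) κ) ≡ true)
        (≡.sym (ℕ.+-assoc d d′ r))
        (≡.cong suc (≡.trans (ℕ.+-suc d (d′ ℕ.+ s)) (≡.cong suc (≡.sym (ℕ.+-assoc d d′ s)))))
        (visit-inner emb v (d′ ℕ.+ r) (suc d′ ℕ.+ s) (s≤s (ℕ.+-monoʳ-≤ d′ (ℕ.<⇒≤ r<s)))
          (visit-inner (path-embedded emb (proj₁ (proj₂ (visit-path v)))) v′ r s r<s q)))))

  -- Here the final flip of e ends the whole action sequence: there is no previous edge to return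
  -- to, and the control passes to κ. Only the inner visits are subject to the prefix condition.
  visit-outer : ∀ {T e d T′ w κ} → Embedded T → Visit T e d T′ → value (κ T′) ≡ true →
                value (branch d (suc d) T e w κ) ≡ true
  visit-outer {T} {e} {κ = κ} emb (now f) q = whenJust-true⁺ (flipᵗ T e) κ (flipᵗ-complete emb f) q
  visit-outer {T} {e} {w = w} {κ} emb (push {g = g} {d} {T₁} {d′} g∈ v v′) q = ∨ᵗ-true⁺
    (neighbours T e >>= anyᵗ (λ g → branch (d ℕ.+ d′) (suc (suc (d ℕ.+ d′))) T g (e ∷ w) κ))
    (inj₁ (anyᵗ-true⁺ (λ g → branch (d ℕ.+ d′) (suc (suc (d ℕ.+ d′))) T g (e ∷ w) κ) g∈
      (≡.subst (λ s → value (branch (d ℕ.+ d′) s T g (e ∷ w) κ) ≡ true) (≡.cong suc (ℕ.+-suc d d′))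
        (visit-inner emb v d′ (suc d′) ℕ.≤-refl
          (visit-outer (path-embedded emb (proj₁ (proj₂ (visit-path v)))) v′ q)))))

  -- For a necessary edge, absent from the target. Cutting at its first flip provides the condition
  -- of `visited` that e is not flipped before.
  split-first : ∀ {T es T′ e} → Path T es T′ → e ∈ T → e ∉ T′ → Split T es T′ e
  split-first (stop (T⊆T′ , _)) e∈T e∉T′ = contradiction (T⊆T′ e∈T) e∉T′
  split-first {e = e} (_∷_ {e = g} f path) e∈T e∉T′ with e ≟ᴱ g
  ... | yes ≡.refl = record { split = ≡.refl ; before = stop ≐-refl ; flipped = f ; rest = path ; g∉before = λ () }
  ... | no e≢g = record
    { split = ≡.cong (g ∷_) S.split ; before = f ∷ S.before ; flipped = S.flipped ; rest = S.rest
    ; g∉before = λ { (here eq) → e≢g eq ; (there x) → S.g∉before x } }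
    where
    module S = Split (split-first path (flip-kept f e∈T e≢g) e∉T′)

  flip-unique : ∀ {T e T′} → Embedded T → Unique T → Flip T e T′ → Unique T′ × length T′ ≡ length T
  flip-unique {T} emb u f with Flip⇒Flippable f
  ... | i , j , k , l , ≡.refl , fl , ≡.refl =
    All.tabulate (λ g∈ kl≡g → AfterFlip.new∉T emb fl
        (≡.subst (_∈ T) (≡.sym kl≡g) (proj₁ (∈-filter⁻ (λ g → ¬? (g ≟ᴱ edge i j)) g∈))))
      ∷ filter⁺ (λ g → ¬? (g ≟ᴱ edge i j)) u
    , length-replace _≟ᴱ_ (edge k l) u (Triangle.ij (Flippable.upper fl))

  path-unique : ∀ {T es T′} → Embedded T → Unique T → Path T es T′ → Unique T′ → length T ≡ length T′
  path-unique emb u (stop (T⊆T′ , T′⊆T)) u′ =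
    ℕ.≤-antisym (Unique-⊆⇒length≤ _≟ᴱ_ u T⊆T′) (Unique-⊆⇒length≤ _≟ᴱ_ u′ T′⊆T)
  path-unique emb u (f ∷ path) u′ =
    let u₁ , len = flip-unique emb u f
    in ≡.trans (≡.sym len) (path-unique (flip-embedded emb f) u₁ path u′)

  visit-unique : ∀ {T e d T′} → Embedded T → Unique T → Visit T e d T′ → Unique T′
  visit-unique emb u (now f) = proj₁ (flip-unique emb u f)
  visit-unique emb u (push _ v v′) =
    visit-unique (path-embedded emb (proj₁ (proj₂ (visit-path v)))) (visit-unique emb u v) v′

  Minimal : List (Edge n) → ℕ → Set ℓ
  Minimal T m = ∀ {es} → Path T es Tend → m ℕ.≤ length es

  -- Strong induction through the bound N, since one iteration consumes `suc V.d` flips at once. It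
  -- holds for every O: whichever necessary edge `pick` returns can be visited. Minimality is
  -- inherited, because a shorter path from `V.T₁`, preceded by the flips of the visit, would
  -- shorten the path from T.
  iterations-complete : ∀ N m {T es} O → m ℕ.< N → Embedded T → Unique T → Unique Tend →
    Path T es Tend → length es ≡ m → Minimal T m →
    ∃[ ks ] Composition m ks × value (iterations ks T O) ≡ true
  iterations-complete (suc N) zero {T} O _ emb u uend (stop (T⊆Tend , Tend⊆T)) _ _ =
    [] , [] , ∧ᵗ-true⁺ (subsetᵗ T Tend) (subsetᵗ-true⁺ T⊆Tend) (subsetᵗ-true⁺ Tend⊆T)
  iterations-complete (suc N) (suc m) {T} {es} O (s≤s m<N) emb u uend path len minimal =
    from-pick (value (pick T O)) ≡.refl
    where
    from-pick : ∀ eO → value (pick T O) ≡ eO →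
        ∃[ ks ] Composition (suc m) ks × value (iterations ks T O) ≡ true
    -- Without a necessary edge T is contained in `Tend`; both have equally many edges, so they
    -- agree, and the empty path contradicts the minimality of `suc m`.
    from-pick nothing eq = contradiction (minimal {[]} (stop (T⊆Tend , Tend⊆T))) λ ()
      where
      T⊆Tend : ∀ {e} → e ∈ T → e ∈ Tend
      T⊆Tend = pick-nothing T O eq
      Tend⊆T : ∀ {e} → e ∈ Tend → e ∈ T
      Tend⊆T = Unique-⊆⇒⊇ _≟ᴱ_ u T⊆Tend (ℕ.≤-reflexive (≡.sym (path-unique emb u path uend)))
    from-pick (just (e , O′)) eq =
      let ks , c , q = iterations-complete N (length (V.fs ++ S.es₂)) O′
            (ℕ.≤-trans (s≤s (ℕ.≤-trans (ℕ.m≤n+m _ V.d) (ℕ.≤-reflexive (ℕ.suc-injective total)))) m<N)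
            emb₁ (visit-unique emb u V.visit) uend (V.remaining ◅◅ S.rest) ≡.refl minimal₁
      in suc V.d ∷ ks , ≡.subst (λ m → Composition m (suc V.d ∷ ks)) total (V.d ∷ c) ,
         whenJust-true⁺ (pick T O) (λ (e , O′) → branch V.d (suc V.d) T e [] (λ T′ → iterations ks T′ O′)) eq
           (visit-outer {w = []} {κ = λ T′ → iterations ks T′ O′} emb V.visit q)
      where
      necessary = pick-sound T O eq
      module S = Split (split-first path (proj₁ necessary) (proj₂ necessary))
      module V = Visited (visited (suc (length S.es₁)) ℕ.≤-refl emb
          (proj₁ necessary) S.g∉before S.before S.flipped)
      walk = visit-path V.visit
      emb₁ = path-embedded emb (proj₁ (proj₂ walk))
      open ≡-Reasoning
      total : suc (V.d ℕ.+ length (V.fs ++ S.es₂)) ≡ suc m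
      total = begin
        suc (V.d ℕ.+ length (V.fs ++ S.es₂))        ≡⟨ ≡.cong (λ x → suc (V.d ℕ.+ x)) (length-++ V.fs) ⟩
        suc (V.d ℕ.+ (length V.fs ℕ.+ length S.es₂))  ≡⟨ ≡.cong suc (ℕ.+-assoc V.d _ _) ⟨
        suc (V.d ℕ.+ length V.fs ℕ.+ length S.es₂)    ≡⟨ ≡.cong (λ x → suc (x ℕ.+ length S.es₂)) V.count ⟩
        suc (length S.es₁ ℕ.+ length S.es₂)            ≡⟨ ℕ.+-suc (length S.es₁) (length S.es₂) ⟨
        length S.es₁ ℕ.+ suc (length S.es₂)            ≡⟨ length-++ S.es₁ ⟨
        length (S.es₁ ++ e ∷ S.es₂)                    ≡⟨ ≡.cong length S.split ⟨
        length es                                      ≡⟨ len ⟩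
        suc m                                          ∎
      minimal₁ : Minimal V.T₁ (length (V.fs ++ S.es₂))
      minimal₁ {fs} path₁ = ℕ.+-cancelˡ-≤ (suc V.d) _ _ (≡.subst₂ ℕ._≤_ (≡.sym total)
        (≡.trans (length-++ (proj₁ walk)) (≡.cong (ℕ._+ length fs) (proj₂ (proj₂ walk))))
        (minimal (proj₁ (proj₂ walk) ◅◅ path₁)))

  search-complete : ∀ {T es k} → Embedded T → Unique T → Unique Tend → Path T es Tend → length es ≡ k →
      Minimal T k →
                    value (search T k) ≡ true
  search-complete {T} {k = k} emb u uend path len minimal =
    let ks , c , q = iterations-complete (suc k) k
            (value (necessaryEdges T)) ℕ.≤-refl emb u uend path len minimal
    in anyᵗ-true⁺ (λ ks → necessaryEdges T >>= iterations ks T) (∈-compositions c) q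

  path⇒sequence : ∀ {T es T′} → Path T es T′ → FlipSequence T (length es) T′
  path⇒sequence (stop T≐T′) = done T≐T′
  path⇒sequence (f ∷ path)  = flip f (path⇒sequence path)

  sequence⇒path : ∀ {T m T′} → FlipSequence T m T′ → ∃[ es ] Path T es T′ × length es ≡ m
  sequence⇒path (done T≐T′) = [] , stop T≐T′ , ≡.refl
  sequence⇒path (flip f s)  = let es , path , len = sequence⇒path s in _ ∷ es , f ∷ path , ≡.cong suc len

  -- Running time.

  module _ (uend : Unique Tend) where
    open Bounds n

    record Good (T : List (Edge n)) : Set ℓ where
      constructor good
      field
        embedded : Embedded T
        unique   : Unique T

      size : length T ≤ edges
      size = unique-edges unique

    open Good

    good-flip : ∀ {T e T′} → Good T → Canonical e → value (flipᵗ T e) ≡ just T′ → Good T′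
    good-flip {T} {e} (good emb u) can q =
      let f = flipᵗ-sound {T} {e} can q in good (flip-embedded emb f) (proj₁ (flip-unique emb u f))

    steps-insideᵗ : ∀ v i j k → steps (insideᵗ v i j k) ≤ 3
    steps-insideᵗ v i j k = steps-∧ᵗ (leftᵗ i j v) {a = 1} ℕ.≤-refl
        (steps-∧ᵗ (leftᵗ j k v) {a = 1} {1} ℕ.≤-refl ℕ.≤-refl)

    steps-convexᵗ : ∀ i j k l → steps (convexᵗ i j k l) ≤ 4
    steps-convexᵗ i j k l = steps-∧ᵗ (leftᵗ i j k) {a = 1} {3} ℕ.≤-refl
        (steps-∧ᵗ (leftᵗ j k l) {a = 1} {2} ℕ.≤-refl
      (steps-∧ᵗ (leftᵗ k l i) {a = 1} {1} ℕ.≤-refl ℕ.≤-refl))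

    steps-triangleᵗ : ∀ {T} i j k → length T ≤ edges → steps (triangleᵗ T i j k) ≤ triangle
    steps-triangleᵗ {T} i j k len =
      steps-∧ᵗ (leftᵗ i j k) {a = 1} ℕ.≤-refl
        (steps-∧ᵗ (memberᵗ (edge i j) T) (steps-memberᵗ (edge i j) T len)
        (steps-∧ᵗ (memberᵗ (edge j k) T) (steps-memberᵗ (edge j k) T len)
        (steps-∧ᵗ (memberᵗ (edge k i) T) (steps-memberᵗ (edge k i) T len)
        (ℕ.+-monoʳ-≤ n (ℕ.≤-trans
          (steps-allᵗ (λ v → notᵗ (insideᵗ v i j k)) {3} (allFin n)
            (λ v → steps-notᵗ (insideᵗ v i j k) (steps-insideᵗ v i j k)))
          (ℕ.≤-reflexive (≡.cong (λ m → suc (m * 4)) (length-allFin n))))))))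

    steps-apexes : ∀ {T} i j → length T ≤ edges → steps (apexes T i j) ≤ apex
    steps-apexes {T} i j len = ℕ.+-monoʳ-≤ n (ℕ.≤-trans
      (steps-filterᵗ (triangleᵗ T i j) {triangle} (allFin n) (λ k → steps-triangleᵗ {T} i j k len))
      (ℕ.≤-reflexive (≡.cong (λ m → suc (m * suc triangle)) (length-allFin n))))

    length-apexes : ∀ {T} i j → Embedded T → length (value (apexes T i j)) ≤ 1
    length-apexes {T} i j emb = at-most-one (value (apexes T i j))
        (unique-filterᵗ (triangleᵗ T i j) (allFin⁺ n))
      λ x∈ y∈ → apex-unique emb (∈-apexes⁻ {T} x∈) (∈-apexes⁻ {T} y∈)
      where
      at-most-one : ∀ (ks : List (Fin n)) → Unique ks → (∀ {x y} → x ∈ ks → y ∈ ks → x ≡ y) → length ks ≤ 1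
      at-most-one []           _             _    = z≤n
      at-most-one (_ ∷ [])     _             _    = ℕ.≤-refl
      at-most-one (x ∷ y ∷ ks) ((x≢y ∷ _) ∷ _) same = contradiction
          (same (here ≡.refl) (there (here ≡.refl))) x≢y

    neighboursOf : Fin n → Fin n → List (Fin n) → List (Fin n) → Timed (List (Edge n))
    neighboursOf i j ks ls =
      appendᵗ ks ls >>= λ ms → mapᵗ (edge i) ms >>= λ es → mapᵗ (edge j) ms >>= λ fs → appendᵗ es fs

    steps-neighboursOf : ∀ i j ks ls → length ks ≤ 1 → length ls ≤ 1 →
        steps (neighboursOf i j ks ls) ≤ 2 + (3 + (3 + 3))
    steps-neighboursOf i j []          []          _ _ = ℕ.m≤n+m 4 7
    steps-neighboursOf i j []          (_ ∷ [])    _ _ = ℕ.m≤n+m 7 4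
    steps-neighboursOf i j (_ ∷ [])    []          _ _ = ℕ.m≤n+m 8 3
    steps-neighboursOf i j (_ ∷ [])    (_ ∷ [])    _ _ = ℕ.≤-refl
    steps-neighboursOf i j (_ ∷ _ ∷ _) _           (s≤s ()) _
    steps-neighboursOf i j []          (_ ∷ _ ∷ _) _ (s≤s ())
    steps-neighboursOf i j (_ ∷ [])    (_ ∷ _ ∷ _) _ (s≤s ())

    length-neighboursOf : ∀ i j ks ls → length ks ≤ 1 → length ls ≤ 1 →
        length (value (neighboursOf i j ks ls)) ≤ 4
    length-neighboursOf i j []          []          _ _ = z≤n
    length-neighboursOf i j []          (_ ∷ [])    _ _ = ℕ.m≤n+m 2 2
    length-neighboursOf i j (_ ∷ [])    []          _ _ = ℕ.m≤n+m 2 2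
    length-neighboursOf i j (_ ∷ [])    (_ ∷ [])    _ _ = ℕ.≤-refl
    length-neighboursOf i j (_ ∷ _ ∷ _) _           (s≤s ()) _
    length-neighboursOf i j []          (_ ∷ _ ∷ _) _ (s≤s ())
    length-neighboursOf i j (_ ∷ [])    (_ ∷ _ ∷ _) _ (s≤s ())

    steps-neighbours : ∀ {T} e → Good T → steps (neighbours T e) ≤ neighbour
    steps-neighbours {T} (i , j) g = ℕ.+-mono-≤ (steps-apexes {T} i j (size g))
        (ℕ.+-mono-≤ (steps-apexes {T} j i (size g))
      (steps-neighboursOf i j (value (apexes T i j)) (value (apexes T j i))
        (length-apexes {T} i j (embedded g)) (length-apexes {T} j i (embedded g))))

    length-neighbours : ∀ {T} e → Good T → length (value (neighbours T e)) ≤ 4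
    length-neighbours {T} (i , j) g = length-neighboursOf i j (value (apexes T i j)) (value (apexes T j i))
      (length-apexes {T} i j (embedded g)) (length-apexes {T} j i (embedded g))

    steps-flipQuadrilateral : ∀ {T} e ks ls → length T ≤ edges →
        steps (flipQuadrilateral T e ks ls) ≤ 4 + member
    steps-flipQuadrilateral {T} (i , j) (k ∷ _) (l ∷ _) len =
      ℕ.+-mono-≤ (steps-convexᵗ i l j k) (by-convexity (value (convexᵗ i l j k)))
      where
      by-convexity : ∀ b → steps (exchangeIf T (i , j) (edge k l) b) ≤ member
      by-convexity true  = ℕ.≤-trans (ℕ.≤-reflexive (ℕ.+-identityʳ _)) (ℕ.≤-trans
        (steps-filterᵗ (λ f → step (not (does (f ≟ᴱ (i , j))))) T (λ _ → ℕ.≤-refl)) (s≤s (ℕ.*-monoˡ-≤ 2 len)))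
      by-convexity false = z≤n
    steps-flipQuadrilateral e []       _  _ = s≤s z≤n
    steps-flipQuadrilateral e (_ ∷ _) []  _ = s≤s z≤n

    steps-flipᵗ : ∀ {T} e → length T ≤ edges → steps (flipᵗ T e) ≤ flipping
    steps-flipᵗ {T} (i , j) len = ℕ.+-mono-≤ (steps-apexes {T} i j len) (ℕ.+-mono-≤ (steps-apexes {T} j i len)
      (steps-flipQuadrilateral (i , j) (value (apexes T i j)) (value (apexes T j i)) len))

    steps-whenJust : ∀ {A : Set} (m : Timed (Maybe A)) κ {a b} → steps m ≤ a → (∀ {x} →
        value m ≡ just x → steps (κ x) ≤ b) →
                     steps (whenJust m κ) ≤ suc (a + b)
    steps-whenJust m κ p q with value m
    ... | just x  = s≤s (ℕ.+-mono-≤ p (q ≡.refl))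
    ... | nothing = s≤s (ℕ.+-mono-≤ p z≤n)

    steps-flipBack : ∀ {T e} w κ {b} → Good T → Canonical e → All Canonical w →
      (∀ {T′ e′ w′} → Good T′ → Canonical e′ → All Canonical w′ → steps (κ T′ e′ w′) ≤ b) →
      steps (flipBack T e w κ) ≤ suc flipping + b
    steps-flipBack         []       κ g can _              p = s≤s z≤n
    steps-flipBack {T} {e} (e′ ∷ w) κ g can (can′ ∷ can-w) p =
      steps-whenJust (flipᵗ T e) (λ T′ → κ T′ e′ w) (steps-flipᵗ e (size g)) λ q → p
          (good-flip g can q) can′ can-w

    -- A node with r and s actions left costs at most node steps besides its at most
    -- four moves and one flip.  Adding node to the cost on the left of steps-branch
    -- makes the recurrence t (r + 1) (s + 1) ≤ node + 4 t r (s + 1) + t (r + 1) s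
    -- close.
    weight : ℕ → ℕ → ℕ
    weight r s = 8 ^ r * 2 ^ s

    module _ (κ : List (Edge n) → Timed Bool) {X : ℕ} (node<X : node ℕ.< X)
             (leaf : ∀ {T} → Good T → steps (κ T) + node ≤ X) where
      open ℕ.≤-Reasoning

      private
        branching≤node : neighbour + suc flipping + 6 ≤ node
        branching≤node = ℕ.m≤m+n (neighbour + suc flipping + 6) (suc picking + (subset + subset))

        flipping≤node : suc flipping ≤ node
        flipping≤node = ℕ.≤-trans (ℕ.m≤n+m (suc flipping) neighbour)
          (ℕ.≤-trans (ℕ.m≤m+n (neighbour + suc flipping) 6) branching≤node)

        X≤ : ∀ r s → X ≤ weight r s * X
        X≤ r s = ℕ.m≤n*m X (weight r s) {{ℕ.m*n≢0 (8 ^ r) (2 ^ s) {{ℕ.m^n≢0 8 r}} {{ℕ.m^n≢0 2 s}}}}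

      steps-branch : ∀ r s {T e w} → Good T → Canonical e → All Canonical w →
                     steps (branch r s T e w κ) + node ≤ weight r s * X
      -- The strict inequality `node<X` pays for the single step of answering NO.
      steps-branch r zero _ _ _ = ℕ.≤-trans node<X (X≤ r zero)
      steps-branch zero (suc zero) {T} {e} g can can-w = begin
        steps (whenJust (flipᵗ T e) κ) + node  ≤⟨ ℕ.+-monoˡ-≤ node
            (steps-whenJust (flipᵗ T e) κ {b = X ℕ.∸ node} (steps-flipᵗ e (size g))
                                                   (λ q → ℕ.m+n≤o⇒m≤o∸n _ (leaf (good-flip g can q)))) ⟩
        suc flipping + (X ℕ.∸ node) + node     ≡⟨ ≡.trans (ℕ.+-assoc (suc flipping) _ node)
            (≡.cong (suc flipping +_) (ℕ.m∸n+n≡m (ℕ.<⇒≤ node<X))) ⟩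
        suc flipping + X                       ≤⟨ ℕ.+-monoˡ-≤ X (ℕ.≤-trans flipping≤node (ℕ.<⇒≤ node<X)) ⟩
        X + X                                  ≡⟨ solve 1 (λ x → x :+ x := con 2 :* x) ≡.refl X ⟩
        2 * X                                  ∎
        where open +-*-Solver
      steps-branch zero (suc (suc s)) {T} {e} {w} g can can-w = begin
        steps (flipBack T e w (λ T′ e′ w′ → branch zero (suc s) T′ e′ w′ κ)) + node
          ≤⟨ ℕ.+-monoˡ-≤ node (steps-flipBack {T} {e} w _ g can can-w λ g′ can′ can-w′ → ℕ.m+n≤o⇒m≤o∸n _
              (steps-branch zero (suc s) g′ can′ can-w′)) ⟩
        suc flipping + (B ℕ.∸ node) + node
          ≡⟨ ≡.trans (ℕ.+-assoc (suc flipping) _ node) (≡.cong (suc flipping +_) (ℕ.m∸n+n≡m node≤B)) ⟩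
        suc flipping + B
          ≤⟨ ℕ.+-monoˡ-≤ B (ℕ.≤-trans flipping≤node node≤B) ⟩
        B + B
          ≡⟨ solve 2 (λ p x → (p :+ con 0) :* x :+ (p :+ con 0) :* x :=
              (con 2 :* p :+ con 0) :* x) ≡.refl (2 ^ suc s) X ⟩
        weight zero (suc (suc s)) * X ∎
        where
        open +-*-Solver
        B : ℕ
        B = weight zero (suc s) * X
        node≤B : node ≤ B
        node≤B = ℕ.≤-trans (ℕ.<⇒≤ node<X) (X≤ zero (suc s))
      steps-branch (suc r) (suc s) {T} {e} {w} g can can-w = begin
        steps (branch (suc r) (suc s) T e w κ) + node
          ≤⟨ ℕ.+-monoˡ-≤ node (steps-∨ᵗ (neighbours T e >>= anyᵗ
              (λ g → branch r (suc s) T g (e ∷ w) κ)) moves flips) ⟩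
        neighbour + (5 + 4 * b₁) + (suc flipping + b₂) + node
          ≤⟨ ℕ.m≤n+m _ 1 ⟩
        suc (neighbour + (5 + 4 * b₁) + (suc flipping + b₂) + node)
          ≡⟨ solve 5 (λ x y u v m → con 1 :+ (x :+ (con 5 :+ con 4 :* u) :+ (y :+ v) :+ m) :=
              (x :+ y :+ con 6) :+ (con 4 :* u :+ v :+ m)) ≡.refl neighbour (suc flipping) b₁ b₂ node ⟩
        (neighbour + suc flipping + 6) + (4 * b₁ + b₂ + node)
          -- One `node` already covers the overhead. Four are charged, one for each move, so that
          -- every `b₁` becomes `b₁ + node`; the `node` on the left does the same for `b₂`.
          ≤⟨ ℕ.+-monoˡ-≤ (4 * b₁ + b₂ + node) (ℕ.≤-trans branching≤node (ℕ.m≤m+n node (3 * node))) ⟩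
        4 * node + (4 * b₁ + b₂ + node)
          ≡⟨ solve 3 (λ u v m → con 4 :* m :+ (con 4 :* u :+ v :+ m) := con 4 :* (u :+ m) :+
              (v :+ m)) ≡.refl b₁ b₂ node ⟩
        4 * (b₁ + node) + (b₂ + node)
          ≡⟨ ≡.cong₂ (λ u v → 4 * u + v) (ℕ.m∸n+n≡m (ℕ.≤-trans (ℕ.<⇒≤ node<X) (X≤ r (suc s))))
              (ℕ.m∸n+n≡m (ℕ.≤-trans (ℕ.<⇒≤ node<X) (X≤ (suc r) s))) ⟩
        -- The bases 8 and 2 are chosen for this: four moves contribute 4/8 and the flip 1/2 of the
        -- weight of the node.
        4 * (weight r (suc s) * X) + weight (suc r) s * X
          ≡⟨ solve 3 (λ p q x → con 4 :* (p :* (con 2 :* q) :* x) :+ (con 8 :* p) :* q :* x :=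
              (con 8 :* p) :* (con 2 :* q) :* x) ≡.refl (8 ^ r) (2 ^ s) X ⟩
        weight (suc r) (suc s) * X ∎
        where
        open +-*-Solver
        b₁ b₂ : ℕ
        b₁ = weight r (suc s) * X ℕ.∸ node
        b₂ = weight (suc r) s * X ℕ.∸ node
        moves : steps (neighbours T e >>= anyᵗ (λ g →
            branch r (suc s) T g (e ∷ w) κ)) ≤ neighbour + (5 + 4 * b₁)
        moves = ℕ.+-mono-≤ (steps-neighbours {T} e g) (ℕ.≤-trans
          (steps-anyᵗ (λ g → branch r (suc s) T g (e ∷ w) κ) {b₁} (value (neighbours T e)) λ f∈ →
            ℕ.m+n≤o⇒m≤o∸n _ (steps-branch r (suc s) g (neighbours-canonical {T} {e} f∈) (can ∷ can-w)))
          (ℕ.≤-trans (s≤s (ℕ.*-monoˡ-≤ (suc b₁) (length-neighbours {T} e g)))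
            (ℕ.≤-reflexive (solve 1 (λ x → con 1 :+ con 4 :*
                (con 1 :+ x) := con 5 :+ con 4 :* x) ≡.refl b₁))))
        guarded : ∀ b {m c} → steps m ≤ suc c → steps (if b then m else step NO) ≤ suc c
        guarded true  p = p
        guarded false p = s≤s z≤n
        flips : steps (if does (suc r ℕ.<? s) then flipBack T e w (λ T′ e′ w′ →
            branch (suc r) s T′ e′ w′ κ) else step NO)
                ≤ suc flipping + b₂
        flips = guarded (does (suc r ℕ.<? s)) (steps-flipBack {T} {e} w _ g can can-w λ g′ can′ can-w′ →
          ℕ.m+n≤o⇒m≤o∸n _ (steps-branch (suc r) s g′ can′ can-w′))

    steps-nextNecessary : ∀ T O → length T ≤ edges → length Tend ≤ edges →
                          steps (nextNecessary T O) ≤ suc (length O * suc (member + member))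
    steps-nextNecessary T []      _   _    = ℕ.≤-refl
    steps-nextNecessary T (e ∷ O) len len′ = s≤s (ℕ.≤-trans
      (ℕ.+-mono-≤
        (steps-∧ᵗ (memberᵗ e T) (steps-memberᵗ e T len)
            (steps-notᵗ (memberᵗ e Tend) (steps-memberᵗ e Tend len′)))
        (continue (value (memberᵗ e T ∧ᵗ notᵗ (memberᵗ e Tend)))))
      (ℕ.≤-reflexive (ℕ.+-suc (member + member) _)))
      where
      continue : ∀ b → steps (if b then return (just (e , O)) else nextNecessary T O) ≤ suc
          (length O * suc (member + member))
      continue true  = z≤n
      continue false = steps-nextNecessary T O len len′

    length-nextNecessary : ∀ T O {e O′} → value (nextNecessary T O) ≡ just (e , O′) → length O′ ≤ length O
    length-nextNecessary T (f ∷ O) {e} {O′} = continue (value (memberᵗ f T ∧ᵗ notᵗ (memberᵗ f Tend)))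
      where
      continue : ∀ b → value (if b then return (just (f , O)) else nextNecessary T O) ≡ just (e , O′) →
          length O′ ≤ suc (length O)
      continue true  ≡.refl = ℕ.n≤1+n _
      continue false q      = ℕ.m≤n⇒m≤1+n (length-nextNecessary T O q)

    isNecessary : Edge n → Timed Bool
    isNecessary e = notᵗ (memberᵗ e Tend)

    length-necessaryEdges : ∀ {T} → length T ≤ edges → length (value (necessaryEdges T)) ≤ edges
    length-necessaryEdges {T} len = ℕ.≤-trans
      (ℕ.≤-reflexive (length-sortᵗ (value (filterᵗ isNecessary T))))
      (ℕ.≤-trans (length-filterᵗ isNecessary T) len)

    steps-necessaryEdges : ∀ {T} → length T ≤ edges → length Tend ≤ edges →
        steps (necessaryEdges T) ≤ necessary
    steps-necessaryEdges {T} len len′ = ℕ.+-mono-≤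
      (ℕ.≤-trans (steps-filterᵗ isNecessary {member} T
          (λ e → steps-notᵗ (memberᵗ e Tend) (steps-memberᵗ e Tend len′)))
        (s≤s (ℕ.*-monoˡ-≤ (suc member) len)))
      (ℕ.≤-trans (steps-sortᵗ (value (filterᵗ isNecessary T)) filtered)
          (s≤s (ℕ.*-monoˡ-≤ (suc (suc edges)) filtered)))
      where
      filtered : length (value (filterᵗ isNecessary T)) ≤ edges
      filtered = ℕ.≤-trans (length-filterᵗ isNecessary T) len

    steps-orElse : ∀ m m′ {a b} → steps m ≤ a → steps m′ ≤ b → steps (orElse m m′) ≤ a + (b + 1)
    steps-orElse m m′ p q with value m
    ... | just _  = ℕ.+-mono-≤ p z≤n
    ... | nothing = ℕ.+-mono-≤ p (ℕ.+-monoˡ-≤ 1 q)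

    steps-pick : ∀ {T O} → Good T → length O ≤ edges → steps (pick T O) ≤ picking
    steps-pick {T} {O} g len = steps-orElse (nextNecessary T O) (necessaryEdges T)
      (ℕ.≤-trans (steps-nextNecessary T O (size g) (unique-edges uend))
          (s≤s (ℕ.*-monoˡ-≤ (suc (member + member)) len)))
      (steps-necessaryEdges {T} (size g) (unique-edges uend))

    length-pick : ∀ {T O e O′} → Good T → length O ≤ edges → value (pick T O) ≡ just (e , O′) →
        length O′ ≤ edges
    length-pick {T} {O} g len q =
      [ (λ r → ℕ.≤-trans (length-nextNecessary T O r) len)
      , (λ r → ℕ.≤-trans (ℕ.n≤1+n _)
          (ℕ.≤-trans (ℕ.≤-reflexive (≡.cong length (≡.sym r))) (length-necessaryEdges {T} (size g))))
      ]′ (orElse-just (nextNecessary T O) (necessaryEdges T) q)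

    private
      Q : ℕ
      Q = node + node

      checking≤node : suc picking + (subset + subset) ≤ node
      checking≤node = ℕ.m≤n+m (suc picking + (subset + subset)) (neighbour + suc flipping + 6)

      necessary≤node : necessary ≤ node
      necessary≤node = ℕ.≤-trans (ℕ.≤-trans (ℕ.m≤m+n necessary 1) (ℕ.m≤n+m (necessary + 1) next))
        (ℕ.≤-trans (ℕ.≤-trans (ℕ.n≤1+n picking) (ℕ.m≤m+n (suc picking) (subset + subset))) checking≤node)

      node<Q : node ℕ.< Q
      node<Q = ℕ.m<m+n node (ℕ.≤-trans (s≤s z≤n) checking≤node)

      16^≢0 : ∀ m → ℕ.NonZero (16 ^ m)
      16^≢0 m = ℕ.m^n≢0 16 m

    -- The search for a part d + 1 multiplies the cost of the later iterations by 2 · 16^d. Picking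
    -- the edge is charged the same amount once more, and the sum 4 · 16^d stays below 16^(d+1). The
    -- summand `node` on the left is the form in which `steps-branch` takes the cost of its leaves.
    steps-iterations : ∀ {m ks T O} → Composition m ks → Good T → length O ≤ edges →
                       steps (iterations ks T O) + node ≤ 16 ^ m * Q
    steps-iterations {T = T} {O} [] g len = begin
      steps (subsetᵗ T Tend ∧ᵗ subsetᵗ Tend T) + node
        ≤⟨ ℕ.+-monoˡ-≤ node (steps-∧ᵗ (subsetᵗ T Tend)
            (steps-subsetᵗ T Tend (size g) (unique-edges uend))
                (steps-subsetᵗ Tend T (unique-edges uend) (size g))) ⟩
      subset + subset + node
        ≤⟨ ℕ.+-monoˡ-≤ node (ℕ.≤-trans (ℕ.m≤n+m (subset + subset) (suc picking)) checking≤node) ⟩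
      Q      ≡⟨ ℕ.+-identityʳ Q ⟨
      1 * Q  ∎
      where open ℕ.≤-Reasoning
    steps-iterations {T = T} {O} (_∷_ {m} {ks} d c) g len = begin
      steps (iterations (suc d ∷ ks) T O) + node
        ≤⟨ ℕ.+-monoˡ-≤ node (steps-whenJust (pick T O)
            (λ (e , O′) → branch d (suc d) T e [] (λ T′ → iterations ks T′ O′))
             {b = B ℕ.∸ node} (steps-pick {T} {O} g len) λ
                 { {e , O′} q → ℕ.m+n≤o⇒m≤o∸n _ (steps-branch (λ T′ → iterations ks T′ O′)
               (ℕ.<-≤-trans node<Q (ℕ.m≤n*m Q (16 ^ m) {{16^≢0 m}}))
               (λ g′ → steps-iterations c g′ (length-pick {T} {O} g len q))
               d (suc d) {w = []} g (canonical (embedded g) (proj₁ (pick-sound T O q))) []) }) ⟩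
      suc picking + (B ℕ.∸ node) + node
        ≡⟨ ≡.trans (ℕ.+-assoc (suc picking) _ node)
            (≡.cong (suc picking +_) (ℕ.m∸n+n≡m (ℕ.≤-trans node≤Z Z≤B))) ⟩
      suc picking + B
        ≤⟨ ℕ.+-monoˡ-≤ B (ℕ.≤-trans (ℕ.≤-trans (ℕ.m≤m+n (suc picking) (subset + subset)) checking≤node)
            (ℕ.≤-trans node≤Z Z≤B)) ⟩
      B + B
        ≡⟨ ≡.cong (λ w → w * Z + w * Z) weight-16 ⟩
      2 * 16 ^ d * Z + 2 * 16 ^ d * Z
        -- The slack: 16 - 2 - 2 = 12.
        ≤⟨ ℕ.m≤m+n _ (12 * 16 ^ d * Z) ⟩
      2 * 16 ^ d * Z + 2 * 16 ^ d * Z + 12 * 16 ^ d * Z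
        ≡⟨ solve 3 (λ p q x → con 2 :* p :* (q :* x) :+ con 2 :* p :* (q :* x) :+ con 12 :* p :*
            (q :* x) := con 16 :* (p :* q) :* x) ≡.refl (16 ^ d) (16 ^ m) Q ⟩
      16 * (16 ^ d * 16 ^ m) * Q
        ≡⟨ ≡.cong (λ x → 16 * x * Q) (ℕ.^-distribˡ-+-* 16 d m) ⟨
      16 ^ (suc d + m) * Q ∎
      where
      open ℕ.≤-Reasoning
      open +-*-Solver
      Z B : ℕ
      Z = 16 ^ m * Q
      B = weight d (suc d) * Z
      node≤Z : node ≤ Z
      node≤Z = ℕ.≤-trans (ℕ.<⇒≤ node<Q) (ℕ.m≤n*m Q (16 ^ m) {{16^≢0 m}})
      weight-16 : weight d (suc d) ≡ 2 * 16 ^ d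
      weight-16 = ≡.trans (solve 2 (λ p q → p :* (con 2 :* q) := con 2 :* (p :* q)) ≡.refl (8 ^ d) (2 ^ d))
        (≡.cong (2 *_) (≡.sym (^-distribʳ-* d 8 2)))
      Z≤B : Z ≤ B
      Z≤B = ℕ.m≤n*m Z (weight d (suc d))
          {{≡.subst ℕ.NonZero (≡.sym weight-16) (ℕ.m*n≢0 2 (16 ^ d) {{_}} {{16^≢0 d}})}}

    -- The summand 8 collects the costs proportional to the number of compositions: 6 for generating
    -- them, 1 for visiting each in `anyᵗ`, and 1 for absorbing the final step of `anyᵗ`.
    steps-search : ∀ {T} k → Good T → steps (search T k) ≤ (8 + Q) * 32 ^ k
    steps-search {T} k g = begin
      steps (search T k)
        ≤⟨ ℕ.+-mono-≤ (steps-compositions k) (ℕ.≤-trans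
             (steps-anyᵗ (λ ks → necessaryEdges T >>= iterations ks T) {16 ^ k * Q}
                 (value (compositions k)) each)
             (s≤s (ℕ.*-monoˡ-≤ (suc (16 ^ k * Q)) (length-compositions k)))) ⟩
      6 * 2 ^ k + suc (2 ^ k * suc (16 ^ k * Q))
        ≤⟨ ℕ.+-monoʳ-≤ (6 * 2 ^ k) (ℕ.+-monoˡ-≤ _ (ℕ.m^n>0 2 k)) ⟩
      6 * 2 ^ k + (2 ^ k + 2 ^ k * suc (16 ^ k * Q))
        ≡⟨ solve 3 (λ x y q → con 6 :* x :+ (x :+ x :* (con 1 :+ y :* q)) := con 8 :*
            (x :* con 1) :+ q :* (x :* y)) ≡.refl (2 ^ k) (16 ^ k) Q ⟩
      8 * (2 ^ k * 1) + Q * (2 ^ k * 16 ^ k)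
        ≤⟨ ℕ.+-monoˡ-≤ _ (ℕ.*-monoʳ-≤ 8 (ℕ.*-monoʳ-≤ (2 ^ k) (ℕ.m^n>0 16 k))) ⟩
      8 * (2 ^ k * 16 ^ k) + Q * (2 ^ k * 16 ^ k)
        ≡⟨ ℕ.*-distribʳ-+ (2 ^ k * 16 ^ k) 8 Q ⟨
      (8 + Q) * (2 ^ k * 16 ^ k)
        ≡⟨ ≡.cong ((8 + Q) *_) (^-distribʳ-* k 2 16) ⟨
      (8 + Q) * 32 ^ k ∎
      where
      open ℕ.≤-Reasoning
      open +-*-Solver
      each : ∀ {ks} → ks ∈ value (compositions k) → steps (necessaryEdges T >>= iterations ks T) ≤ 16 ^ k * Q
      each {ks} ks∈ = begin
        steps (necessaryEdges T) + steps (iterations ks T (value (necessaryEdges T)))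
          ≤⟨ ℕ.+-monoˡ-≤ _ (ℕ.≤-trans (steps-necessaryEdges {T} (size g)
              (unique-edges uend)) necessary≤node) ⟩
        node + steps (iterations ks T (value (necessaryEdges T)))
          ≡⟨ ℕ.+-comm node _ ⟩
        steps (iterations ks T (value (necessaryEdges T))) + node
          ≤⟨ steps-iterations (∈-compositions⁻ k ks∈) g (length-necessaryEdges {T} (size g)) ⟩
        16 ^ k * Q ∎

-- Correctness and time bound for an instance.

module _ {a ℓ} {F : OrderedField a ℓ} (I : Instance F) where
  open Instance I
  open Correctness F p distinct Tend

  Tstart-embedded : Embedded Tstart
  Tstart-embedded = planar⇒embedded (IsTriangulation.planar triStart)

  FLIPDT-complete : IsFlipDistance Tstart Tend k → value (FLIPDT I) ≡ YES
  FLIPDT-complete (s , minimal) =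
    let es , path , len = sequence⇒path s
    in search-complete Tstart-embedded (IsTriangulation.unique triStart)
            (IsTriangulation.unique triEnd) path len
         λ {fs} path′ → ℕ.≮⇒≥ λ fs<k → minimal (length fs) fs<k (path⇒sequence path′)

  FLIPDT-sound : value (FLIPDT I) ≡ YES → FlipSequence Tstart k Tend
  FLIPDT-sound q =
    let es , path , len = search-sound Tstart-embedded q
    in ≡.subst (λ m → FlipSequence Tstart m Tend) len (path⇒sequence path)

  FLIPDT-steps : steps (FLIPDT I) ≤ (8 + (Bounds.node n + Bounds.node n)) * 32 ^ k
  FLIPDT-steps = steps-search (IsTriangulation.unique triEnd) k
      (good Tstart-embedded (IsTriangulation.unique triStart))

-- The left side is a polynomial of degree 4 in n with constant term 76. Subtracting it from 76 (1 +
-- n)^4 leaves n (248 + 390 n + 256 n² + 54 n³), whose coefficients are nonnegative.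
node-polynomial : ∀ n → 8 + (Bounds.node n + Bounds.node n) ≤ 76 * suc n ^ 4
node-polynomial n = ℕ.≤-trans (ℕ.m≤m+n _ _) (ℕ.≤-reflexive (solve 1 (λ n →
  let edges     = n :* n
      member    = con 1 :+ edges :* con 2
      triangle  = con 1 :+ (member :+ (member :+ (member :+ (n :+ (con 1 :+ n :* con 4)))))
      apex      = n :+ (con 1 :+ n :* (con 1 :+ triangle))
      neighbour = apex :+ (apex :+ con 11)
      flipping  = apex :+ (apex :+ (con 4 :+ member))
      next      = con 1 :+ edges :* (con 1 :+ (member :+ member))
      necessary = (con 1 :+ edges :* (con 1 :+ member)) :+ (con 1 :+ edges :* (con 2 :+ edges))
      picking   = next :+ (necessary :+ con 1)
      subset    = con 1 :+ edges :* (con 1 :+ member)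
      node      = (neighbour :+ (con 1 :+ flipping) :+ con 6) :+ ((con 1 :+ picking) :+ (subset :+ subset))
      1+n       = con 1 :+ n
  in (con 8 :+ (node :+ node)) :+ n :* (con 248 :+ n :* (con 390 :+ n :* (con 256 :+ n :* con 54)))
     := con 76 :* (1+n :* (1+n :* (1+n :* (1+n :* con 1))))) ≡.refl n))
  where open +-*-Solver

-- At k = 0 the product vanishes and the maximum supplies 32^0 = 1; otherwise k is at least 1.
32^k≤1⊔k*32^k : ∀ k → 32 ^ k ≤ 1 ℕ.⊔ k * 32 ^ k
32^k≤1⊔k*32^k zero    = s≤s z≤n
32^k≤1⊔k*32^k (suc k) = ℕ.≤-trans (ℕ.m≤m+n (32 ^ suc k) (k * 32 ^ suc k)) (ℕ.m≤n⊔m 1 _)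

≢true⇒false : ∀ {b} → b ≢ true → b ≡ false
≢true⇒false {false} _  = ≡.refl
≢true⇒false {true}  ≢ = contradiction ≡.refl ≢

theorem2 : ∀ {a ℓ} (F : OrderedField a ℓ) → let open Instance {F = F} in
    ((I : Instance F) →
    (IsFlipDistance I (Tstart I) (Tend I) (k I) → value (FLIPDT I) ≡ YES) ×
    (¬ FlipSequence I (Tstart I) (k I) (Tend I) → value (FLIPDT I) ≡ NO))
    × O* n (λ I → steps (FLIPDT I)) (λ I → k I * 32 ^ k I)
theorem2 F =
  (λ I → FLIPDT-complete I , λ ¬sequence → ≢true⇒false (¬sequence ∘ FLIPDT-sound I))
  , 76 , 4 , λ I → ℕ.≤-trans (FLIPDT-steps I)
      (ℕ.*-mono-≤ (node-polynomial (Instance.n I)) (32^k≤1⊔k*32^k (Instance.k I)))
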